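{- Let $n\ge 5$ be an integer. If the wheel graph $W_n$ on $n$ vertices is geodesic Leech, then $n\le 40$.
   Context: Graphs are finite, simple, undirected and connected. A geodesic of a graph $G$ is a shortest path between two distinct vertices; a path and its reverse are regarded as the same, but distinct shortest paths with the same endpoints are counted separately. Let $t_{gp}(G)$ be the number of geodesics of $G$. For an edge labeling $f:E(G)\to\{1,2,3,\ldots\}$, the weight of a path is the sum of the labels of its edges. The labeling $f$ is a geodesic Leech labeling if the multiset of the weights of all geodesics of $G$ is exactly $\{1,2,\ldots,t_{gp}(G)\}$, each value occurring once. A graph is geodesic Leech if it admits a geodesic Leech labeling. $W_n$ denotes the wheel on $n$ vertices: a hub joined to every vertex of a cycle of length $n-1$. -}

module Defs where

open import Data.Empty using (⊥)
open import Data.Fin as Fin using (Fin; zero; suc; toℕ)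
import Data.Fin.Properties as Fin
open import Data.List using (List; []; _∷_; length; map; filter; concatMap;
  cartesianProduct; cartesianProductWith; allFin; upTo; head; last; lookup)
open import Data.List.Membership.Propositional using (_∈_; lose; find)
open import Data.List.Membership.Propositional.Properties using
  (∈-allFin; ∈-cartesianProduct⁺; ∈-cartesianProductWith⁺; ∈-concatMap⁺;
   ∈-concatMap⁻; ∈-filter⁺; ∈-filter⁻; ∈-lookup)
open import Data.List.Relation.Binary.Permutation.Propositional using (_↭_)
open import Data.List.Relation.Unary.All as All using (All)
open import Data.List.Relation.Unary.Any using (here; there)
open import Data.List.Relation.Unary.AllPairs using (_∷_)
open import Data.List.Relation.Unary.Linked using (Linked; linked?)
open import Data.List.Relation.Unary.Unique.Propositional using (Unique)
import Data.List.Relation.Unary.Unique.DecPropositional as DecUnique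
open import Data.Maybe using (just)
import Data.Maybe.Properties as Maybe
open import Data.Nat using (ℕ; zero; suc; _+_; _≤_; s≤s; _≤?_)
import Data.Nat.Properties as ℕ
open import Data.Product using (Σ-syntax; ∃₂; _×_; _,_; proj₁; proj₂; uncurry)
open import Data.Sum using (_⊎_; swap)
open import Data.Unit using (⊤; tt)
open import Function using (_∘_)
open import Function.Definitions using (Injective)
open import Level using (0ℓ)
open import Relation.Binary using (Rel; Symmetric; Irreflexive; Decidable)
open import Relation.Binary.Construct.Closure.ReflexiveTransitive using (Star; ε; _◅_)
open import Relation.Binary.PropositionalEquality
open import Relation.Nullary using (Dec; yes; no; contradiction)
open import Relation.Nullary.Decidable using (map′; _×-dec_; _⊎-dec_; _→-dec_; ¬?)

record Graph : Set₁ where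
  field
    order      : ℕ
    Adj        : Rel (Fin order) 0ℓ
    adj?       : Decidable Adj
    adj-sym    : Symmetric Adj
    adj-irrefl : Irreflexive _≡_ Adj
    connected  : ∀ u v → Star Adj u v

  Vertex : Set
  Vertex = Fin order

-- All lists over Fin n of length at most k, each exactly once.
listsUpTo : (n k : ℕ) → List (List (Fin n))
listsUpTo n zero    = [] ∷ []
listsUpTo n (suc k) = [] ∷ cartesianProductWith _∷_ (allFin n) (listsUpTo n k)

∈-listsUpTo : ∀ {n k} (xs : List (Fin n)) → length xs ≤ k → xs ∈ listsUpTo n k
∈-listsUpTo {k = zero}  []       _         = here refl
∈-listsUpTo {k = suc _} []       _         = here refl
∈-listsUpTo {k = suc _} (x ∷ xs) (s≤s len) =
  there (∈-cartesianProductWith⁺ _∷_ (∈-allFin x) (∈-listsUpTo xs len))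

Unique⇒lookup-injective : ∀ {A : Set} {xs : List A} → Unique xs →
                          Injective _≡_ _≡_ (lookup xs)
Unique⇒lookup-injective (_ ∷ _)  {zero}  {zero}  _  = refl
Unique⇒lookup-injective (x∉ ∷ _) {zero}  {suc j} eq =
  contradiction eq (All.lookup x∉ (∈-lookup j))
Unique⇒lookup-injective (x∉ ∷ _) {suc i} {zero}  eq =
  contradiction (sym eq) (All.lookup x∉ (∈-lookup i))
Unique⇒lookup-injective (_ ∷ u)  {suc i} {suc j} eq =
  cong suc (Unique⇒lookup-injective u eq)

module _ (G : Graph) where
  open Graph G

  -- A path is given by its sequence of vertices.
  IsPath : Vertex → Vertex → List Vertex → Set
  IsPath u v xs = head xs ≡ just u × last xs ≡ just v × Linked Adj xs × Unique xs

  IsGeodesic : Vertex → Vertex → List Vertex → Set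
  IsGeodesic u v xs =
    u ≢ v × IsPath u v xs × (∀ ys → IsPath u v ys → length xs ≤ length ys)

  isPath? : ∀ u v xs → Dec (IsPath u v xs)
  isPath? u v xs =
    Maybe.≡-dec Fin._≟_ (head xs) (just u) ×-dec
    Maybe.≡-dec Fin._≟_ (last xs) (just v) ×-dec
    linked? adj? xs ×-dec
    DecUnique.unique? Fin._≟_ xs

  isGeodesic? : ∀ u v xs → Dec (IsGeodesic u v xs)
  isGeodesic? u v xs = ¬? (u Fin.≟ v) ×-dec isPath? u v xs ×-dec minimal?
    where
    Shorter : List Vertex → Set
    Shorter ys = IsPath u v ys → length xs ≤ length ys

    extend : All Shorter (listsUpTo order (length xs)) → ∀ ys → Shorter ys
    extend all ys p with length xs ≤? length ys
    ... | yes le = le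
    ... | no ¬le = All.lookup all (∈-listsUpTo ys (ℕ.<⇒≤ (ℕ.≰⇒> ¬le))) p

    minimal? : Dec (∀ ys → Shorter ys)
    minimal? = map′ extend (λ h → All.tabulate λ {ys} _ → h ys)
      (All.all? (λ ys → isPath? u v ys →-dec (length xs ≤? length ys))
                (listsUpTo order (length xs)))

  orderedPairs : List (Vertex × Vertex)
  orderedPairs =
    filter (uncurry Fin._<?_) (cartesianProduct (allFin order) (allFin order))

  geodesicsBetween : Vertex × Vertex → List (List Vertex)
  geodesicsBetween (u , v) = filter (isGeodesic? u v) (listsUpTo order order)

  -- The geodesics of G, each exactly once: since a path is identified with its
  -- reverse, it is listed only in the direction from the smaller to the larger
  -- endpoint.  The cut-off of the vertex count at the order of G loses nothing,
  -- as ∈-geodesics⁺ shows.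
  geodesics : List (List Vertex)
  geodesics = concatMap geodesicsBetween orderedPairs

  length-path : ∀ {u v xs} → IsPath u v xs → length xs ≤ order
  length-path (_ , _ , _ , unique) =
    Fin.injective⇒≤ (Unique⇒lookup-injective unique)

  ∈-geodesics⁺ : ∀ {u v xs} → u Fin.< v → IsGeodesic u v xs → xs ∈ geodesics
  ∈-geodesics⁺ {u} {v} {xs} u<v g@(_ , path , _) = ∈-concatMap⁺ geodesicsBetween
    (lose (∈-filter⁺ (uncurry Fin._<?_)
             (∈-cartesianProduct⁺ (∈-allFin u) (∈-allFin v)) u<v)
          (∈-filter⁺ (isGeodesic? u v) (∈-listsUpTo xs (length-path path)) g))

  ∈-geodesics⁻ : ∀ {xs} → xs ∈ geodesics →
                 ∃₂ λ u v → u Fin.< v × IsGeodesic u v xs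
  ∈-geodesics⁻ xs∈ with find (∈-concatMap⁻ geodesicsBetween {xs = orderedPairs} xs∈)
  ... | (u , v) , uv∈ , xs∈uv =
    u , v ,
    proj₂ (∈-filter⁻ (uncurry Fin._<?_)
             {xs = cartesianProduct (allFin order) (allFin order)} uv∈) ,
    proj₂ (∈-filter⁻ (isGeodesic? u v) {xs = listsUpTo order order} xs∈uv)

  tgp : ℕ
  tgp = length geodesics

  -- A labeling of the edges by positive integers.  The values of label at
  -- non-adjacent pairs are arbitrary and never used.
  record EdgeLabeling : Set where
    field
      label     : Vertex → Vertex → ℕ
      label-sym : ∀ {u v} → Adj u v → label u v ≡ label v u
      label-pos : ∀ {u v} → Adj u v → 1 ≤ label u v

    weight : List Vertex → ℕ
    weight []               = 0
    weight (_ ∷ [])         = 0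
    weight (u ∷ vs@(v ∷ _)) = label u v + weight vs

  -- Equality up to permutation of lists is equality of multisets.
  IsGeodesicLeechLabeling : EdgeLabeling → Set
  IsGeodesicLeechLabeling f = map weight geodesics ↭ map suc (upTo tgp)
    where open EdgeLabeling f

  IsGeodesicLeech : Set
  IsGeodesicLeech = Σ[ f ∈ EdgeLabeling ] IsGeodesicLeechLabeling f

-- The cycle 0, 1, …, m − 1, 0.
Next : ∀ {m} → Rel (Fin m) 0ℓ
Next {m} i j = toℕ j ≡ suc (toℕ i) ⊎ (suc (toℕ i) ≡ m × toℕ j ≡ 0)

-- The condition i ≢ j only matters for m = 1, where it excludes a loop.
CycleAdj : ∀ {m} → Rel (Fin m) 0ℓ
CycleAdj i j = i ≢ j × (Next i j ⊎ Next j i)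

-- Vertex 0 is the hub and the vertices suc i form the rim.
WheelAdj : ∀ {n} → Rel (Fin n) 0ℓ
WheelAdj zero    zero    = ⊥
WheelAdj zero    (suc _) = ⊤
WheelAdj (suc _) zero    = ⊤
WheelAdj (suc i) (suc j) = CycleAdj i j

next? : ∀ {m} → Decidable (Next {m})
next? {m} i j = (toℕ j ℕ.≟ suc (toℕ i)) ⊎-dec (suc (toℕ i) ℕ.≟ m ×-dec toℕ j ℕ.≟ 0)

wheelAdj? : ∀ {n} → Decidable (WheelAdj {n})
wheelAdj? zero    zero    = no λ ()
wheelAdj? zero    (suc _) = yes tt
wheelAdj? (suc _) zero    = yes tt
wheelAdj? (suc i) (suc j) = ¬? (i Fin.≟ j) ×-dec (next? i j ⊎-dec next? j i)

wheelAdj-sym : ∀ {n} → Symmetric (WheelAdj {n})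
wheelAdj-sym {x = zero}  {suc _} _          = tt
wheelAdj-sym {x = suc _} {zero}  _          = tt
wheelAdj-sym {x = suc _} {suc _} (i≢j , ij) = i≢j ∘ sym , swap ij

wheelAdj-irrefl : ∀ {n} → Irreflexive _≡_ (WheelAdj {n})
wheelAdj-irrefl {x = suc _} refl (i≢i , _) = i≢i refl

wheel-connected : ∀ {n} (u v : Fin n) → Star WheelAdj u v
wheel-connected zero    zero    = ε
wheel-connected zero    (suc _) = tt ◅ ε
wheel-connected (suc _) zero    = tt ◅ ε
wheel-connected (suc _) (suc _) = _◅_ {j = zero} tt (tt ◅ ε)

-- The wheel on n vertices, for n ≥ 4; smaller n give complete graphs.
wheel : ℕ → Graph
wheel n = record
  { order      = n
  ; Adj        = WheelAdj
  ; adj?       = wheelAdj?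
  ; adj-sym    = wheelAdj-sym
  ; adj-irrefl = wheelAdj-irrefl
  ; connected  = wheel-connected
  }

-- Put the value 0 on the hub. The sums of two values over the pairs of vertices not
-- joined by a rim edge are the weights of distinct geodesics, so they are distinct and
-- lie in [1, N] with N = m (m + 3) / 2, where m = n − 1; they miss only O(m) of these
-- numbers. Let χ be a character of ℕ turning by almost 2π / N and let G be its sum over
-- the m + 1 values. Since the sum of χ over [1, N] is negligible, G² is the sum of χ²
-- over the values up to O(m). This bounds the sums of χ⁸, χ⁶, χ⁴, χ² and, through
-- |G|² − Re G², the sum of Im χ by small multiples of m. If all values are at most N / 2,
-- their images lie in the upper half circle, where the trigonometric polynomial
-- c₁ sin θ + c₂ cos 2θ + c₄ cos 4θ + c₆ cos 6θ + c₈ cos 8θ is at least 1, so that its sum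
-- over the values is at least m + 1. For m ≥ 40 this exceeds the upper bound.
--
-- Two values above N / 2 add up to more than N, so their vertices are adjacent, and there
-- are at most two of them. If the second largest value exceeds N / 2 considerably, all but
-- the two largest are below N / 2 by as much, and N is replaced by a smaller T; similarly
-- for the largest value and the values other than the three largest. Otherwise the two
-- largest values only cause a small loss in the lower bound.

module Submission where

open import Defs
open import Data.Empty using (⊥; ⊥-elim)
open import Data.Fin as Fin using (Fin; zero; suc; toℕ)
import Data.Fin.Properties as Fin
import Data.Integer as ℤ
open import Data.List using (List; []; _∷_; _++_; map; length; filter)
open import Data.List.Membership.Propositional using (_∈_)
open import Data.List.Membership.Propositional.Properties using
  (∈-∃++; ∈-map⁺; ∈-map⁻; ∈-++⁺ˡ; ∈-++⁺ʳ; ∈-++⁻; ∈-filter⁻; ∈-upTo⁻)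
open import Data.List.Properties using (length-++; length-map; map-∘; map-++; map-id)
open import Data.List.Relation.Binary.Permutation.Propositional as Perm using (_↭_; ↭-sym; ↭⇒↭ₛ)
open import Data.List.Relation.Binary.Permutation.Propositional.Properties using
  (∈-resp-↭; All-resp-↭; shift; ↭-length)
  renaming (map⁺ to ↭-map⁺)
open import Data.List.Relation.Binary.Permutation.Setoid.Properties using (AllPairs-resp-↭)
open import Data.List.Relation.Unary.All as All using (All; []; _∷_)
open import Data.List.Relation.Unary.AllPairs as AllPairs using ([]; _∷_)
import Data.List.Relation.Unary.AllPairs.Properties as AllPairs
open import Data.List.Relation.Unary.Any using (here; there)
open import Data.List.Relation.Unary.Linked using ([-]; _∷_)
open import Data.List.Relation.Unary.Unique.Propositional using (Unique)
import Data.List.Relation.Unary.Unique.Propositional.Properties as Unique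
open import Data.Maybe.Properties using (just-injective)
open import Data.Nat as ℕ using (ℕ; zero; suc; s≤s; z≤n)
import Data.Nat.Properties as ℕ
import Data.Nat.Solver
open import Data.Product using (_×_; _,_; proj₁; proj₂; ∃-syntax; ∃₂)
open import Data.Rational using (ℚ; 0ℚ; 1ℚ; _+_; _*_; _-_; -_; _/_; 1/_; _≤_; _<_; _≤?_; _<?_; nonNegative; positive)
open import Data.Rational.Properties as ℚ using (≤-refl; ≤-trans; ≤-reflexive)
open import Data.Rational.Solver
open import Data.Sum using (_⊎_; inj₁; inj₂; [_,_]′)
open import Data.Unit using (tt)
open import Function using (_∘_)
open import Relation.Binary using (tri<; tri≈; tri>)
open import Relation.Binary.PropositionalEquality
open import Relation.Nullary using (¬_; Dec; yes; no; contradiction)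
open import Relation.Nullary.Decidable using (toWitness; True; ¬?; decidable-stable)
open +-*-Solver
module ℕR = Data.Nat.Solver.+-*-Solver

-- Ordered field arithmetic

-- Everything happens over the rationals, without π and the complex exponential. The character is
-- therefore built from the rational point of the circle whose half-angle has tangent ε = e₀ / T,
-- where e₀ is a fixed fraction just below π / 16, and angles are compared only through their
-- tangents. As e₀ is not exactly π / 16, the sum of χ over [1, T] does not vanish; its modulus is
-- at most 3 T / 10000. This error is quadratic in m with a tiny factor. So the bounds for the
-- character sums are taken linear in m, and the final comparisons are between polynomials in z = m
-- - 40, with positive coefficients in the difference. They are tight: with all vertices kept, the
-- two sides differ at m = 40 by less than one percent. The thresholds for twice the second largest
-- and twice the largest value, N + 77 and N + 124, are a compromise. Raising one of them shortens
-- the interval that remains after vertices are dropped, and so reduces the number of missing sums,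
-- but it increases the loss caused by large values that are kept.

infixl 6 _⊕_
infixl 7 _⊗_

_⊕_ : ∀ {p q} → 0ℚ ≤ p → 0ℚ ≤ q → 0ℚ ≤ p + q
_⊕_ = ℚ.+-mono-≤

_⊗_ : ∀ {p q} → 0ℚ ≤ p → 0ℚ ≤ q → 0ℚ ≤ p * q
_⊗_ {p} {q} 0≤p 0≤q =
  subst (_≤ p * q) (ℚ.*-zeroʳ p) (ℚ.*-monoˡ-≤-nonNeg p {{nonNegative 0≤p}} 0≤q)

positive-constant : ∀ {p} → {True (0ℚ ≤? p)} → 0ℚ ≤ p
positive-constant {p} {t} = toWitness {a? = 0ℚ ≤? p} t

0≤square : ∀ p → 0ℚ ≤ p * p
0≤square p with ℚ.≤-total 0ℚ p
... | inj₁ 0≤p = 0≤p ⊗ 0≤p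
... | inj₂ p≤0 = subst (0ℚ ≤_) (solve 1 (λ p → (:- p) :* (:- p) := p :* p) refl p)
                       (ℚ.neg-antimono-≤ p≤0 ⊗ ℚ.neg-antimono-≤ p≤0)

≤⇒0≤- : ∀ {p q} → p ≤ q → 0ℚ ≤ q - p
≤⇒0≤- {p} {q} p≤q =
  subst (_≤ q - p) (ℚ.+-inverseʳ p) (ℚ.+-monoˡ-≤ (- p) p≤q)

-- The form in which polynomial inequalities are certified throughout: `d` is assembled from visibly
-- nonnegative terms with `_⊕_` and `_⊗_`, and the ring solver confirms that it equals the
-- difference.
≤-by : ∀ {p q d} → 0ℚ ≤ d → q - p ≡ d → p ≤ q
≤-by {p} {q} 0≤d refl =
  subst₂ _≤_ (ℚ.+-identityˡ p) (solve 2 (λ p q → q :- p :+ p := q) refl p q) (ℚ.+-monoˡ-≤ p 0≤d)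

square-cancel-≤ : ∀ {p q} → 0ℚ ≤ q → p * p ≤ q * q → p ≤ q
square-cancel-≤ {p} {q} 0≤q pp≤qq with p ≤? q
... | yes p≤q = p≤q
... | no p≰q  = contradiction
  (ℚ.<-≤-trans (ℚ.≤-<-trans (ℚ.*-monoˡ-≤-nonNeg q {{nonNegative 0≤q}} (ℚ.<⇒≤ q<p))
                            (ℚ.*-monoˡ-<-pos p {{positive (ℚ.≤-<-trans 0≤q q<p)}} q<p))
               pp≤qq)
  (ℚ.<-irrefl refl)
  where q<p = ℚ.≰⇒> p≰q

*-cancel-≤ : ∀ {n w} → 0ℚ ≤ w → n * n ≤ n * w → n ≤ w
*-cancel-≤ {n} {w} 0≤w nn≤nw with n ≤? w
... | yes n≤w = n≤w
... | no n≰w  = contradiction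
  (ℚ.<-≤-trans (ℚ.*-monoʳ-<-pos n {{positive (ℚ.≤-<-trans 0≤w w<n)}} w<n) nn≤nw)
  (ℚ.<-irrefl refl)
  where w<n = ℚ.≰⇒> n≰w

-- Sums over lists

∑ : {A : Set} → (A → ℚ) → List A → ℚ
∑ f []       = 0ℚ
∑ f (x ∷ xs) = f x + ∑ f xs

ι : ℕ → ℚ
ι zero    = 0ℚ
ι (suc n) = 1ℚ + ι n

0≤1 : 0ℚ ≤ 1ℚ
0≤1 = positive-constant {1ℚ}

0≤ι : ∀ n → 0ℚ ≤ ι n
0≤ι zero    = ≤-refl
0≤ι (suc n) = 0≤1 ⊕ 0≤ι n

ι-+ : ∀ m n → ι (m ℕ.+ n) ≡ ι m + ι n
ι-+ zero    n = sym (ℚ.+-identityˡ (ι n))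
ι-+ (suc m) n = trans (cong (1ℚ +_) (ι-+ m n)) (sym (ℚ.+-assoc 1ℚ (ι m) (ι n)))

ι-* : ∀ m n → ι (m ℕ.* n) ≡ ι m * ι n
ι-* zero    n = sym (ℚ.*-zeroˡ (ι n))
ι-* (suc m) n = begin
  ι (n ℕ.+ m ℕ.* n)   ≡⟨ ι-+ n (m ℕ.* n) ⟩
  ι n + ι (m ℕ.* n)   ≡⟨ cong (ι n +_) (ι-* m n) ⟩
  ι n + ι m * ι n     ≡⟨ solve 2 (λ x y → y :+ x :* y := (con 1ℚ :+ x) :* y) refl (ι m) (ι n) ⟩
  (1ℚ + ι m) * ι n    ∎
  where open ≡-Reasoning

ι-mono-≤ : ∀ {m n} → m ℕ.≤ n → ι m ≤ ι n
ι-mono-≤ {n = n} z≤n = 0≤ι n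
ι-mono-≤ (s≤s m≤n)   = ℚ.+-monoʳ-≤ 1ℚ (ι-mono-≤ m≤n)

module _ {A : Set} where

  ∑-++ : (f : A → ℚ) → ∀ xs ys → ∑ f (xs ++ ys) ≡ ∑ f xs + ∑ f ys
  ∑-++ f []       ys = sym (ℚ.+-identityˡ (∑ f ys))
  ∑-++ f (x ∷ xs) ys =
    trans (cong (f x +_) (∑-++ f xs ys)) (sym (ℚ.+-assoc (f x) (∑ f xs) (∑ f ys)))

  ∑-↭ : (f : A → ℚ) → ∀ {xs ys} → xs ↭ ys → ∑ f xs ≡ ∑ f ys
  ∑-↭ f Perm.refl          = refl
  ∑-↭ f (Perm.prep x p)    = cong (f x +_) (∑-↭ f p)
  ∑-↭ f (Perm.swap {xs} x y p) = trans
    (solve 3 (λ x y s → x :+ (y :+ s) := y :+ (x :+ s)) refl (f x) (f y) (∑ f xs))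
    (cong (λ s → f y + (f x + s)) (∑-↭ f p))
  ∑-↭ f (Perm.trans p q)   = trans (∑-↭ f p) (∑-↭ f q)

  ∑-cong : {f g : A → ℚ} → (∀ x → f x ≡ g x) → ∀ xs → ∑ f xs ≡ ∑ g xs
  ∑-cong f≗g []       = refl
  ∑-cong f≗g (x ∷ xs) = cong₂ _+_ (f≗g x) (∑-cong f≗g xs)

  ∑-linear : ∀ a b (f g : A → ℚ) xs →
             ∑ (λ x → a * f x + b * g x) xs ≡ a * ∑ f xs + b * ∑ g xs
  ∑-linear a b f g []       = solve 2 (λ a b → con 0ℚ := a :* con 0ℚ :+ b :* con 0ℚ) refl a b
  ∑-linear a b f g (x ∷ xs) = trans
    (cong (a * f x + b * g x +_) (∑-linear a b f g xs))
    (solve 6 (λ a b s t u v → a :* s :+ b :* t :+ (a :* u :+ b :* v) := a :* (s :+ u) :+ b :* (t :+ v)) refl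
       a b (f x) (g x) (∑ f xs) (∑ g xs))

  ∑-≤-const : ∀ {b} (f : A → ℚ) → (∀ x → f x ≤ b) → ∀ xs → ∑ f xs ≤ ι (length xs) * b
  ∑-≤-const {b} f f≤b []       = ≤-reflexive (sym (ℚ.*-zeroˡ b))
  ∑-≤-const {b} f f≤b (x ∷ xs) = ≤-trans (ℚ.+-mono-≤ (f≤b x) (∑-≤-const f f≤b xs))
    (≤-reflexive (solve 2 (λ b n → b :+ n :* b := (con 1ℚ :+ n) :* b) refl b (ι (length xs))))

  ∑-const-≤ : ∀ {b} (f : A → ℚ) xs → (∀ {x} → x ∈ xs → b ≤ f x) → ι (length xs) * b ≤ ∑ f xs
  ∑-const-≤ {b} f []       b≤f = ≤-reflexive (ℚ.*-zeroˡ b)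
  ∑-const-≤ {b} f (x ∷ xs) b≤f = ≤-trans
    (≤-reflexive (solve 2 (λ b n → (con 1ℚ :+ n) :* b := b :+ n :* b) refl b (ι (length xs))))
    (ℚ.+-mono-≤ (b≤f (here refl)) (∑-const-≤ f xs (b≤f ∘ there)))

∑-map : {A B : Set} (f : B → ℚ) (g : A → B) → ∀ xs → ∑ f (map g xs) ≡ ∑ (f ∘ g) xs
∑-map f g []       = refl
∑-map f g (x ∷ xs) = cong (f (g x) +_) (∑-map f g xs)

∑-distribˡ : {A : Set} → ∀ a (f : A → ℚ) xs → ∑ (λ x → a * f x) xs ≡ a * ∑ f xs
∑-distribˡ a f []       = sym (ℚ.*-zeroʳ a)
∑-distribˡ a f (x ∷ xs) = trans (cong (a * f x +_) (∑-distribˡ a f xs))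
                                (sym (ℚ.*-distribˡ-+ a (f x) (∑ f xs)))

∑-+ : {A : Set} → ∀ (f g : A → ℚ) xs → ∑ (λ x → f x + g x) xs ≡ ∑ f xs + ∑ g xs
∑-+ f g []       = refl
∑-+ f g (x ∷ xs) = trans (cong (f x + g x +_) (∑-+ f g xs))
  (solve 4 (λ s t u v → s :+ t :+ (u :+ v) := s :+ u :+ (t :+ v)) refl (f x) (g x) (∑ f xs) (∑ g xs))

-- Unitary characters of ℕ

-- Lagrange's identity: (r n)² - (a c + b d)² is (a d - b c)² plus nonnegative multiples of the
-- slacks in the two hypotheses. Moduli appear only through their squares, which keeps square roots
-- out.
cauchy-schwarz : ∀ a b c d {r n} → 0ℚ ≤ r → 0ℚ ≤ n →
                 a * a + b * b ≤ r * r → c * c + d * d ≤ n * n → a * c + b * d ≤ r * n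
cauchy-schwarz a b c d {r} {n} 0≤r 0≤n ab≤r cd≤n =
  square-cancel-≤ (0≤r ⊗ 0≤n) (≤-by
    (0≤square (a * d - b * c) ⊕ ≤⇒0≤- ab≤r ⊗ (0≤square c ⊕ 0≤square d)
      ⊕ 0≤square r ⊗ ≤⇒0≤- cd≤n)
    (solve 6 (λ a b c d r n → r :* n :* (r :* n) :- (a :* c :+ b :* d) :* (a :* c :+ b :* d)
        := (a :* d :- b :* c) :* (a :* d :- b :* c) :+ (r :* r :- (a :* a :+ b :* b)) :* (c :* c :+ d :* d)
        :+ r :* r :* (n :* n :- (c :* c :+ d :* d))) refl a b c d r n))

-- The value at 0 is not a field: the addition law makes it idempotent, and an idempotent of modulus
-- 1 is 1.
record Character : Set where
  field
    re im : ℕ → ℚ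
    re-+  : ∀ j k → re (j ℕ.+ k) ≡ re j * re k - im j * im k
    im-+  : ∀ j k → im (j ℕ.+ k) ≡ im j * re k + re j * im k
    unit  : ∀ k → re k * re k + im k * im k ≡ 1ℚ

  re≤1 : ∀ k → re k ≤ 1ℚ
  re≤1 k = square-cancel-≤ 0≤1 (≤-by (0≤square (im k))
    (trans (cong (λ o → o - re k * re k) (sym (unit k)))
           (solve 2 (λ a b → a :* a :+ b :* b :- a :* a := b :* b) refl (re k) (im k))))

  -1≤re : ∀ k → - 1ℚ ≤ re k
  -1≤re k = subst (- 1ℚ ≤_) (solve 1 (λ a → (:- (:- a)) := a) refl (re k)) (ℚ.neg-antimono-≤
    (square-cancel-≤ { - re k} 0≤1 (≤-by (0≤square (im k))
      (trans (cong (λ o → o - (- re k) * (- re k)) (sym (unit k)))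
             (solve 2 (λ a b → a :* a :+ b :* b :- (:- a) :* (:- a) := b :* b) refl (re k) (im k))))))

  re-2* : ∀ k → re (k ℕ.+ k) ≡ (ℤ.+ 2 / 1) * (re k * re k) - 1ℚ
  re-2* k = trans (re-+ k k) (trans
    (solve 2 (λ a b → a :* a :- b :* b := con (ℤ.+ 2 / 1) :* (a :* a) :- (a :* a :+ b :* b)) refl (re k) (im k))
    (cong (λ o → (ℤ.+ 2 / 1) * (re k * re k) - o) (unit k)))

  im-2* : ∀ k → im (k ℕ.+ k) ≡ (ℤ.+ 2 / 1) * (re k * im k)
  im-2* k = trans (im-+ k k) (solve 2 (λ a b → b :* a :+ a :* b := con (ℤ.+ 2 / 1) :* (a :* b)) refl (re k) (im k))

  ∑-norm : ∀ xs → ∑ re xs * ∑ re xs + ∑ im xs * ∑ im xs ≤ ι (length xs) * ι (length xs)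
  ∑-norm []       = ≤-refl
  ∑-norm (x ∷ xs) = ≤-by (≤⇒0≤- (∑-norm xs) ⊕ 0≤2 ⊗ ≤⇒0≤- step ⊕ ≤⇒0≤- (≤-reflexive (unit x)))
    (solve 5 (λ a b s t n → (con 1ℚ :+ n) :* (con 1ℚ :+ n) :- ((a :+ s) :* (a :+ s) :+ (b :+ t) :* (b :+ t))
        := n :* n :- (s :* s :+ t :* t) :+ con (ℤ.+ 2 / 1) :* (n :* con 1ℚ :- (s :* a :+ t :* b))
        :+ (con 1ℚ :- (a :* a :+ b :* b))) refl
      (re x) (im x) (∑ re xs) (∑ im xs) (ι (length xs)))
    where
    0≤2 : 0ℚ ≤ (ℤ.+ 2 / 1)
    0≤2 = 0≤1 ⊕ 0≤1
    step : ∑ re xs * re x + ∑ im xs * im x ≤ ι (length xs) * 1ℚ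
    step = cauchy-schwarz (∑ re xs) (∑ im xs) (re x) (im x) (0≤ι (length xs)) 0≤1 (∑-norm xs) (≤-reflexive (unit x))

open Character

-- Squaring the values amounts to doubling the argument. In this encoding the value of `χ ²` at k is
-- by definition that of `χ` at k + k, so that information about a character up to T is information
-- about its square up to T / 2.
_² : Character → Character
χ ² = record
  { re   = λ k → re χ (k ℕ.+ k)
  ; im   = λ k → im χ (k ℕ.+ k)
  ; re-+ = λ j k → trans (cong (re χ) (regroup j k)) (re-+ χ (j ℕ.+ j) (k ℕ.+ k))
  ; im-+ = λ j k → trans (cong (im χ) (regroup j k)) (im-+ χ (j ℕ.+ j) (k ℕ.+ k))
  ; unit = λ k → unit χ (k ℕ.+ k)
  }
  where
  regroup : ∀ j k → j ℕ.+ k ℕ.+ (j ℕ.+ k) ≡ j ℕ.+ j ℕ.+ (k ℕ.+ k)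
  regroup j k = ℕR.solve 2 (λ j k → j ℕR.:+ k ℕR.:+ (j ℕR.:+ k) ℕR.:= j ℕR.:+ j ℕR.:+ (k ℕR.:+ k)) refl j k

_³ : Character → Character
χ ³ = record
  { re   = λ k → re χ (k ℕ.+ k ℕ.+ k)
  ; im   = λ k → im χ (k ℕ.+ k ℕ.+ k)
  ; re-+ = λ j k → trans (cong (re χ) (regroup j k)) (re-+ χ (j ℕ.+ j ℕ.+ j) (k ℕ.+ k ℕ.+ k))
  ; im-+ = λ j k → trans (cong (im χ) (regroup j k)) (im-+ χ (j ℕ.+ j ℕ.+ j) (k ℕ.+ k ℕ.+ k))
  ; unit = λ k → unit χ (k ℕ.+ k ℕ.+ k)
  }
  where
  regroup : ∀ j k → j ℕ.+ k ℕ.+ (j ℕ.+ k) ℕ.+ (j ℕ.+ k) ≡ j ℕ.+ j ℕ.+ j ℕ.+ (k ℕ.+ k ℕ.+ k)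
  regroup j k = ℕR.solve 2 (λ j k → j ℕR.:+ k ℕR.:+ (j ℕR.:+ k) ℕR.:+ (j ℕR.:+ k)
                  ℕR.:= j ℕR.:+ j ℕR.:+ j ℕR.:+ (k ℕR.:+ k ℕR.:+ k)) refl j k

re-³ : ∀ χ k → re (χ ³) k ≡ (ℤ.+ 4 / 1) * (re χ k * re χ k * re χ k) - (ℤ.+ 3 / 1) * re χ k
re-³ χ k = begin
  re χ (k ℕ.+ k ℕ.+ k)                                 ≡⟨ re-+ χ (k ℕ.+ k) k ⟩
  re χ (k ℕ.+ k) * a - im χ (k ℕ.+ k) * b              ≡⟨ cong₂ (λ p q → p * a - q * b) (re-2* χ k) (im-2* χ k) ⟩
  ((ℤ.+ 2 / 1) * (a * a) - 1ℚ) * a - ((ℤ.+ 2 / 1) * (a * b)) * b         ≡⟨ solve 2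
      (λ a b → (con (ℤ.+ 2 / 1) :* (a :* a) :- con 1ℚ) :* a :- con (ℤ.+ 2 / 1) :* (a :* b) :* b
      := con (ℤ.+ 4 / 1) :* (a :* a :* a) :- a :- con (ℤ.+ 2 / 1) :* a :* (a :* a :+ b :* b)) refl a b ⟩
  (ℤ.+ 4 / 1) * (a * a * a) - a - (ℤ.+ 2 / 1) * a * (a * a + b * b)      ≡⟨ cong (λ o → (ℤ.+ 4 / 1) * (a * a * a) - a
      - (ℤ.+ 2 / 1) * a * o) (unit χ k) ⟩
  (ℤ.+ 4 / 1) * (a * a * a) - a - (ℤ.+ 2 / 1) * a * 1ℚ                   ≡⟨ solve 1 (λ a → con (ℤ.+ 4 / 1)
      :* (a :* a :* a) :- a :- con (ℤ.+ 2 / 1) :* a :* con 1ℚ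
      := con (ℤ.+ 4 / 1) :* (a :* a :* a) :- con (ℤ.+ 3 / 1) :* a) refl a ⟩
  (ℤ.+ 4 / 1) * (a * a * a) - (ℤ.+ 3 / 1) * a                            ∎
  where
  open ≡-Reasoning
  a = re χ k
  b = im χ k

-- Pair sums, geometric sums and almost periods

pairSums : List ℕ → List ℕ
pairSums []       = []
pairSums (x ∷ xs) = map (x ℕ.+_) xs ++ pairSums xs

range : ℕ → List ℕ
range zero    = []
range (suc n) = suc n ∷ range n

module _ (χ : Character) where

  ∑-re-shift : ∀ x ys → ∑ (re χ) (map (x ℕ.+_) ys) ≡ re χ x * ∑ (re χ) ys - im χ x * ∑ (im χ) ys
  ∑-re-shift x ys = begin
    ∑ (re χ) (map (x ℕ.+_) ys)                                  ≡⟨ ∑-map (re χ) (x ℕ.+_) ys ⟩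
    ∑ (λ y → re χ (x ℕ.+ y)) ys                                 ≡⟨ ∑-cong (λ y → trans (re-+ χ x y)
                                                                     (solve 4 (λ a b c d → a :* c :- b :* d
                                                                         := a :* c :+ (:- b) :* d) refl (re χ x)
                                                                         (im χ x) (re χ y) (im χ y))) ys ⟩
    ∑ (λ y → re χ x * re χ y + (- im χ x) * im χ y) ys          ≡⟨ ∑-linear (re χ x) (- im χ x) (re χ) (im χ) ys ⟩
    re χ x * ∑ (re χ) ys + (- im χ x) * ∑ (im χ) ys             ≡⟨ solve 4 (λ a b c d → a :* c :+ (:- b) :* d
        := a :* c :- b :* d) refl
                                                                     (re χ x) (im χ x) (∑ (re χ) ys) (∑ (im χ) ys) ⟩
    re χ x * ∑ (re χ) ys - im χ x * ∑ (im χ) ys                 ∎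
    where open ≡-Reasoning

  ∑-im-shift : ∀ x ys → ∑ (im χ) (map (x ℕ.+_) ys) ≡ im χ x * ∑ (re χ) ys + re χ x * ∑ (im χ) ys
  ∑-im-shift x ys = trans (∑-map (im χ) (x ℕ.+_) ys)
    (trans (∑-cong (im-+ χ x) ys) (∑-linear (im χ x) (re χ x) (re χ) (im χ) ys))

  -- The real part of an expanded square: the diagonal gives the sum of χ², and each unordered pair
  -- occurs twice.
  square-re : ∀ xs → ∑ (re χ) xs * ∑ (re χ) xs - ∑ (im χ) xs * ∑ (im χ) xs
                     ≡ ∑ (re (χ ²)) xs + (ℤ.+ 2 / 1) * ∑ (re χ) (pairSums xs)
  square-re []       = refl
  square-re (x ∷ xs) = begin
    (a + u) * (a + u) - (b + v) * (b + v)
      ≡⟨ solve 4 (λ a b u v → (a :+ u) :* (a :+ u) :- (b :+ v) :* (b :+ v)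
          := a :* a :- b :* b :+ (u :* u :- v :* v) :+ con (ℤ.+ 2 / 1) :* (a :* u :- b :* v)) refl a b u v ⟩
    a * a - b * b + (u * u - v * v) + (ℤ.+ 2 / 1) * (a * u - b * v)
      ≡⟨ cong₂ (λ p q → p + q + (ℤ.+ 2 / 1) * (a * u - b * v)) (sym (re-+ χ x x)) (square-re xs) ⟩
    re χ (x ℕ.+ x) + (d + (ℤ.+ 2 / 1) * p) + (ℤ.+ 2 / 1) * (a * u - b * v)
      ≡⟨ solve 4 (λ c d p s → c :+ (d :+ con (ℤ.+ 2 / 1) :* p) :+ con (ℤ.+ 2 / 1) :* s
          := c :+ d :+ con (ℤ.+ 2 / 1) :* (s :+ p)) refl (re χ (x ℕ.+ x)) d p (a * u - b * v) ⟩
    re χ (x ℕ.+ x) + d + (ℤ.+ 2 / 1) * (a * u - b * v + p)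
      ≡⟨ cong (λ s → re χ (x ℕ.+ x) + d + (ℤ.+ 2 / 1) * (s + p)) (sym (∑-re-shift x xs)) ⟩
    re χ (x ℕ.+ x) + d + (ℤ.+ 2 / 1) * (∑ (re χ) (map (x ℕ.+_) xs) + p)
      ≡⟨ cong (λ s → re χ (x ℕ.+ x) + d + (ℤ.+ 2 / 1) * s) (sym (∑-++ (re χ) (map (x ℕ.+_) xs) (pairSums xs))) ⟩
    re χ (x ℕ.+ x) + d + (ℤ.+ 2 / 1) * ∑ (re χ) (pairSums (x ∷ xs)) ∎
    where
    open ≡-Reasoning
    a = re χ x
    b = im χ x
    u = ∑ (re χ) xs
    v = ∑ (im χ) xs
    d = ∑ (re (χ ²)) xs
    p = ∑ (re χ) (pairSums xs)

  square-im : ∀ xs → (ℤ.+ 2 / 1) * (∑ (re χ) xs * ∑ (im χ) xs)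
                     ≡ ∑ (im (χ ²)) xs + (ℤ.+ 2 / 1) * ∑ (im χ) (pairSums xs)
  square-im []       = refl
  square-im (x ∷ xs) = begin
    (ℤ.+ 2 / 1) * ((a + u) * (b + v))
      ≡⟨ solve 4 (λ a b u v → con (ℤ.+ 2 / 1) :* ((a :+ u) :* (b :+ v))
          := b :* a :+ a :* b :+ con (ℤ.+ 2 / 1) :* (u :* v) :+ con (ℤ.+ 2 / 1) :* (b :* u :+ a :* v)) refl a b u v ⟩
    b * a + a * b + (ℤ.+ 2 / 1) * (u * v) + (ℤ.+ 2 / 1) * (b * u + a * v)
      ≡⟨ cong₂ (λ p q → p + q + (ℤ.+ 2 / 1) * (b * u + a * v)) (sym (im-+ χ x x)) (square-im xs) ⟩
    im χ (x ℕ.+ x) + (d + (ℤ.+ 2 / 1) * p) + (ℤ.+ 2 / 1) * (b * u + a * v)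
      ≡⟨ solve 4 (λ c d p s → c :+ (d :+ con (ℤ.+ 2 / 1) :* p) :+ con (ℤ.+ 2 / 1) :* s
          := c :+ d :+ con (ℤ.+ 2 / 1) :* (s :+ p)) refl (im χ (x ℕ.+ x)) d p (b * u + a * v) ⟩
    im χ (x ℕ.+ x) + d + (ℤ.+ 2 / 1) * (b * u + a * v + p)
      ≡⟨ cong (λ s → im χ (x ℕ.+ x) + d + (ℤ.+ 2 / 1) * (s + p)) (sym (∑-im-shift x xs)) ⟩
    im χ (x ℕ.+ x) + d + (ℤ.+ 2 / 1) * (∑ (im χ) (map (x ℕ.+_) xs) + p)
      ≡⟨ cong (λ s → im χ (x ℕ.+ x) + d + (ℤ.+ 2 / 1) * s) (sym (∑-++ (im χ) (map (x ℕ.+_) xs) (pairSums xs))) ⟩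
    im χ (x ℕ.+ x) + d + (ℤ.+ 2 / 1) * ∑ (im χ) (pairSums (x ∷ xs)) ∎
    where
    open ≡-Reasoning
    a = re χ x
    b = im χ x
    u = ∑ (re χ) xs
    v = ∑ (im χ) xs
    d = ∑ (im (χ ²)) xs
    p = ∑ (im χ) (pairSums xs)

  -- (1 − z)(z + z² + … + zᵀ) = z − zᵀ⁺¹
  range-re : ∀ T → (1ℚ - re χ 1) * ∑ (re χ) (range T) + im χ 1 * ∑ (im χ) (range T)
                   ≡ re χ 1 - re χ (suc T)
  range-re zero    = solve 2 (λ c s → (con 1ℚ :- c) :* con 0ℚ :+ s :* con 0ℚ := c :- c) refl (re χ 1) (im χ 1)
  range-re (suc T) = begin
    (1ℚ - c) * (a + u) + s * (b + v)                    ≡⟨ solve 6 (λ c s a b u v → (con 1ℚ :- c) :* (a :+ u)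
        :+ s :* (b :+ v) := (con 1ℚ :- c) :* u :+ s :* v :+ (a :- (c :* a :- s :* b))) refl c s a b u v ⟩
    (1ℚ - c) * u + s * v + (a - (c * a - s * b))        ≡⟨ cong₂ (λ p q → p + (a - q)) (range-re T) (sym (re-+ χ 1 (suc T))) ⟩
    c - a + (a - re χ (suc (suc T)))                    ≡⟨ solve 3 (λ c a d → c :- a :+ (a :- d)
        := c :- d) refl c a (re χ (suc (suc T))) ⟩
    c - re χ (suc (suc T))                              ∎
    where
    open ≡-Reasoning
    c = re χ 1
    s = im χ 1
    a = re χ (suc T)
    b = im χ (suc T)
    u = ∑ (re χ) (range T)
    v = ∑ (im χ) (range T)

  range-im : ∀ T → (1ℚ - re χ 1) * ∑ (im χ) (range T) - im χ 1 * ∑ (re χ) (range T)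
                   ≡ im χ 1 - im χ (suc T)
  range-im zero    = solve 2 (λ c s → (con 1ℚ :- c) :* con 0ℚ :- s :* con 0ℚ := s :- s) refl (re χ 1) (im χ 1)
  range-im (suc T) = begin
    (1ℚ - c) * (b + v) - s * (a + u)                    ≡⟨ solve 6 (λ c s a b u v → (con 1ℚ :- c) :* (b :+ v)
        :- s :* (a :+ u) := (con 1ℚ :- c) :* v :- s :* u :+ (b :- (s :* a :+ c :* b))) refl c s a b u v ⟩
    (1ℚ - c) * v - s * u + (b - (s * a + c * b))        ≡⟨ cong₂ (λ p q → p + (b - q)) (range-im T) (sym (im-+ χ 1 (suc T))) ⟩
    s - b + (b - im χ (suc (suc T)))                    ≡⟨ solve 3 (λ c a d → c :- a :+ (a :- d)
        := c :- d) refl s b (im χ (suc (suc T))) ⟩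
    s - im χ (suc (suc T))                              ∎
    where
    open ≡-Reasoning
    c = re χ 1
    s = im χ 1
    a = re χ (suc T)
    b = im χ (suc T)
    u = ∑ (re χ) (range T)
    v = ∑ (im χ) (range T)

  -- The squared modulus of the telescoped geometric sum. Both |1 - z|² and |1 - zᵀ|² have the form
  -- 2 (1 - Re), whence the factor 1/2 in the calculation.
  range-norm : ∀ T → (1ℚ - re χ 1) * (∑ (re χ) (range T) * ∑ (re χ) (range T)
                                      + ∑ (im χ) (range T) * ∑ (im χ) (range T))
                     ≡ 1ℚ - re χ T
  range-norm T = begin
    (1ℚ - c) * (u * u + v * v)
      ≡⟨ solve 4 (λ c s u v → (con 1ℚ :- c) :* (u :* u :+ v :* v)
          := con (ℤ.+ 1 / 2) :* (((con 1ℚ :- c) :* u :+ s :* v) :* ((con 1ℚ :- c) :* u :+ s :* v) :+ ((con 1ℚ :- c) :* v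
          :- s :* u) :* ((con 1ℚ :- c) :* v :- s :* u) :+ (con 1ℚ :- (c :* c :+ s :* s)) :* (u :* u :+ v :* v))) refl c s u v ⟩
    (ℤ.+ 1 / 2) * (((1ℚ - c) * u + s * v) * ((1ℚ - c) * u + s * v) + ((1ℚ - c) * v - s * u) * ((1ℚ - c) * v - s * u)
            + (1ℚ - (c * c + s * s)) * (u * u + v * v))
      ≡⟨ cong₂ (λ p q → (ℤ.+ 1 / 2) * (p * p + q * q + (1ℚ - (c * c + s * s)) * (u * u + v * v)))
           (trans (range-re T) (cong (λ p → c - p) (re-+ χ 1 T))) (trans (range-im T) (cong (λ p → s - p) (im-+ χ 1 T))) ⟩
    (ℤ.+ 1 / 2) * ((c - (c * a - s * b)) * (c - (c * a - s * b)) + (s - (s * a + c * b)) * (s - (s * a + c * b))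
            + (1ℚ - (c * c + s * s)) * (u * u + v * v))
      ≡⟨ solve 5 (λ c s a b w → con (ℤ.+ 1 / 2) :* ((c :- (c :* a :- s :* b)) :* (c :- (c :* a :- s :* b))
          :+ (s :- (s :* a :+ c :* b)) :* (s :- (s :* a :+ c :* b)) :+ (con 1ℚ :- (c :* c :+ s :* s)) :* w)
          := con (ℤ.+ 1 / 2) :* ((c :* c :+ s :* s) :* (con 1ℚ :- con (ℤ.+ 2 / 1) :* a :+ (a :* a :+ b :* b))
          :+ (con 1ℚ :- (c :* c :+ s :* s)) :* w)) refl c s a b (u * u + v * v) ⟩
    (ℤ.+ 1 / 2) * ((c * c + s * s) * (1ℚ - (ℤ.+ 2 / 1) * a + (a * a + b * b)) + (1ℚ - (c * c + s * s)) * (u * u + v * v))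
      ≡⟨ cong₂ (λ o o′ → (ℤ.+ 1 / 2) * (o * (1ℚ - (ℤ.+ 2 / 1) * a + o′) + (1ℚ - o) * (u * u + v * v))) (unit χ 1) (unit χ T) ⟩
    (ℤ.+ 1 / 2) * (1ℚ * (1ℚ - (ℤ.+ 2 / 1) * a + 1ℚ) + (1ℚ - 1ℚ) * (u * u + v * v))
      ≡⟨ solve 2 (λ a w → con (ℤ.+ 1 / 2) :* (con 1ℚ :* (con 1ℚ :- con (ℤ.+ 2 / 1) :* a :+ con 1ℚ) :+ (con 1ℚ :- con 1ℚ)
          :* w) := con 1ℚ :- a) refl a (u * u + v * v) ⟩
    1ℚ - a ∎
    where
    open ≡-Reasoning
    c = re χ 1
    s = im χ 1
    a = re χ T
    b = im χ T
    u = ∑ (re χ) (range T)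
    v = ∑ (im χ) (range T)

-- The character has almost period T, with error R.
record AlmostPeriodic (T : ℕ) (R : ℚ) (χ : Character) : Set where
  field
    0≤R   : 0ℚ ≤ R
    moves : 0ℚ < 1ℚ - re χ 1
    close : 1ℚ - re χ T ≤ (R * R) * (1ℚ - re χ 1)

  range-bound : ∑ (re χ) (range T) * ∑ (re χ) (range T) + ∑ (im χ) (range T) * ∑ (im χ) (range T) ≤ R * R
  range-bound = ℚ.*-cancelˡ-≤-pos (1ℚ - re χ 1) {{positive moves}}
    (≤-trans (≤-reflexive (range-norm χ T)) (≤-trans close (≤-reflexive (ℚ.*-comm (R * R) (1ℚ - re χ 1)))))

open AlmostPeriodic

module _ {T R χ} (per : AlmostPeriodic T R χ) (0≤c : 0ℚ ≤ re χ 1) where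
  private
    c = re χ 1
    d = re χ T
    0≤2 : 0ℚ ≤ (ℤ.+ 2 / 1)
    0≤2 = 0≤1 ⊕ 0≤1

  double-moves : 1ℚ - c ≤ 1ℚ - re (χ ²) 1
  double-moves = ≤-by (((0≤2 ⊗ 0≤c) ⊕ 0≤1) ⊗ ≤⇒0≤- (re≤1 χ 1))
    (trans (cong (λ o → 1ℚ - o - (1ℚ - c)) (re-2* χ 1))
           (solve 1 (λ c → con 1ℚ :- (con (ℤ.+ 2 / 1) :* (c :* c) :- con 1ℚ) :- (con 1ℚ :- c)
               := (con (ℤ.+ 2 / 1) :* c :+ con 1ℚ) :* (con 1ℚ :- c)) refl c))

  double-close : 1ℚ - re (χ ²) T ≤ (ℤ.+ 4 / 1) * (1ℚ - d)
  double-close = ≤-by (0≤2 ⊗ 0≤square (1ℚ - d))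
    (trans (cong (λ o → (ℤ.+ 4 / 1) * (1ℚ - d) - (1ℚ - o)) (re-2* χ T))
           (solve 1 (λ d → con (ℤ.+ 4 / 1) :* (con 1ℚ :- d) :- (con 1ℚ :- (con (ℤ.+ 2 / 1) :* (d :* d) :- con 1ℚ))
               := con (ℤ.+ 2 / 1) :* ((con 1ℚ :- d) :* (con 1ℚ :- d))) refl d))

  -- Doubling an angle multiplies 1 - cos by at most 4, and does not decrease it if the cosine is
  -- nonnegative. Applied at `T` and at 1 respectively, the two facts turn `R` into 2 `R`. The
  -- second is wasteful for small angles, but `R` is small enough.
  periodic-² : AlmostPeriodic T ((ℤ.+ 2 / 1) * R) (χ ²)
  periodic-² = record
    { 0≤R   = 0≤2 ⊗ 0≤R per
    ; moves = ℚ.<-≤-trans (moves per) double-moves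
    ; close = ≤-by
        (≤⇒0≤- double-close ⊕ 0≤4 ⊗ ≤⇒0≤- (close per) ⊕ (0≤4 ⊗ 0≤square R) ⊗ ≤⇒0≤- double-moves)
        (solve 5 (λ r p q c d → con (ℤ.+ 2 / 1) :* r :* (con (ℤ.+ 2 / 1) :* r) :* p :- q
            := con (ℤ.+ 4 / 1) :* (con 1ℚ :- d) :- q :+ con (ℤ.+ 4 / 1) :* (r :* r :* (con 1ℚ :- c) :- (con 1ℚ :- d))
            :+ con (ℤ.+ 4 / 1) :* (r :* r) :* (p :- (con 1ℚ :- c))) refl
           R (1ℚ - re (χ ²) 1) (1ℚ - re (χ ²) T) c d)
    }
    where
    0≤4 : 0ℚ ≤ (ℤ.+ 4 / 1)
    0≤4 = 0≤ι 4

  triple-moves : 1ℚ - c ≤ 1ℚ - re (χ ³) 1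
  triple-moves = ≤-by (((0≤ι 4 ⊗ 0≤c) ⊗ (0≤1 ⊕ 0≤c)) ⊗ ≤⇒0≤- (re≤1 χ 1))
    (trans (cong (λ o → 1ℚ - o - (1ℚ - c)) (re-³ χ 1))
           (solve 1 (λ c → con 1ℚ :- (con (ℤ.+ 4 / 1) :* (c :* c :* c) :- con (ℤ.+ 3 / 1) :* c) :- (con 1ℚ :- c)
               := con (ℤ.+ 4 / 1) :* c :* (con 1ℚ :+ c) :* (con 1ℚ :- c)) refl c))

  triple-close : 1ℚ - re (χ ³) T ≤ (ℤ.+ 9 / 1) * (1ℚ - d)
  triple-close = ≤-by ((0≤ι 4 ⊗ 0≤square (1ℚ - d)) ⊗ (0≤1 ⊕ ≤⇒0≤- (-1≤re χ T)))
    (trans (cong (λ o → (ℤ.+ 9 / 1) * (1ℚ - d) - (1ℚ - o)) (re-³ χ T))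
           (solve 1 (λ d → con (ℤ.+ 9 / 1) :* (con 1ℚ :- d) :- (con 1ℚ :- (con (ℤ.+ 4 / 1) :* (d :* d :* d)
               :- con (ℤ.+ 3 / 1) :* d)) := con (ℤ.+ 4 / 1) :* ((con 1ℚ :- d) :* (con 1ℚ :- d)) :* (con 1ℚ
               :+ (d :- (:- con (ℤ.+ 1 / 1))))) refl d))

  periodic-³ : AlmostPeriodic T ((ℤ.+ 3 / 1) * R) (χ ³)
  periodic-³ = record
    { 0≤R   = 0≤ι 3 ⊗ 0≤R per
    ; moves = ℚ.<-≤-trans (moves per) triple-moves
    ; close = ≤-by
        (≤⇒0≤- triple-close ⊕ 0≤ι 9 ⊗ ≤⇒0≤- (close per) ⊕ (0≤ι 9 ⊗ 0≤square R) ⊗ ≤⇒0≤- triple-moves)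
        (solve 5 (λ r p q c d → con (ℤ.+ 3 / 1) :* r :* (con (ℤ.+ 3 / 1) :* r) :* p :- q
            := con (ℤ.+ 9 / 1) :* (con 1ℚ :- d) :- q :+ con (ℤ.+ 9 / 1) :* (r :* r :* (con 1ℚ :- c) :- (con 1ℚ :- d))
            :+ con (ℤ.+ 9 / 1) :* (r :* r) :* (p :- (con 1ℚ :- c))) refl
           R (1ℚ - re (χ ³) 1) (1ℚ - re (χ ³) T) c d)
    }

-- In the application `rest` holds the sums over rim edges, about which nothing is assumed, and
-- `missing` the numbers of [1, T] that are not in `distinct`. The estimates depend only on the
-- lengths of these two lists, since each entry contributes a unit vector.
record Packing (xs : List ℕ) (T : ℕ) : Set where
  field
    {distinct rest missing} : List ℕ
    split    : pairSums xs ↭ distinct ++ rest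
    complete : distinct ++ missing ↭ range T

  ∑-pairSums : ∀ f → ∑ f (pairSums xs) ≡ ∑ f (range T) + ∑ f rest - ∑ f missing
  ∑-pairSums f = begin
    ∑ f (pairSums xs)                                            ≡⟨ trans (∑-↭ f split) (∑-++ f distinct rest) ⟩
    ∑ f distinct + ∑ f rest                                      ≡⟨ solve 3 (λ s e m → s :+ e
        := s :+ m :+ e :- m) refl (∑ f distinct) (∑ f rest) (∑ f missing) ⟩
    ∑ f distinct + ∑ f missing + ∑ f rest - ∑ f missing          ≡⟨ cong (λ t → t + ∑ f rest - ∑ f missing)
                                                                      (trans (sym (∑-++ f distinct missing)) (∑-↭ f complete)) ⟩
    ∑ f (range T) + ∑ f rest - ∑ f missing                       ∎
    where open ≡-Reasoning

  e μ : ℚ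
  e = ι (length rest)
  μ = ι (length missing)

module _ {xs T} (P : Packing xs T) (χ : Character) where
  open Packing P
  private
    U = ∑ (re χ) xs
    V = ∑ (im χ) xs
    A = U * U - V * V
    B = (ℤ.+ 2 / 1) * (U * V)
    n = U * U + V * V
    Dr = ∑ (re (χ ²)) xs
    Di = ∑ (im (χ ²)) xs
    Er = ∑ (re χ) rest
    Ei = ∑ (im χ) rest
    Mr = ∑ (re χ) missing
    Mi = ∑ (im χ) missing
    Tr = ∑ (re χ) (range T)
    Ti = ∑ (im χ) (range T)

  real-part : A ≡ Dr + (ℤ.+ 2 / 1) * (Tr + Er - Mr)
  real-part = trans (square-re χ xs) (cong (λ p → Dr + (ℤ.+ 2 / 1) * p) (∑-pairSums (re χ)))

  -- n² is the inner product of the square of the character sum with itself; expanding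
  -- one factor leaves inner products with unit vectors.
  norm-bound : ∀ {δ R} → 0ℚ ≤ δ → AlmostPeriodic T R χ → Dr * Dr + Di * Di ≤ δ * δ →
               n ≤ δ + (ℤ.+ 2 / 1) * (R + e + μ)
  norm-bound {δ} {R} 0≤δ per D≤ = *-cancel-≤
    (0≤δ ⊕ 0≤ι 2 ⊗ (0≤R per ⊕ 0≤ι (length rest) ⊕ 0≤ι (length missing)))
    (≤-by (≤⇒0≤- d ⊕ 0≤ι 2 ⊗ (≤⇒0≤- t ⊕ ≤⇒0≤- r ⊕ ≤⇒0≤- m)) eq)
    where
    0≤n : 0ℚ ≤ n
    0≤n = 0≤square U ⊕ 0≤square V
    nn : A * A + B * B ≤ n * n
    nn = ≤-reflexive (solve 2 (λ u v → (u :* u :- v :* v) :* (u :* u :- v :* v) :+ con (ℤ.+ 2 / 1) :* (u :* v)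
        :* (con (ℤ.+ 2 / 1) :* (u :* v)) := (u :* u :+ v :* v) :* (u :* u :+ v :* v)) refl U V)
    d : A * Dr + B * Di ≤ n * δ
    d = cauchy-schwarz A B Dr Di 0≤n 0≤δ nn D≤
    t : A * Tr + B * Ti ≤ n * R
    t = cauchy-schwarz A B Tr Ti 0≤n (0≤R per) nn (range-bound per)
    r : A * Er + B * Ei ≤ n * e
    r = cauchy-schwarz A B Er Ei 0≤n (0≤ι (length rest)) nn (∑-norm χ rest)
    m : A * (- Mr) + B * (- Mi) ≤ n * μ
    m = cauchy-schwarz A B (- Mr) (- Mi) 0≤n (0≤ι (length missing)) nn
      (≤-trans (≤-reflexive (solve 2 (λ a b → (:- a) :* (:- a) :+ (:- b) :* (:- b) := a :* a :+ b :* b) refl Mr Mi))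
          (∑-norm χ missing))
    AB : n * n ≡ A * (Dr + (ℤ.+ 2 / 1) * (Tr + Er - Mr)) + B * (Di + (ℤ.+ 2 / 1) * (Ti + Ei - Mi))
    AB = trans (solve 2 (λ u v → (u :* u :+ v :* v) :* (u :* u :+ v :* v)
        := (u :* u :- v :* v) :* (u :* u :- v :* v) :+ con (ℤ.+ 2 / 1) :* (u :* v) :* (con (ℤ.+ 2 / 1) :* (u :* v))) refl U V)
      (cong₂ (λ p q → A * p + B * q) real-part
        (trans (square-im χ xs) (cong (λ p → Di + (ℤ.+ 2 / 1) * p) (∑-pairSums (im χ)))))
    eq : n * (δ + (ℤ.+ 2 / 1) * (R + e + μ)) - n * n
         ≡ n * δ - (A * Dr + B * Di) + (ℤ.+ 2 / 1) * (n * R - (A * Tr + B * Ti) + (n * e - (A * Er + B * Ei))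
                                              + (n * μ - (A * (- Mr) + B * (- Mi))))
    eq = trans (cong (λ q → n * (δ + (ℤ.+ 2 / 1) * (R + e + μ)) - q) AB)
      (solve 15 (λ A B n δ R e μ dr di tr ti er ei mr mi → n :* (δ :+ con (ℤ.+ 2 / 1) :* (R :+ e :+ μ))
          :- (A :* (dr :+ con (ℤ.+ 2 / 1) :* (tr :+ er :- mr)) :+ B :* (di :+ con (ℤ.+ 2 / 1) :* (ti :+ ei :- mi)))
          := n :* δ :- (A :* dr :+ B :* di) :+ con (ℤ.+ 2 / 1) :* (n :* R :- (A :* tr :+ B :* ti)
          :+ (n :* e :- (A :* er :+ B :* ei)) :+ (n :* μ :- (A :* (:- mr) :+ B :* (:- mi))))) refl
         A B n δ R e μ Dr Di Tr Ti Er Ei Mr Mi)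

-- Found by numerical optimisation, to bound the kernel below by 1 on the upper half circle.
c₁ c₂ c₄ c₆ c₈ : ℚ
c₁ = (ℤ.+ 163 / 100)
c₂ = (ℤ.+ 7417 / 10000)
c₄ = (ℤ.+ 419 / 2500)
c₆ = (ℤ.+ 27 / 400)
c₈ = (ℤ.+ 29 / 1250)

-- Every term is invariant under θ ↦ π - θ, the symmetry of the upper half circle, so the kernel is
-- a polynomial in sin θ. Since c₂ + c₄ + c₆ + c₈ = 1, its value at both ends of the half circle is
-- exactly 1.
kernel : Character → ℕ → ℚ
kernel χ x = c₁ * im χ x + c₂ * re (χ ²) x + c₄ * re (χ ² ²) x + c₆ * re (χ ² ³) x + c₈ * re (χ ² ² ²) x

-- Upper bound for the kernel sum

module Estimate {xs T R} (P : Packing xs T) (χ : Character) (per : AlmostPeriodic T R χ)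
                (small : 1ℚ - re χ 1 ≤ (ℤ.+ 1 / 100)) where
  open Packing P
  χ₂ = χ ²
  χ₄ = χ₂ ²
  χ₈ = χ₄ ²
  χ₆ = χ₂ ³

  private
    V  = ∑ (im χ) xs
    U  = ∑ (re χ) xs
    P₂ = ∑ (re χ₂) xs
    W₂ = ∑ (im χ₂) xs
    Q₄ = ∑ (re χ₄) xs
    Q₆ = ∑ (re χ₆) xs
    Q₈ = ∑ (re χ₈) xs
    M  = ι (length xs)

    -- Squaring a character at most quadruples 1 - Re at 1. Starting from 1/100, the real parts of
    -- χ, χ² and χ⁴ at 1 therefore stay nonnegative, as `periodic-²` and `periodic-³` require.
    0≤re : 0ℚ ≤ re χ 1
    0≤re = ≤-trans (positive-constant {ℤ.+ 99 / 100}) (≤-by (≤⇒0≤- small)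
      (solve 1 (λ c → c :- con (ℤ.+ 99 / 100) := con (ℤ.+ 1 / 100) :- (con 1ℚ :- c)) refl (re χ 1)))
    small₂ : 1ℚ - re χ₂ 1 ≤ (ℤ.+ 1 / 25)
    small₂ = ≤-by (0≤ι 2 ⊗ 0≤square (1ℚ - re χ 1) ⊕ 0≤ι 4 ⊗ ≤⇒0≤- small)
      (trans (cong (λ o → (ℤ.+ 1 / 25) - (1ℚ - o)) (re-2* χ 1))
        (solve 1 (λ c → con (ℤ.+ 1 / 25) :- (con 1ℚ :- (con (ℤ.+ 2 / 1) :* (c :* c) :- con 1ℚ))
            := con (ℤ.+ 2 / 1) :* ((con 1ℚ :- c) :* (con 1ℚ :- c)) :+ con (ℤ.+ 4 / 1) :* (con (ℤ.+ 1 / 100)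
            :- (con 1ℚ :- c))) refl (re χ 1)))
    0≤re₂ : 0ℚ ≤ re χ₂ 1
    0≤re₂ = ≤-trans (positive-constant {ℤ.+ 24 / 25}) (≤-by (≤⇒0≤- small₂)
      (solve 1 (λ c → c :- con (ℤ.+ 24 / 25) := con (ℤ.+ 1 / 25) :- (con 1ℚ :- c)) refl (re χ₂ 1)))
    0≤re₄ : 0ℚ ≤ re χ₄ 1
    0≤re₄ = ≤-trans (positive-constant {ℤ.+ 21 / 25})
      (≤-by (0≤ι 2 ⊗ 0≤square (1ℚ - re χ₂ 1) ⊕ 0≤ι 4 ⊗ ≤⇒0≤- small₂)
      (trans (cong (λ o → o - (ℤ.+ 21 / 25)) (re-2* χ₂ 1))
        (solve 1 (λ c → con (ℤ.+ 2 / 1) :* (c :* c) :- con 1ℚ :- con (ℤ.+ 21 / 25)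
            := con (ℤ.+ 2 / 1) :* ((con 1ℚ :- c) :* (con 1ℚ :- c)) :+ con (ℤ.+ 4 / 1) :* (con (ℤ.+ 1 / 25)
            :- (con 1ℚ :- c))) refl (re χ₂ 1))))

    per₂ = periodic-² per 0≤re
    per₄ = periodic-² per₂ 0≤re₂
    per₈ = periodic-² per₄ 0≤re₄
    per₆ = periodic-³ per₂ 0≤re₂

  -- `γ₄` majorises the moduli of the sums of χ⁴, χ⁶ and χ⁸, and `γ₂` that of χ²; the conditions are
  -- quadratic because `norm-bound` controls squared moduli. The largest of the errors, 8 `R` for
  -- χ⁸, serves for all three.
  module _ {γ₂ γ₄ : ℚ} (0≤γ₂ : 0ℚ ≤ γ₂) (0≤γ₄ : 0ℚ ≤ γ₄)
           (γ₄-large : M + (ℤ.+ 2 / 1) * ((ℤ.+ 8 / 1) * R + e + μ) ≤ γ₄ * γ₄)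
           (γ₂-large : γ₄ + (ℤ.+ 2 / 1) * ((ℤ.+ 2 / 1) * R + e + μ) ≤ γ₂ * γ₂) where
    private
      0≤r = 0≤R per
      -- The recursion from a character to its square stops here: the sums of χ⁸, χ¹² and χ¹⁶ are
      -- bounded trivially by the number `M` of values.
      n₄ : Q₄ * Q₄ + ∑ (im χ₄) xs * ∑ (im χ₄) xs ≤ γ₄ * γ₄
      n₄ = ≤-trans (norm-bound P χ₄ (0≤ι (length xs)) per₄ (∑-norm χ₈ xs))
        (≤-by (≤⇒0≤- γ₄-large ⊕ 0≤ι 8 ⊗ 0≤r)
          (solve 5 (λ g M r e m → g :* g :- (M :+ con (ℤ.+ 2 / 1) :* (con (ℤ.+ 2 / 1) :* (con (ℤ.+ 2 / 1) :* r) :+ e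
              :+ m)) := g :* g :- (M :+ con (ℤ.+ 2 / 1) :* (con (ℤ.+ 8 / 1) :* r :+ e :+ m)) :+ con (ℤ.+ 8 / 1) :* r)
              refl γ₄ M R e μ))
      n₈ : Q₈ * Q₈ + ∑ (im χ₈) xs * ∑ (im χ₈) xs ≤ γ₄ * γ₄
      n₈ = ≤-trans (norm-bound P χ₈ (0≤ι (length xs)) per₈ (∑-norm (χ₈ ²) xs))
        (≤-by (≤⇒0≤- γ₄-large)
          (solve 5 (λ g M r e m → g :* g :- (M :+ con (ℤ.+ 2 / 1) :* (con (ℤ.+ 2 / 1) :* (con (ℤ.+ 2 / 1)
              :* (con (ℤ.+ 2 / 1) :* r)) :+ e :+ m))
              := g :* g :- (M :+ con (ℤ.+ 2 / 1) :* (con (ℤ.+ 8 / 1) :* r :+ e :+ m))) refl γ₄ M R e μ))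
      n₆ : Q₆ * Q₆ + ∑ (im χ₆) xs * ∑ (im χ₆) xs ≤ γ₄ * γ₄
      n₆ = ≤-trans (norm-bound P χ₆ (0≤ι (length xs)) per₆ (∑-norm (χ₆ ²) xs))
        (≤-by (≤⇒0≤- γ₄-large ⊕ 0≤ι 4 ⊗ 0≤r)
          (solve 5 (λ g M r e m → g :* g :- (M :+ con (ℤ.+ 2 / 1) :* (con (ℤ.+ 3 / 1) :* (con (ℤ.+ 2 / 1) :* r) :+ e
              :+ m)) := g :* g :- (M :+ con (ℤ.+ 2 / 1) :* (con (ℤ.+ 8 / 1) :* r :+ e :+ m)) :+ con (ℤ.+ 4 / 1) :* r)
              refl γ₄ M R e μ))
      n₂ : P₂ * P₂ + W₂ * W₂ ≤ γ₄ + (ℤ.+ 2 / 1) * ((ℤ.+ 2 / 1) * R + e + μ)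
      n₂ = norm-bound P χ₂ 0≤γ₄ per₂ n₄
      n₁ : U * U + V * V ≤ γ₂ + (ℤ.+ 2 / 1) * (R + e + μ)
      n₁ = norm-bound P χ 0≤γ₂ per (≤-trans n₂ γ₂-large)

      ≤γ₄ : ∀ q w → q * q + w * w ≤ γ₄ * γ₄ → q ≤ γ₄
      ≤γ₄ q w le = square-cancel-≤ 0≤γ₄ (≤-trans
        (≤-by (0≤square w) (solve 2 (λ q w → q :* q :+ w :* w :- q :* q := w :* w) refl q w)) le)

      -T≤R : - ∑ (re χ) (range T) ≤ R
      -T≤R = square-cancel-≤ 0≤r (≤-trans
        (≤-by (0≤square (∑ (im χ) (range T)))
          (solve 2 (λ q w → q :* q :+ w :* w :- (:- q) :* (:- q) := w :* w) refl (∑ (re χ) (range T)) (∑ (im χ) (range T))))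
        (range-bound per))
      T₂≤2R : ∑ (re χ₂) (range T) ≤ (ℤ.+ 2 / 1) * R
      T₂≤2R = square-cancel-≤ (0≤ι 2 ⊗ 0≤r) (≤-trans
        (≤-by (0≤square (∑ (im χ₂) (range T)))
          (solve 2 (λ q w → q :* q :+ w :* w :- q :* q := w :* w) refl (∑ (re χ₂) (range T)) (∑ (im χ₂) (range T))))
        (range-bound per₂))

      on-rest : - 1ℚ * ∑ (re χ) rest + (ℤ.+ 9 / 20) * ∑ (re χ₂) rest ≤ e * (ℤ.+ 29 / 20)
      on-rest = subst (_≤ e * (ℤ.+ 29 / 20)) (∑-linear (- 1ℚ) (ℤ.+ 9 / 20) (re χ) (re χ₂) rest)
        (∑-≤-const _ (λ s → ≤-by (≤⇒0≤- (-1≤re χ s) ⊗ (0≤1 ⊕ positive-constant {ℤ.+ 9 / 10} ⊗ ≤⇒0≤- (re≤1 χ s)))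
          (trans (cong (λ o → (ℤ.+ 29 / 20) - (- 1ℚ * re χ s + (ℤ.+ 9 / 20) * o)) (re-2* χ s))
            (solve 1 (λ x → con (ℤ.+ 29 / 20) :- ((:- con (ℤ.+ 1 / 1)) :* x :+ con (ℤ.+ 9 / 20) :* (con (ℤ.+ 2 / 1)
                :* (x :* x) :- con 1ℚ)) := (x :- (:- con (ℤ.+ 1 / 1))) :* (con 1ℚ :+ con (ℤ.+ 9 / 10) :* (con 1ℚ :- x)))
                refl (re χ s)))) rest)

      -- The real parts of χ and χ² enter with opposite signs and cannot both be extremal: the joint
      -- maximum, attained at Re χ = 5/9, is 131/180 instead of 1 + 9/20. The gain matters because
      -- `μ` causes the largest error.
      on-missing : 1ℚ * ∑ (re χ) missing + (- (ℤ.+ 9 / 20)) * ∑ (re χ₂) missing ≤ μ * (ℤ.+ 131 / 180)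
      on-missing = subst (_≤ μ * (ℤ.+ 131 / 180)) (∑-linear 1ℚ (- (ℤ.+ 9 / 20)) (re χ) (re χ₂) missing)
        (∑-≤-const _ (λ s → ≤-by (positive-constant {ℤ.+ 9 / 10} ⊗ 0≤square (re χ s - (ℤ.+ 5 / 9)))
          (trans (cong (λ o → (ℤ.+ 131 / 180) - (1ℚ * re χ s + (- (ℤ.+ 9 / 20)) * o)) (re-2* χ s))
            (solve 1 (λ x → con (ℤ.+ 131 / 180) :- (con 1ℚ :* x :+ (:- con (ℤ.+ 9 / 20)) :* (con (ℤ.+ 2 / 1) :* (x :* x)
                :- con 1ℚ)) := con (ℤ.+ 9 / 10) :* ((x :- con (ℤ.+ 5 / 9)) :* (x :- con (ℤ.+ 5 / 9)))) refl (re χ s)))) missing)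

    -- 98/45 = 1 + 9/20 + 131/180 and 29/10 = 1 + 9/20 + 29/20: the first two summands come from
    -- `norm-bound` for χ and χ², the third from the pointwise bounds above. Similarly 19/5 = 1 +
    -- 9/10 + 1 + 9/10, where the last two come from the sums over `range T`.
    X : ℚ
    X = (ℤ.+ 1 / 2) * γ₂ + (ℤ.+ 9 / 20) * γ₄ + (ℤ.+ 98 / 45) * μ + (ℤ.+ 29 / 10) * e + (ℤ.+ 19 / 5) * R

    -- 2V² = |G|² − Re G² and 2P² = |G′|² + Re G′², where G and G′ are the sums of χ and χ².
    quadratic-bound : V * V + (ℤ.+ 1 / 2) * P₂ + (ℤ.+ 9 / 20) * (P₂ * P₂) ≤ X
    quadratic-bound = ≤-by
      (0≤½ ⊗ ≤⇒0≤- n₁ ⊕ 0≤9/40 ⊗ ≤⇒0≤- n₂ ⊕ 0≤9/40 ⊗ ≤⇒0≤- (≤γ₄ Q₄ (∑ (im χ₄) xs) n₄) ⊕ ≤⇒0≤- -T≤R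
        ⊕ (0≤ι 2 ⊗ 0≤9/40) ⊗ ≤⇒0≤- T₂≤2R ⊕ ≤⇒0≤- on-rest ⊕ ≤⇒0≤- on-missing)
      (begin
        X - (V * V + (ℤ.+ 1 / 2) * P₂ + (ℤ.+ 9 / 20) * (P₂ * P₂))
          ≡⟨ solve 5 (λ x u v p w → x :- (v :* v :+ con (ℤ.+ 1 / 2) :* p :+ con (ℤ.+ 9 / 20) :* (p :* p))
              := x :- (con (ℤ.+ 1 / 2) :* (u :* u :+ v :* v :- (u :* u :- v :* v)) :+ con (ℤ.+ 1 / 2) :* p
              :+ con (ℤ.+ 9 / 40) :* (p :* p :+ w :* w :+ (p :* p :- w :* w)))) refl X U V P₂ W₂ ⟩
        X - ((ℤ.+ 1 / 2) * (U * U + V * V - (U * U - V * V)) + (ℤ.+ 1 / 2) * P₂ + (ℤ.+ 9 / 40) * (P₂ * P₂ + W₂ * W₂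
            + (P₂ * P₂ - W₂ * W₂)))
          ≡⟨ cong₂ (λ p q → X - ((ℤ.+ 1 / 2) * (U * U + V * V - p) + (ℤ.+ 1 / 2) * P₂ + (ℤ.+ 9 / 40) * (P₂ * P₂ + W₂ * W₂ + q)))
               (real-part P χ) (real-part P χ₂) ⟩
        X - ((ℤ.+ 1 / 2) * (U * U + V * V - (P₂ + (ℤ.+ 2 / 1) * (Tr + Er - Mr))) + (ℤ.+ 1 / 2) * P₂
             + (ℤ.+ 9 / 40) * (P₂ * P₂ + W₂ * W₂ + (Q₄ + (ℤ.+ 2 / 1) * (T₂ + E₂ - M₂))))
          ≡⟨ solve 15 (λ g f R e μ n m p q tr er mr t2 e2 m2 → con (ℤ.+ 1 / 2) :* g :+ con (ℤ.+ 9 / 20) :* f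
              :+ con (ℤ.+ 98 / 45) :* μ :+ con (ℤ.+ 29 / 10) :* e :+ con (ℤ.+ 19 / 5) :* R :- (con (ℤ.+ 1 / 2) :* (n
              :- (p :+ con (ℤ.+ 2 / 1) :* (tr :+ er :- mr))) :+ con (ℤ.+ 1 / 2) :* p :+ con (ℤ.+ 9 / 40) :* (m
              :+ (q :+ con (ℤ.+ 2 / 1) :* (t2 :+ e2 :- m2))))
              := con (ℤ.+ 1 / 2) :* (g :+ con (ℤ.+ 2 / 1) :* (R :+ e :+ μ) :- n) :+ con (ℤ.+ 9 / 40) :* (f
              :+ con (ℤ.+ 2 / 1) :* (con (ℤ.+ 2 / 1) :* R :+ e :+ μ) :- m) :+ con (ℤ.+ 9 / 40) :* (f :- q)
              :+ (R :- (:- tr)) :+ con (ℤ.+ 2 / 1) :* con (ℤ.+ 9 / 40) :* (con (ℤ.+ 2 / 1) :* R :- t2)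
              :+ (e :* con (ℤ.+ 29 / 20) :- ((:- con (ℤ.+ 1 / 1)) :* er :+ con (ℤ.+ 9 / 20) :* e2))
              :+ (μ :* con (ℤ.+ 131 / 180) :- (con 1ℚ :* mr :+ (:- con (ℤ.+ 9 / 20)) :* m2))) refl
               γ₂ γ₄ R e μ (U * U + V * V) (P₂ * P₂ + W₂ * W₂) P₂ Q₄ Tr Er Mr T₂ E₂ M₂ ⟩
        (ℤ.+ 1 / 2) * (γ₂ + (ℤ.+ 2 / 1) * (R + e + μ) - (U * U + V * V)) + (ℤ.+ 9 / 40) * (γ₄ + (ℤ.+ 2 / 1)
            * ((ℤ.+ 2 / 1) * R + e + μ) - (P₂ * P₂ + W₂ * W₂))
          + (ℤ.+ 9 / 40) * (γ₄ - Q₄) + (R - (- Tr)) + ((ℤ.+ 2 / 1) * (ℤ.+ 9 / 40)) * ((ℤ.+ 2 / 1) * R - T₂)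
          + (e * (ℤ.+ 29 / 20) - (- 1ℚ * Er + (ℤ.+ 9 / 20) * E₂)) + (μ * (ℤ.+ 131 / 180) - (1ℚ * Mr + (- (ℤ.+ 9 / 20)) * M₂)) ∎)
      where
      open ≡-Reasoning
      0≤½ : 0ℚ ≤ (ℤ.+ 1 / 2)
      0≤½ = positive-constant {ℤ.+ 1 / 2}
      0≤9/40 : 0ℚ ≤ (ℤ.+ 9 / 40)
      0≤9/40 = positive-constant {ℤ.+ 9 / 40}
      Tr = ∑ (re χ) (range T)
      Er = ∑ (re χ) rest
      Mr = ∑ (re χ) missing
      T₂ = ∑ (re χ₂) (range T)
      E₂ = ∑ (re χ₂) rest
      M₂ = ∑ (re χ₂) missing

    -- The multiplier `k` is free, and the linear terms are absorbed by completing squares: 2 k c₁ V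
    -- ≤ V² + (k c₁)², and likewise for `P₂` with the weight 9/20, where 10/9 and 5/9 are 1 / (2 ·
    -- 9/20) and 1 / (4 · 9/20). As Re G² contains `P₂` itself, `quadratic-bound` has P₂ / 2 on its
    -- left side, which lowers the coefficient 2 k c₂ by 1/2.
    kernel-sum-bound : ∀ {k} → 0ℚ ≤ k →
      (ℤ.+ 2 / 1) * k * ∑ (kernel χ) xs
        ≤ X + k * k * (c₁ * c₁) + (ℤ.+ 5 / 9) * (((ℤ.+ 2 / 1) * k * c₂ - (ℤ.+ 1 / 2)) * ((ℤ.+ 2 / 1) * k * c₂ - (ℤ.+ 1 / 2)))
            + (ℤ.+ 2 / 1) * k * (c₄ + c₆ + c₈) * γ₄
    kernel-sum-bound {k} 0≤k = ≤-by
      (≤⇒0≤- quadratic-bound ⊕ 0≤square (V - k * c₁)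
        ⊕ positive-constant {ℤ.+ 9 / 20} ⊗ 0≤square (P₂ - (ℤ.+ 10 / 9) * ((ℤ.+ 2 / 1) * k * c₂ - (ℤ.+ 1 / 2)))
        ⊕ 0≤ι 2 ⊗ 0≤k ⊗ (positive-constant {c₄} ⊗ ≤⇒0≤- (≤γ₄ Q₄ (∑ (im χ₄) xs) n₄) ⊕ positive-constant {c₆} ⊗ ≤⇒0≤-
            (≤γ₄ Q₆ (∑ (im χ₆) xs) n₆)
                          ⊕ positive-constant {c₈} ⊗ ≤⇒0≤- (≤γ₄ Q₈ (∑ (im χ₈) xs) n₈)))
      (trans (cong (λ s → bound - (ℤ.+ 2 / 1) * k * s) ∑-kernel)
        (solve 8 (λ x k g v p q4 q6 q8 → x :+ k :* k :* (con (ℤ.+ 163 / 100) :* con (ℤ.+ 163 / 100)) :+ con (ℤ.+ 5 / 9)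
            :* ((con (ℤ.+ 2 / 1) :* k :* con (ℤ.+ 7417 / 10000) :- con (ℤ.+ 1 / 2)) :* (con (ℤ.+ 2 / 1) :* k
            :* con (ℤ.+ 7417 / 10000) :- con (ℤ.+ 1 / 2))) :+ con (ℤ.+ 2 / 1) :* k :* (con (ℤ.+ 419 / 2500)
            :+ con (ℤ.+ 27 / 400) :+ con (ℤ.+ 29 / 1250)) :* g :- con (ℤ.+ 2 / 1) :* k :* (con (ℤ.+ 163 / 100) :* v
            :+ con (ℤ.+ 7417 / 10000) :* p :+ con (ℤ.+ 419 / 2500) :* q4 :+ con (ℤ.+ 27 / 400) :* q6
            :+ con (ℤ.+ 29 / 1250) :* q8) := x :- (v :* v :+ con (ℤ.+ 1 / 2) :* p :+ con (ℤ.+ 9 / 20) :* (p :* p))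
            :+ (v :- k :* con (ℤ.+ 163 / 100)) :* (v :- k :* con (ℤ.+ 163 / 100)) :+ con (ℤ.+ 9 / 20)
            :* ((p :- con (ℤ.+ 10 / 9) :* (con (ℤ.+ 2 / 1) :* k :* con (ℤ.+ 7417 / 10000) :- con (ℤ.+ 1 / 2))) :* (p
            :- con (ℤ.+ 10 / 9) :* (con (ℤ.+ 2 / 1) :* k :* con (ℤ.+ 7417 / 10000) :- con (ℤ.+ 1 / 2))))
            :+ con (ℤ.+ 2 / 1) :* k :* (con (ℤ.+ 419 / 2500) :* (g :- q4) :+ con (ℤ.+ 27 / 400) :* (g :- q6)
            :+ con (ℤ.+ 29 / 1250) :* (g :- q8))) refl
           X k γ₄ V P₂ Q₄ Q₆ Q₈))
      where
      bound = X + k * k * (c₁ * c₁) + (ℤ.+ 5 / 9) * (((ℤ.+ 2 / 1) * k * c₂ - (ℤ.+ 1 / 2)) * ((ℤ.+ 2 / 1) * k * c₂ - (ℤ.+ 1 / 2)))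
                + (ℤ.+ 2 / 1) * k * (c₄ + c₆ + c₈) * γ₄
      ∑-kernel : ∑ (kernel χ) xs ≡ c₁ * V + c₂ * P₂ + c₄ * Q₄ + c₆ * Q₆ + c₈ * Q₈
      ∑-kernel = begin
        ∑ (kernel χ) xs
          ≡⟨ trans (∑-+ _ (λ x → c₈ * re χ₈ x) xs) (cong₂ _+_ (trans (∑-+ _ (λ x → c₆ * re χ₆ x) xs)
               (cong₂ _+_ (trans (∑-+ _ (λ x → c₄ * re χ₄ x) xs) (cong₂ _+_ (∑-linear c₁ c₂ (im χ) (re χ₂) xs)
                 (∑-distribˡ c₄ (re χ₄) xs))) (∑-distribˡ c₆ (re χ₆) xs))) (∑-distribˡ c₈ (re χ₈) xs)) ⟩
        c₁ * V + c₂ * P₂ + c₄ * Q₄ + c₆ * Q₆ + c₈ * Q₈ ∎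
        where open ≡-Reasoning

-- A rational rotation by almost a full turn over T

reciprocal : ∀ {q} → 0ℚ < q → ∃[ p ] 0ℚ ≤ p × q * p ≡ 1ℚ
reciprocal {q} 0<q = 1/ q , ℚ.<⇒≤ (ℚ.positive⁻¹ (1/ q) {{ℚ.1/pos⇒pos q}}) , ℚ.*-inverseʳ q
  where
  instance
    q-pos = positive 0<q
    q≢0   = ℚ.pos⇒nonZero q

module Powers (c s : ℚ) (cc+ss : c * c + s * s ≡ 1ℚ) where

  power-re power-im : ℕ → ℚ
  power-re zero    = 1ℚ
  power-re (suc k) = c * power-re k - s * power-im k
  power-im zero    = 0ℚ
  power-im (suc k) = s * power-re k + c * power-im k

  power-re-+ : ∀ j k → power-re (j ℕ.+ k) ≡ power-re j * power-re k - power-im j * power-im k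
  power-im-+ : ∀ j k → power-im (j ℕ.+ k) ≡ power-im j * power-re k + power-re j * power-im k
  power-re-+ zero    k = solve 2 (λ a b → a := con 1ℚ :* a :- con 0ℚ :* b) refl (power-re k) (power-im k)
  power-re-+ (suc j) k = trans (cong₂ (λ p q → c * p - s * q) (power-re-+ j k) (power-im-+ j k))
    (solve 6 (λ c s a b x y → c :* (a :* x :- b :* y) :- s :* (b :* x :+ a :* y)
        := (c :* a :- s :* b) :* x :- (s :* a :+ c :* b) :* y) refl c s (power-re j) (power-im j) (power-re k) (power-im k))
  power-im-+ zero    k = solve 2 (λ a b → b := con 0ℚ :* a :+ con 1ℚ :* b) refl (power-re k) (power-im k)
  power-im-+ (suc j) k = trans (cong₂ (λ p q → s * p + c * q) (power-re-+ j k) (power-im-+ j k))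
    (solve 6 (λ c s a b x y → s :* (a :* x :- b :* y) :+ c :* (b :* x :+ a :* y)
        := (s :* a :+ c :* b) :* x :+ (c :* a :- s :* b) :* y) refl c s (power-re j) (power-im j) (power-re k) (power-im k))

  power-unit : ∀ k → power-re k * power-re k + power-im k * power-im k ≡ 1ℚ
  power-unit zero    = refl
  power-unit (suc k) = trans
    (solve 4 (λ c s a b → (c :* a :- s :* b) :* (c :* a :- s :* b) :+ (s :* a :+ c :* b) :* (s :* a :+ c :* b)
        := (c :* c :+ s :* s) :* (a :* a :+ b :* b)) refl c s (power-re k) (power-im k))
    (cong₂ _*_ cc+ss (power-unit k))

  powers : Character
  powers = record { re = power-re ; im = power-im ; re-+ = power-re-+ ; im-+ = power-im-+ ; unit = power-unit }

-- The value at `k` has an angle between 0 and arctan `τ`; the slope stands in for the angle.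
record Cone (χ : Character) (τ : ℚ) (k : ℕ) : Set where
  field
    0≤re  : 0ℚ ≤ re χ k
    0≤im  : 0ℚ ≤ im χ k
    slope : im χ k ≤ τ * re χ k

open Cone

-- The last numerical hypothesis is σ ≥ 2 τ / (1 - τ²), the tangent of the doubled angle, cleared of
-- its denominator.
cone-² : ∀ {χ τ k} σ → 0ℚ ≤ τ → τ ≤ 1ℚ → 0ℚ ≤ σ → (ℤ.+ 2 / 1) * τ ≤ σ * (1ℚ - τ * τ) → Cone χ τ k → Cone (χ ²) σ k
cone-² {χ} {τ} {k} σ 0≤τ τ≤1 0≤σ le cone = record
  { 0≤re  = subst (0ℚ ≤_) (sym (trans (re-+ χ k k) re-eq)) 0≤rr
  ; 0≤im  = subst (0ℚ ≤_) (sym (im-+ χ k k)) (0≤im cone ⊗ 0≤re cone ⊕ 0≤re cone ⊗ 0≤im cone)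
  ; slope = ≤-by (0≤σ ⊗ 0≤gap ⊕ 0≤ι 2 ⊗ (d ⊗ 0≤re cone) ⊕ ≤⇒0≤- le ⊗ 0≤square (re χ k))
      (trans (cong₂ (λ p q → σ * p - q) (re-+ χ k k) (im-+ χ k k))
        (solve 4 (λ s t a b → s :* (a :* a :- b :* b) :- (b :* a :+ a :* b)
            := s :* ((t :* a :- b) :* (t :* a) :+ b :* (t :* a :- b)) :+ con (ℤ.+ 2 / 1) :* ((t :* a :- b) :* a)
            :+ (s :* (con 1ℚ :- t :* t) :- con (ℤ.+ 2 / 1) :* t) :* (a :* a)) refl
           σ τ (re χ k) (im χ k)))
  }
  where
  d = ≤⇒0≤- (slope cone)
  0≤gap : 0ℚ ≤ (τ * re χ k - im χ k) * (τ * re χ k) + im χ k * (τ * re χ k - im χ k)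
  0≤gap = d ⊗ (0≤τ ⊗ 0≤re cone) ⊕ 0≤im cone ⊗ d
  0≤rr : 0ℚ ≤ (τ * re χ k - im χ k) * (τ * re χ k) + im χ k * (τ * re χ k - im χ k)
               + (1ℚ - τ) * (1ℚ + τ) * (re χ k * re χ k)
  0≤rr = 0≤gap ⊕ ≤⇒0≤- τ≤1 ⊗ (0≤1 ⊕ 0≤τ) ⊗ 0≤square (re χ k)
  re-eq : re χ k * re χ k - im χ k * im χ k
          ≡ (τ * re χ k - im χ k) * (τ * re χ k) + im χ k * (τ * re χ k - im χ k)
            + (1ℚ - τ) * (1ℚ + τ) * (re χ k * re χ k)
  re-eq = solve 3 (λ t a b → a :* a :- b :* b := (t :* a :- b) :* (t :* a) :+ b :* (t :* a :- b) :+ (con 1ℚ :- t)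
      :* (con 1ℚ :+ t) :* (a :* a)) refl τ (re χ k) (im χ k)

abstract
  -- 75/382 falls short of π / 16 by less than 0.00002. What is used later about `e₀`, `ω` and `σ₀`
  -- are the inequalities of this block.
  e₀ : ℚ
  e₀ = (ℤ.+ 75 / 382)

  0≤e₀ : 0ℚ ≤ e₀
  0≤e₀ = positive-constant

  0<e₀ : 0ℚ < e₀
  0<e₀ = toWitness {a? = 0ℚ <? e₀} _

  -- 267/200 is 1 + κ with the κ = 67/200 of `below`, where this keeps `X` nonnegative.
  e₀-small : 0ℚ ≤ 1ℚ - (ℤ.+ 267 / 200) * (e₀ * e₀)
  e₀-small = positive-constant

  -- 1/200 is 3 κ - 1, positive because κ > 1/3. It has to absorb a term κ² z z′ ≤ κ² e₀² in the
  -- induction for the tangent.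
  e₀-small′ : 0ℚ ≤ (ℤ.+ 1 / 200) - (ℤ.+ 67 / 200) * (ℤ.+ 67 / 200) * (e₀ * e₀)
  e₀-small′ = positive-constant

  e₀-small″ : 0ℚ ≤ 1ℚ - (ℤ.+ 67 / 200) * (e₀ * e₀) - (ℤ.+ 9 / 10)
  e₀-small″ = positive-constant

  e₀-tan : 0ℚ ≤ (1ℚ - (ℤ.+ 67 / 200) * (e₀ * e₀)) * (ℤ.+ 73 / 367) - e₀
  e₀-tan = positive-constant

  e₀-cubic : 0ℚ ≤ e₀ + (ℤ.+ 1 / 3) * (e₀ * e₀ * e₀) - (ℤ.+ 1 / 3) * e₀ * (ℤ.+ 1 / 6250000) - (ℤ.+ 174 / 875)
  e₀-cubic = positive-constant

  e₀≤1/5 : e₀ ≤ (ℤ.+ 1 / 5)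
  e₀≤1/5 = toWitness {a? = e₀ ≤? (ℤ.+ 1 / 5)} _

  32e₀≤ : (ℤ.+ 32 / 1) * e₀ ≤ (ℤ.+ 6283 / 1000)
  32e₀≤ = toWitness {a? = (ℤ.+ 32 / 1) * e₀ ≤? (ℤ.+ 6283 / 1000)} _

  -- The T-th power of the rotation u has an angle θ close to π / 8, for which
  -- tan 2θ ≥ σ₀ and cos 4θ ≤ ω.
  ω : ℚ
  ω = (ℤ.+ 443 / 1000000)

  σ₀ : ℚ
  σ₀ = (ℤ.+ 2260 / 2261)

  0≤ω : 0ℚ ≤ ω
  0≤ω = positive-constant

  0≤σ₀ : 0ℚ ≤ σ₀
  0≤σ₀ = positive-constant

  σ₀-fact : 0ℚ ≤ (ℤ.+ 2 / 1) * (ℤ.+ 147 / 355) - σ₀ + σ₀ * ((ℤ.+ 147 / 355) * (ℤ.+ 147 / 355))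
  σ₀-fact = positive-constant

  ω-fact : 0ℚ ≤ (1ℚ + ω) * (σ₀ * σ₀) - (1ℚ - ω)
  ω-fact = positive-constant

  -- The left side will bound 1 - Re χ(T). On the right, (3/10000)² is the square of the error
  -- constant and 510 ε² a lower bound for 1 - Re χ(1), combined through T ε = e₀.
  ω²≤ : (ℤ.+ 8 / 1) * (ω * ω) ≤ (ℤ.+ 9 / 100000000) * (ℤ.+ 510 / 1) * (e₀ * e₀)
  ω²≤ = toWitness {a? = (ℤ.+ 8 / 1) * (ω * ω) ≤? (ℤ.+ 9 / 100000000) * (ℤ.+ 510 / 1) * (e₀ * e₀)} _

module Rotation (T : ℕ) (500≤T : 500 ℕ.≤ T) where
  private
    ιT = ι T
    0<T : 0ℚ < ιT
    0<T = ℚ.<-≤-trans (toWitness {a? = 0ℚ <? 1ℚ} _) (ι-mono-≤ {1} (ℕ.≤-trans (s≤s z≤n) 500≤T))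

  -- e₀ is just below π / 16, so 32 T steps of angle arctan ε make almost a full turn.
  ε : ℚ
  ε = e₀ * proj₁ (reciprocal 0<T)

  Tε≡e₀ : ιT * ε ≡ e₀
  Tε≡e₀ = trans (solve 3 (λ t e i → t :* (e :* i) := e :* (t :* i)) refl ιT e₀ (proj₁ (reciprocal 0<T)))
    (trans (cong (e₀ *_) (proj₂ (proj₂ (reciprocal 0<T)))) (ℚ.*-identityʳ e₀))

  0≤ε : 0ℚ ≤ ε
  0≤ε = 0≤e₀ ⊗ proj₁ (proj₂ (reciprocal 0<T))

  private
    n : ℚ
    n = 1ℚ + ε * ε
    0<n : 0ℚ < n
    0<n = ℚ.<-≤-trans (toWitness {a? = 0ℚ <? 1ℚ} _)
      (≤-by (0≤square ε) (solve 1 (λ e → con 1ℚ :+ e :* e :- con 1ℚ := e :* e) refl ε))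

  v : ℚ
  v = proj₁ (reciprocal 0<n)

  0≤v : 0ℚ ≤ v
  0≤v = proj₁ (proj₂ (reciprocal 0<n))

  nv≡1 : n * v ≡ 1ℚ
  nv≡1 = proj₂ (proj₂ (reciprocal 0<n))

  -- The rational parametrisation of the circle: (1 + i ε)² / (1 + ε²) has the angle 2 arctan ε.
  open Powers ((1ℚ - ε * ε) * v) ((ℤ.+ 2 / 1) * ε * v)
    (trans (solve 2 (λ e v → (con 1ℚ :- e :* e) :* v :* ((con 1ℚ :- e :* e) :* v) :+ con (ℤ.+ 2 / 1) :* e :* v
        :* (con (ℤ.+ 2 / 1) :* e :* v) := (con 1ℚ :+ e :* e) :* v :* ((con 1ℚ :+ e :* e) :* v)) refl ε v)
           (cong₂ _*_ nv≡1 nv≡1))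
    public renaming (powers to u)

  -- (1 + iε)ʲ = X j + i Y j, whose square has the direction of the j-th power of u.
  X Y vʲ : ℕ → ℚ
  X zero    = 1ℚ
  X (suc j) = X j - ε * Y j
  Y zero    = 0ℚ
  Y (suc j) = Y j + ε * X j
  vʲ zero    = 1ℚ
  vʲ (suc j) = v * vʲ j

  0≤vʲ : ∀ j → 0ℚ ≤ vʲ j
  0≤vʲ zero    = 0≤1
  0≤vʲ (suc j) = 0≤v ⊗ 0≤vʲ j

  re-u : ∀ j → re u j ≡ vʲ j * (X j * X j - Y j * Y j)
  im-u : ∀ j → im u j ≡ vʲ j * ((ℤ.+ 2 / 1) * (X j * Y j))
  re-u zero    = refl
  re-u (suc j) = trans (cong₂ (λ p q → (1ℚ - ε * ε) * v * p - (ℤ.+ 2 / 1) * ε * v * q) (re-u j) (im-u j))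
    (solve 5 (λ e v w x y → (con 1ℚ :- e :* e) :* v :* (w :* (x :* x :- y :* y)) :- con (ℤ.+ 2 / 1) :* e :* v
        :* (w :* (con (ℤ.+ 2 / 1) :* (x :* y)))
        := v :* w :* ((x :- e :* y) :* (x :- e :* y) :- (y :+ e :* x) :* (y :+ e :* x))) refl ε v (vʲ j) (X j) (Y j))
  im-u zero    = refl
  im-u (suc j) = trans (cong₂ (λ p q → (ℤ.+ 2 / 1) * ε * v * p + (1ℚ - ε * ε) * v * q) (re-u j) (im-u j))
    (solve 5 (λ e v w x y → con (ℤ.+ 2 / 1) :* e :* v :* (w :* (x :* x :- y :* y)) :+ (con 1ℚ :- e :* e) :* v
        :* (w :* (con (ℤ.+ 2 / 1) :* (x :* y))) := v :* w :* (con (ℤ.+ 2 / 1) :* ((x :- e :* y) :* (y :+ e :* x)))) refl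
        ε v (vʲ j) (X j) (Y j))

  κ : ℚ
  κ = (ℤ.+ 67 / 200)

  ιε≤e₀ : ∀ {j} → j ℕ.≤ T → ι j * ε ≤ e₀
  ιε≤e₀ j≤T = ≤-trans (ℚ.*-monoʳ-≤-nonNeg ε {{nonNegative 0≤ε}} (ι-mono-≤ j≤T)) (≤-reflexive Tε≡e₀)

  -- tan x ≤ x / (1 − κ x²) for small x, as κ > 1/3.
  record Below (j : ℕ) : Set where
    field
      0≤X   : 0ℚ ≤ X j
      0≤Y   : 0ℚ ≤ Y j
      tan≤  : (1ℚ - κ * (ι j * ε * (ι j * ε))) * Y j ≤ ι j * ε * X j

  open Below

  below : ∀ j → j ℕ.≤ T → Below j
  below zero    _    = record { 0≤X = 0≤1 ; 0≤Y = ≤-refl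
    ; tan≤ = ≤-reflexive (solve 1 (λ e → (con 1ℚ :- con (ℤ.+ 67 / 200) :* (con 0ℚ :* e :* (con 0ℚ :* e))) :* con 0ℚ
        := con 0ℚ :* e :* con 1ℚ) refl ε) }
  below (suc j) j<T = record
    { 0≤X  = ℚ.*-cancelˡ-≤-pos D {{positive 0<D}} (≤-by
        (0≤X b ⊗ (e₀-small ⊕ κ≥0 ⊗ e₀²-zz ⊕ e₀²-zε) ⊕ 0≤ε ⊗ ≤⇒0≤- (tan≤ b))
        (solve 5 (λ e0 z e x y → (con 1ℚ :- con (ℤ.+ 67 / 200) :* (z :* z)) :* (x :- e :* y)
            :- (con 1ℚ :- con (ℤ.+ 67 / 200) :* (z :* z)) :* con 0ℚ
            := x :* (con 1ℚ :- con (ℤ.+ 267 / 200) :* (e0 :* e0) :+ con (ℤ.+ 67 / 200) :* (e0 :* e0 :- z :* z)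
            :+ (e0 :* e0 :- z :* e)) :+ e :* (z :* x :- (con 1ℚ :- con (ℤ.+ 67 / 200) :* (z :* z)) :* y)) refl e₀ z ε
            (X j) (Y j)))
    ; 0≤Y  = 0≤Y b ⊕ 0≤ε ⊗ 0≤X b
    -- After multiplication by `D` and replacement of D · Y by z · X, the difference of the two
    -- sides is X ε (z z′ (3 κ - 1 - κ² z z′) + κ ε²), where z′ = z + ε.
    ; tan≤ = subst (λ z′ → (1ℚ - κ * (z′ * z′)) * (Y j + ε * X j) ≤ z′ * (X j - ε * Y j)) (sym z′≡)
        (ℚ.*-cancelˡ-≤-pos D {{positive 0<D}} (≤-by
          ((0≤X b ⊗ 0≤ε) ⊗ ((0≤z ⊗ 0≤z′) ⊗ (e₀-small′ ⊕ (κ≥0 ⊗ κ≥0) ⊗ e₀²-zz′) ⊕ κ≥0 ⊗ 0≤square ε)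
            ⊕ (0≤z′ ⊗ 0≤ε ⊕ 0≤D′) ⊗ ≤⇒0≤- (tan≤ b))
          (solve 5 (λ e0 z e x y → (con 1ℚ :- con (ℤ.+ 67 / 200) :* (z :* z)) :* ((z :+ e) :* (x :- e :* y))
              :- (con 1ℚ :- con (ℤ.+ 67 / 200) :* (z :* z)) :* ((con 1ℚ :- con (ℤ.+ 67 / 200) :* ((z :+ e) :* (z :+ e)))
              :* (y :+ e :* x)) := x :* e :* (z :* (z :+ e) :* (con (ℤ.+ 1 / 200) :- con (ℤ.+ 67 / 200)
              :* con (ℤ.+ 67 / 200) :* (e0 :* e0) :+ con (ℤ.+ 67 / 200) :* con (ℤ.+ 67 / 200) :* (e0 :* e0
              :- z :* (z :+ e))) :+ con (ℤ.+ 67 / 200) :* (e :* e)) :+ ((z :+ e) :* e :+ (con 1ℚ :- con (ℤ.+ 67 / 200)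
              :* (e0 :* e0) :+ con (ℤ.+ 67 / 200) :* (e0 :* e0 :- (z :+ e) :* (z :+ e)))) :* (z :* x
              :- (con 1ℚ :- con (ℤ.+ 67 / 200) :* (z :* z)) :* y)) refl e₀ z ε (X j) (Y j))))
    }
    where
    b = below j (ℕ.<⇒≤ j<T)
    z = ι j * ε
    D = 1ℚ - κ * (z * z)
    z′≡ : ι (suc j) * ε ≡ z + ε
    z′≡ = solve 2 (λ n e → (con 1ℚ :+ n) :* e := n :* e :+ e) refl (ι j) ε
    κ≥0 : 0ℚ ≤ κ
    κ≥0 = positive-constant {κ}
    0≤z : 0ℚ ≤ z
    0≤z = 0≤ι j ⊗ 0≤ε
    0≤z′ : 0ℚ ≤ z + ε
    0≤z′ = 0≤z ⊕ 0≤ε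
    z≤ : 0ℚ ≤ e₀ - z
    z≤ = ≤⇒0≤- (ιε≤e₀ (ℕ.<⇒≤ j<T))
    z′≤ : 0ℚ ≤ e₀ - (z + ε)
    z′≤ = subst (λ q → 0ℚ ≤ e₀ - q) z′≡ (≤⇒0≤- (ιε≤e₀ j<T))
    e₀²-zz : 0ℚ ≤ e₀ * e₀ - z * z
    e₀²-zz = subst (0ℚ ≤_) (solve 2 (λ e0 z → (e0 :- z) :* (e0 :+ z) := e0 :* e0 :- z :* z) refl e₀ z) (z≤ ⊗ (0≤e₀ ⊕ 0≤z))
    e₀²-z′z′ : 0ℚ ≤ e₀ * e₀ - (z + ε) * (z + ε)
    e₀²-z′z′ = subst (0ℚ ≤_) (solve 2 (λ e0 z → (e0 :- z) :* (e0 :+ z) := e0 :* e0 :- z :* z) refl e₀ (z + ε))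
        (z′≤ ⊗ (0≤e₀ ⊕ 0≤z′))
    e₀²-zz′ : 0ℚ ≤ e₀ * e₀ - z * (z + ε)
    e₀²-zz′ = subst (0ℚ ≤_) (solve 3 (λ e0 z w → e0 :* (e0 :- z) :+ z :* (e0 :- w) := e0 :* e0 :- z :* w) refl e₀ z (z + ε))
      (0≤e₀ ⊗ z≤ ⊕ 0≤z ⊗ z′≤)
    e₀²-zε : 0ℚ ≤ e₀ * e₀ - z * ε
    e₀²-zε = subst (0ℚ ≤_) (solve 3 (λ e0 z e → e0 :* e0 :- z :* (z :+ e) :+ z :* z := e0 :* e0 :- z :* e) refl e₀ z ε)
        (e₀²-zz′ ⊕ 0≤square z)
    0≤D′ : 0ℚ ≤ 1ℚ - κ * (e₀ * e₀) + κ * (e₀ * e₀ - (z + ε) * (z + ε))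
    0≤D′ = subst (0ℚ ≤_) (solve 1 (λ e0 → con 1ℚ :- con (ℤ.+ 67 / 200) :* (e0 :* e0) :- con (ℤ.+ 9 / 10)
        :+ con (ℤ.+ 9 / 10) := con 1ℚ :- con (ℤ.+ 67 / 200) :* (e0 :* e0)) refl e₀) (e₀-small″
        ⊕ positive-constant {ℤ.+ 9 / 10}) ⊕ κ≥0 ⊗ e₀²-z′z′
    0<D : 0ℚ < D
    0<D = ℚ.<-≤-trans (toWitness {a? = 0ℚ <? (ℤ.+ 9 / 10)} _)
      (≤-by (e₀-small″ ⊕ κ≥0 ⊗ e₀²-zz)
        (solve 2 (λ e0 z → con 1ℚ :- con (ℤ.+ 67 / 200) :* (z :* z) :- con (ℤ.+ 9 / 10)
            := con 1ℚ :- con (ℤ.+ 67 / 200) :* (e0 :* e0) :- con (ℤ.+ 9 / 10) :+ con (ℤ.+ 67 / 200) :* (e0 :* e0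
            :- z :* z)) refl e₀ z))

  -- A Riemann sum for the integral x³ / 3 of x², with step ε. Sampling by the product of the two
  -- endpoints gives it a closed form.
  a : ℕ → ℚ
  a zero    = 0ℚ
  a (suc j) = a j + ε * (ι j * ε * (ι (suc j) * ε))

  0≤a : ∀ j → 0ℚ ≤ a j
  0≤a zero    = ≤-refl
  0≤a (suc j) = 0≤a j ⊕ 0≤ε ⊗ ((0≤ι j ⊗ 0≤ε) ⊗ (0≤ι (suc j) ⊗ 0≤ε))

  a-closed : ∀ j → a j ≡ (ℤ.+ 1 / 3) * (ι j * ε * (ι j * ε) * (ι j * ε) - ι j * ε * (ε * ε))
  a-closed zero    = solve 1 (λ e → con 0ℚ := con (ℤ.+ 1 / 3) :* (con 0ℚ :* e :* (con 0ℚ :* e) :* (con 0ℚ :* e)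
      :- con 0ℚ :* e :* (e :* e))) refl ε
  a-closed (suc j) = trans (cong (_+ ε * (ι j * ε * (ι (suc j) * ε))) (a-closed j))
    (solve 2 (λ n e → con (ℤ.+ 1 / 3) :* (n :* e :* (n :* e) :* (n :* e) :- n :* e :* (e :* e))
        :+ e :* (n :* e :* ((con 1ℚ :+ n) :* e))
        := con (ℤ.+ 1 / 3) :* ((con 1ℚ :+ n) :* e :* ((con 1ℚ :+ n) :* e) :* ((con 1ℚ :+ n) :* e) :- (con 1ℚ :+ n) :* e
        :* (e :* e))) refl (ι j) ε)

  -- tan x ≥ x + x³ / 3, up to a discretisation error.
  above : ∀ j → j ℕ.≤ T → (ι j * ε + a j) * X j ≤ Y j
  above zero    _    = ≤-reflexive (solve 1 (λ e → (con 0ℚ :* e :+ con 0ℚ) :* con 1ℚ := con 0ℚ) refl ε)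
  above (suc j) j<T = ≤-by
    ((0≤1 ⊕ 0≤ε ⊗ ((0≤z ⊕ 0≤ε) ⊕ 0≤a (suc j))) ⊗ ≤⇒0≤- (above j (ℕ.<⇒≤ j<T))
      ⊕ (0≤X (below j (ℕ.<⇒≤ j<T)) ⊗ 0≤ε) ⊗ (0≤a j ⊗ ((0≤z ⊕ 0≤ε) ⊕ 0≤a (suc j)) ⊕ 0≤z ⊗ 0≤a (suc j)))
    (solve 5 (λ n e a x y → y :+ e :* x :- ((con 1ℚ :+ n) :* e :+ (a :+ e :* (n :* e :* ((con 1ℚ :+ n) :* e)))) :* (x
        :- e :* y) := (con 1ℚ :+ e :* (n :* e :+ e :+ (a :+ e :* (n :* e :* ((con 1ℚ :+ n) :* e))))) :* (y
        :- (n :* e :+ a) :* x) :+ x :* e :* (a :* (n :* e :+ e :+ (a :+ e :* (n :* e :* ((con 1ℚ :+ n) :* e))))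
        :+ n :* e :* (a :+ e :* (n :* e :* ((con 1ℚ :+ n) :* e))))) refl
       (ι j) ε (a j) (X j) (Y j))
    where
    0≤z : 0ℚ ≤ ι j * ε
    0≤z = 0≤ι j ⊗ 0≤ε

  -- Fractions just below tan (π / 16) and tan (π / 8), with 2 x₀ / (1 - x₀²) ≤ τ and 2 τ / (1 - τ²)
  -- ≤ 1. The deficit of `e₀` leaves room for them.
  x₀ τ : ℚ
  x₀ = (ℤ.+ 73 / 367)
  τ  = (ℤ.+ 239 / 577)

  slope-XY : ∀ {j} → j ℕ.≤ T → Y j ≤ x₀ * X j
  slope-XY {j} j≤T = ℚ.*-cancelˡ-≤-pos (1ℚ - κ * (e₀ * e₀)) {{positive 0<D}} (≤-by
    (0≤X b ⊗ e₀-tan ⊕ 0≤X b ⊗ z≤ ⊕ ≤⇒0≤- (tan≤ b) ⊕ (positive-constant {κ} ⊗ (z≤ ⊗ (0≤e₀ ⊕ 0≤ι j ⊗ 0≤ε))) ⊗ 0≤Y b)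
    (solve 5 (λ e0 z x y t → (con 1ℚ :- con (ℤ.+ 67 / 200) :* (e0 :* e0)) :* (t :* x) :- (con 1ℚ :- con (ℤ.+ 67 / 200)
        :* (e0 :* e0)) :* y := x :* ((con 1ℚ :- con (ℤ.+ 67 / 200) :* (e0 :* e0)) :* t :- e0) :+ x :* (e0 :- z)
        :+ (z :* x :- (con 1ℚ :- con (ℤ.+ 67 / 200) :* (z :* z)) :* y) :+ con (ℤ.+ 67 / 200) :* ((e0 :- z) :* (e0 :+ z))
        :* y) refl e₀ (ι j * ε) (X j) (Y j) x₀))
    where
    b = below j j≤T
    z≤ : 0ℚ ≤ e₀ - ι j * ε
    z≤ = ≤⇒0≤- (ιε≤e₀ j≤T)
    0<D : 0ℚ < 1ℚ - κ * (e₀ * e₀)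
    0<D = ℚ.<-≤-trans (toWitness {a? = 0ℚ <? (ℤ.+ 9 / 10)} _) (≤-by e₀-small″ refl)

  cone-u : ∀ {j} → j ℕ.≤ T → Cone u τ j
  cone-u {j} j≤T = record
    { 0≤re  = subst (0ℚ ≤_) (sym (re-u j)) (0≤vʲ j ⊗ subst (0ℚ ≤_)
        (solve 3 (λ x y t → (t :* x :- y) :* (t :* x :+ y) :+ (con 1ℚ :- t :* t) :* (x :* x)
            := x :* x :- y :* y) refl (X j) (Y j) x₀)
        (g ⊗ h ⊕ positive-constant {1ℚ - x₀ * x₀} ⊗ 0≤square (X j)))
    ; 0≤im  = subst (0ℚ ≤_) (sym (im-u j)) (0≤vʲ j ⊗ (0≤ι 2 ⊗ (0≤X b ⊗ 0≤Y b)))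
    ; slope = ≤-by (0≤vʲ j ⊗ (g ⊗ (0≤ι 2 ⊗ 0≤X b ⊕ positive-constant {τ} ⊗ h)
                               ⊕ positive-constant {τ - τ * (x₀ * x₀) - (ℤ.+ 2 / 1) * x₀} ⊗ 0≤square (X j)))
        (trans (cong₂ (λ p q → τ * p - q) (re-u j) (im-u j))
          (solve 5 (λ v x y t s → s :* (v :* (x :* x :- y :* y)) :- v :* (con (ℤ.+ 2 / 1) :* (x :* y))
              := v :* ((t :* x :- y) :* (con (ℤ.+ 2 / 1) :* x :+ s :* (t :* x :+ y)) :+ (s :- s :* (t :* t)
              :- con (ℤ.+ 2 / 1) :* t) :* (x :* x))) refl
             (vʲ j) (X j) (Y j) x₀ τ))
    }
    where
    b = below j j≤T
    g : 0ℚ ≤ x₀ * X j - Y j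
    g = ≤⇒0≤- (slope-XY j≤T)
    h : 0ℚ ≤ x₀ * X j + Y j
    h = positive-constant {x₀} ⊗ 0≤X b ⊕ 0≤Y b

  cone-u² : ∀ {j} → j ℕ.≤ T → Cone (u ²) 1ℚ j
  cone-u² j≤T = cone-² 1ℚ positive-constant (toWitness {a? = τ ≤? 1ℚ} _) 0≤1
    (toWitness {a? = (ℤ.+ 2 / 1) * τ ≤? 1ℚ * (1ℚ - τ * τ)} _) (cone-u j≤T)

  -- The angle of one step is 32 arctan ε, so that `T` steps make slightly less than 32 e₀ < 2π.
  -- Reaching it by four squarings of `u` confines the tangent estimates to angles below π / 8.
  χ : Character
  χ = u ² ² ² ²

  private
    u⁴ = u ² ²
    u⁸ = u ² ² ²

  0≤re-u⁴ : ∀ {j} → j ℕ.≤ T → 0ℚ ≤ re u⁴ j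
  0≤re-u⁴ {j} j≤T = subst (0ℚ ≤_) (trans (solve 2 (λ a b → (con 1ℚ :* a :- b) :* (a :+ b)
      := a :* a :- b :* b) refl (re (u ²) j) (im (u ²) j))
    (sym (re-+ (u ²) j j))) (≤⇒0≤- (slope c) ⊗ (0≤re c ⊕ 0≤im c))
    where c = cone-u² j≤T

  0≤im-u⁴ : ∀ {j} → j ℕ.≤ T → 0ℚ ≤ im u⁴ j
  0≤im-u⁴ {j} j≤T = subst (0ℚ ≤_) (sym (im-2* (u ²) j)) (0≤ι 2 ⊗ (0≤re c ⊗ 0≤im c))
    where c = cone-u² j≤T

  0≤im-u⁸ : ∀ {j} → j ℕ.≤ T → 0ℚ ≤ im u⁸ j
  0≤im-u⁸ {j} j≤T = subst (0ℚ ≤_) (sym (im-2* u⁴ j)) (0≤ι 2 ⊗ (0≤re-u⁴ j≤T ⊗ 0≤im-u⁴ j≤T))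

  -- By definition the value of `χ` at k is that of `u⁸` at 2 k ≤ T, where the angle is below π.
  0≤im-χ : ∀ {k} → k ℕ.+ k ℕ.≤ T → 0ℚ ≤ im χ k
  0≤im-χ = 0≤im-u⁸

  0≤re-χ : ∀ {k} → k ℕ.+ k ℕ.+ (k ℕ.+ k) ℕ.≤ T → 0ℚ ≤ re χ k
  0≤re-χ = 0≤re-u⁴

  private
    1≤T : 1 ℕ.≤ T
    1≤T = ℕ.≤-trans (s≤s z≤n) 500≤T

  1-v : 1ℚ - v ≡ ε * ε * v
  1-v = trans (cong (_- v) (sym nv≡1)) (solve 2 (λ e v → (con 1ℚ :+ e :* e) :* v :- v := e :* e :* v) refl ε v)

  v≤1 : v ≤ 1ℚ
  v≤1 = ≤-by (0≤square ε ⊗ 0≤v) 1-v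

  double-im : ∀ ψ k → 0ℚ ≤ im ψ k → im (ψ ²) k ≤ (ℤ.+ 2 / 1) * im ψ k
  double-im ψ k 0≤i = ≤-by (0≤ι 2 ⊗ (≤⇒0≤- (re≤1 ψ k) ⊗ 0≤i))
    (trans (cong (λ q → (ℤ.+ 2 / 1) * im ψ k - q) (im-2* ψ k)) (solve 2 (λ a b → con (ℤ.+ 2 / 1) :* b :- con (ℤ.+ 2 / 1)
        :* (a :* b) := con (ℤ.+ 2 / 1) :* ((con 1ℚ :- a) :* b)) refl (re ψ k) (im ψ k)))

  -- The inequality sin 2φ ≤ 2 sin φ, used four times on the way from `u` to `χ`, and im u 1 = 2 ε v
  -- ≤ 2 ε give im χ 1 ≤ 32 ε. The constant lies between 32 e₀ and 2π.
  im-χ-1 : ιT * im χ 1 ≤ (ℤ.+ 6283 / 1000)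
  im-χ-1 = ≤-trans (≤-by (0<T′ ⊗ (≤⇒0≤- (double-im u⁸ 1 (0≤im-u⁸ 1≤T)) ⊕ 0≤ι 2 ⊗ ≤⇒0≤- (double-im u⁴ 1 (0≤im-u⁴ 1≤T))
      ⊕ 0≤ι 4 ⊗ ≤⇒0≤- (double-im (u ²) 1 (0≤im (cone-u² 1≤T))) ⊕ 0≤ι 8 ⊗ ≤⇒0≤- (double-im u 1 (0≤im (cone-u 1≤T)))
      ⊕ (0≤ι 32 ⊗ 0≤ε) ⊗ ≤⇒0≤- v≤1))
      (trans (cong (λ q → (ℤ.+ 32 / 1) * q - ιT * im χ 1) (sym Tε≡e₀))
      (solve 7 (λ t e v a b c d → con (ℤ.+ 32 / 1) :* (t :* e) :- t :* d
          := t :* (con (ℤ.+ 2 / 1) :* c :- d :+ con (ℤ.+ 2 / 1) :* (con (ℤ.+ 2 / 1) :* b :- c) :+ con (ℤ.+ 4 / 1)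
          :* (con (ℤ.+ 2 / 1) :* a :- b) :+ con (ℤ.+ 8 / 1) :* (con (ℤ.+ 2 / 1) :* (con (ℤ.+ 2 / 1) :* e :* v :* con 1ℚ
          :+ (con 1ℚ :- e :* e) :* v :* con 0ℚ) :- a) :+ con (ℤ.+ 32 / 1) :* e :* (con 1ℚ :- v))) refl
         ιT ε v (im (u ²) 1) (im u⁴ 1) (im u⁸ 1) (im χ 1)))) 32e₀≤
    where
    0<T′ = ℚ.<⇒≤ 0<T

  ε²-small : ε * ε ≤ (ℤ.+ 1 / 6250000)
  ε²-small = ≤-by (((positive-constant {ℤ.+ 1 / 2500} ⊗ g) ⊕ g ⊗ 0≤ε))
    (solve 1 (λ e → con (ℤ.+ 1 / 6250000) :- e :* e := con (ℤ.+ 1 / 2500) :* (con (ℤ.+ 1 / 2500) :- e)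
        :+ (con (ℤ.+ 1 / 2500) :- e) :* e) refl ε)
    where
    g : 0ℚ ≤ (ℤ.+ 1 / 2500) - ε
    g = subst (0ℚ ≤_) (solve 2 (λ e0 e → con (ℤ.+ 1 / 500) :* (e0 :- con (ℤ.+ 500 / 1) :* e) :+ con (ℤ.+ 1 / 500)
        :* (con (ℤ.+ 1 / 5) :- e0) := con (ℤ.+ 1 / 2500) :- e) refl e₀ ε)
      (positive-constant {ℤ.+ 1 / 500} ⊗ ≤⇒0≤- (≤-trans
         (ℚ.*-monoʳ-≤-nonNeg ε {{nonNegative 0≤ε}} (≤-trans (≤-reflexive (sym (ι-* 20 25))) (ι-mono-≤ 500≤T)))
         (≤-reflexive Tε≡e₀))
       ⊕ positive-constant {ℤ.+ 1 / 500} ⊗ ≤⇒0≤- e₀≤1/5)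

  private
    versine : Character → ℚ
    versine ψ = 1ℚ - re ψ 1

    versine-² : ∀ ψ → versine (ψ ²) ≡ (ℤ.+ 4 / 1) * versine ψ - (ℤ.+ 2 / 1) * (versine ψ * versine ψ)
    versine-² ψ = trans (cong (λ o → 1ℚ - o) (re-2* ψ 1))
      (solve 1 (λ a → con 1ℚ :- (con (ℤ.+ 2 / 1) :* (a :* a) :- con 1ℚ)
          := con (ℤ.+ 4 / 1) :* (con 1ℚ :- a) :- con (ℤ.+ 2 / 1) :* ((con 1ℚ :- a) :* (con 1ℚ :- a))) refl (re ψ 1))

    versine-²-≤ : ∀ ψ → versine (ψ ²) ≤ (ℤ.+ 4 / 1) * versine ψ
    versine-²-≤ ψ = ≤-by (0≤ι 2 ⊗ 0≤square (versine ψ)) (trans (cong (λ q → (ℤ.+ 4 / 1) * versine ψ - q) (versine-² ψ))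
      (solve 1 (λ d → con (ℤ.+ 4 / 1) :* d :- (con (ℤ.+ 4 / 1) :* d :- con (ℤ.+ 2 / 1) :* (d :* d))
          := con (ℤ.+ 2 / 1) :* (d :* d)) refl (versine ψ)))

    versine-²-≥ : ∀ ψ → versine ψ ≤ (ℤ.+ 1 / 1000) → (ℤ.+ 1999 / 500) * versine ψ ≤ versine (ψ ²)
    versine-²-≥ ψ le = ≤-by (0≤ι 2 ⊗ (≤⇒0≤- (re≤1 ψ 1) ⊗ ≤⇒0≤- le))
        (trans (cong (λ q → q - (ℤ.+ 1999 / 500) * versine ψ) (versine-² ψ))
      (solve 1 (λ d → con (ℤ.+ 4 / 1) :* d :- con (ℤ.+ 2 / 1) :* (d :* d) :- con (ℤ.+ 1999 / 500) :* d
          := con (ℤ.+ 2 / 1) :* (d :* (con (ℤ.+ 1 / 1000) :- d))) refl (versine ψ)))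

    versine-u : versine u ≡ (ℤ.+ 2 / 1) * (ε * ε) * v
    versine-u = trans (cong (λ o → o - re u 1) (sym nv≡1))
      (solve 2 (λ e v → (con 1ℚ :+ e :* e) :* v :- ((con 1ℚ :- e :* e) :* v :* con 1ℚ :- con (ℤ.+ 2 / 1) :* e :* v
          :* con 0ℚ) := con (ℤ.+ 2 / 1) :* (e :* e) :* v) refl ε v)

    ≤4 : ∀ {p q} a → q ≤ (ℤ.+ 4 / 1) * p → p ≤ a * (ε * ε) → q ≤ (ℤ.+ 4 / 1) * a * (ε * ε)
    ≤4 {p} {q} a q≤ p≤ = ≤-by (≤⇒0≤- q≤ ⊕ 0≤ι 4 ⊗ ≤⇒0≤- p≤)
      (solve 4 (λ a e p q → con (ℤ.+ 4 / 1) :* a :* e :- q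
          := con (ℤ.+ 4 / 1) :* p :- q :+ con (ℤ.+ 4 / 1) :* (a :* e :- p)) refl a (ε * ε) p q)

    u₁ : versine u ≤ (ℤ.+ 2 / 1) * (ε * ε)
    u₁ = ≤-by ((0≤ι 2 ⊗ 0≤square ε) ⊗ ≤⇒0≤- v≤1)
      (trans (cong (λ q → (ℤ.+ 2 / 1) * (ε * ε) - q) versine-u) (solve 2 (λ e v → con (ℤ.+ 2 / 1) :* e
          :- con (ℤ.+ 2 / 1) :* e :* v := con (ℤ.+ 2 / 1) :* e :* (con 1ℚ :- v)) refl (ε * ε) v))
    u₂ = ≤4 (ℤ.+ 2 / 1) (versine-²-≤ u) u₁
    u₄ = ≤4 ((ℤ.+ 4 / 1) * (ℤ.+ 2 / 1)) (versine-²-≤ (u ²)) u₂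
    u₈ = ≤4 ((ℤ.+ 4 / 1) * ((ℤ.+ 4 / 1) * (ℤ.+ 2 / 1))) (versine-²-≤ u⁴) u₄
    u₁₆ = ≤4 ((ℤ.+ 4 / 1) * ((ℤ.+ 4 / 1) * ((ℤ.+ 4 / 1) * (ℤ.+ 2 / 1)))) (versine-²-≤ u⁸) u₈

    tiny : ∀ a → {True (0ℚ ≤? a)} → {True (a * (ℤ.+ 1 / 6250000) ≤? (ℤ.+ 1 / 1000))} → a * (ε * ε) ≤ (ℤ.+ 1 / 1000)
    tiny a {a≥0} {a≤} = ≤-trans (ℚ.*-monoˡ-≤-nonNeg a {{nonNegative (toWitness a≥0)}} ε²-small) (toWitness a≤)

  χ-small : 1ℚ - re χ 1 ≤ (ℤ.+ 1 / 100)
  χ-small = ≤-trans (≤-trans u₁₆ (tiny (ℤ.+ 512 / 1))) (toWitness {a? = (ℤ.+ 1 / 1000) ≤? (ℤ.+ 1 / 100)} _)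

  private
    v≥ : 1ℚ - ε * ε ≤ v
    v≥ = ≤-by (0≤square ε ⊗ ≤⇒0≤- v≤1) (trans (solve 2 (λ e v → v :- (con 1ℚ :- e) := e :- (con 1ℚ :- v)) refl (ε * ε) v)
      (trans (cong (λ q → ε * ε - q) 1-v) (solve 2 (λ e v → e :- e :* v := e :* (con 1ℚ :- v)) refl (ε * ε) v)))

    -- For `u` the versine is 2 ε² v, and each of the four squarings multiplies it by nearly 4. The
    -- factor 1999/500 = 4 - 2/1000 accounts for the loss, and 2 (1999/500)⁴ still exceeds 510.
    510ε²≤ : (ℤ.+ 510 / 1) * (ε * ε) ≤ versine χ
    510ε²≤ = ≤-trans (≤-trans (≤-by
        ((q ⊗ q ⊗ q ⊗ q) ⊗ ((0≤ι 2 ⊗ 0≤square ε) ⊗ (≤⇒0≤- v≥ ⊕ ≤⇒0≤- ε²-small))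
          ⊕ positive-constant {(ℤ.+ 1999 / 500) * (ℤ.+ 1999 / 500) * (ℤ.+ 1999 / 500) * (ℤ.+ 1999 / 500) * ((ℤ.+ 2 / 1)
              * (1ℚ - (ℤ.+ 1 / 6250000))) - (ℤ.+ 510 / 1)} ⊗ 0≤square ε)
        (solve 2 (λ e v → con (ℤ.+ 1999 / 500) :* con (ℤ.+ 1999 / 500) :* con (ℤ.+ 1999 / 500) :* con (ℤ.+ 1999 / 500)
            :* (con (ℤ.+ 2 / 1) :* e :* v) :- con (ℤ.+ 510 / 1) :* e
            := con (ℤ.+ 1999 / 500) :* con (ℤ.+ 1999 / 500) :* con (ℤ.+ 1999 / 500) :* con (ℤ.+ 1999 / 500)
            :* (con (ℤ.+ 2 / 1) :* e :* (v :- (con 1ℚ :- e) :+ (con (ℤ.+ 1 / 6250000) :- e))) :+ (con (ℤ.+ 1999 / 500)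
            :* con (ℤ.+ 1999 / 500) :* con (ℤ.+ 1999 / 500) :* con (ℤ.+ 1999 / 500) :* (con (ℤ.+ 2 / 1) :* (con 1ℚ
            :- con (ℤ.+ 1 / 6250000))) :- con (ℤ.+ 510 / 1)) :* e) refl (ε * ε) v))
        (≤-reflexive (cong ((ℤ.+ 1999 / 500) * (ℤ.+ 1999 / 500) * (ℤ.+ 1999 / 500) * (ℤ.+ 1999 / 500) *_) (sym versine-u))))
      (≤-by
        (≤⇒0≤- (versine-²-≥ u⁸ (≤-trans u₈ (tiny (ℤ.+ 128 / 1))))
          ⊕ q ⊗ ≤⇒0≤- (versine-²-≥ u⁴ (≤-trans u₄ (tiny (ℤ.+ 32 / 1))))
          ⊕ (q ⊗ q) ⊗ ≤⇒0≤- (versine-²-≥ (u ²) (≤-trans u₂ (tiny (ℤ.+ 8 / 1))))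
          ⊕ (q ⊗ q ⊗ q) ⊗ ≤⇒0≤- (versine-²-≥ u (≤-trans u₁ (tiny (ℤ.+ 2 / 1)))))
        (solve 6 (λ q a b c d e → e :- q :* q :* q :* q :* a
            := e :- q :* d :+ q :* (d :- q :* c) :+ q :* q :* (c :- q :* b) :+ q :* q :* q :* (b :- q :* a)) refl
           (ℤ.+ 1999 / 500) (versine u) (versine (u ²)) (versine u⁴) (versine u⁸) (versine χ)))
      where
      q : 0ℚ ≤ (ℤ.+ 1999 / 500)
      q = positive-constant

    -- Lower bounds for the tangents of T arctan ε and of its double; one more doubling leads to
    -- `σ₀`.
    l τ₀ : ℚ
    l  = (ℤ.+ 174 / 875)
    τ₀ = (ℤ.+ 147 / 355)

    tan-T : τ₀ * re u T ≤ im u T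
    tan-T = ≤-by (0≤vʲ T ⊗ (g ⊗ (0≤ι 2 ⊗ 0≤X b ⊕ positive-constant {τ₀} ⊗ (0≤Y b ⊕ positive-constant {l} ⊗ 0≤X b))
                             ⊕ positive-constant {(ℤ.+ 2 / 1) * l - τ₀ + τ₀ * (l * l)} ⊗ 0≤square (X T)))
      (trans (cong₂ (λ p q → q - τ₀ * p) (re-u T) (im-u T))
        (solve 5 (λ v x y l t → v :* (con (ℤ.+ 2 / 1) :* (x :* y)) :- t :* (v :* (x :* x :- y :* y))
            := v :* ((y :- l :* x) :* (con (ℤ.+ 2 / 1) :* x :+ t :* (y :+ l :* x)) :+ (con (ℤ.+ 2 / 1) :* l :- t
            :+ t :* (l :* l)) :* (x :* x))) refl (vʲ T) (X T) (Y T) l τ₀))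
      where
      b = below T ℕ.≤-refl
      l≤ : 0ℚ ≤ ι T * ε + a T - l
      l≤ = subst (0ℚ ≤_) (sym (trans (cong (λ q → ι T * ε + q - l) (a-closed T))
             (trans (cong (λ z → z + (ℤ.+ 1 / 3) * (z * z * z - z * (ε * ε)) - l) Tε≡e₀)
               (solve 2 (λ z e → z :+ con (ℤ.+ 1 / 3) :* (z :* z :* z :- z :* e) :- con (ℤ.+ 174 / 875)
                   := z :+ con (ℤ.+ 1 / 3) :* (z :* z :* z) :- con (ℤ.+ 1 / 3) :* z :* con (ℤ.+ 1 / 6250000)
                   :- con (ℤ.+ 174 / 875) :+ con (ℤ.+ 1 / 3) :* z :* (con (ℤ.+ 1 / 6250000) :- e)) refl e₀ (ε * ε)))))
             (e₀-cubic ⊕ (positive-constant {ℤ.+ 1 / 3} ⊗ 0≤e₀) ⊗ ≤⇒0≤- ε²-small)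
      g : 0ℚ ≤ Y T - l * X T
      g = subst (0ℚ ≤_) (solve 4 (λ x y l q → y :- q :* x :+ (q :- l) :* x := y :- l :* x) refl (X T) (Y T) l (ι T * ε + a T))
        (≤⇒0≤- (above T ℕ.≤-refl) ⊕ l≤ ⊗ 0≤X b)

    tan-2T : σ₀ * re (u ²) T ≤ im (u ²) T
    tan-2T = ≤-by (≤⇒0≤- tan-T ⊗ (0≤ι 2 ⊗ 0≤re c ⊕ 0≤σ₀ ⊗ (0≤im c ⊕ positive-constant {τ₀} ⊗ 0≤re c))
        ⊕ σ₀-fact ⊗ 0≤square (re u T))
      (trans (cong₂ (λ p q → q - σ₀ * p) (re-+ u T T) (im-2* u T))
        (solve 4 (λ a b s t → con (ℤ.+ 2 / 1) :* (a :* b) :- s :* (a :* a :- b :* b)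
            := (b :- t :* a) :* (con (ℤ.+ 2 / 1) :* a :+ s :* (b :+ t :* a)) :+ (con (ℤ.+ 2 / 1) :* t :- s
            :+ s :* (t :* t)) :* (a :* a)) refl (re u T) (im u T) σ₀ τ₀))
      where c = cone-u (ℕ.≤-refl {T})

    re-4T : re u⁴ T ≤ ω
    re-4T = ≤-by ((0≤1 ⊕ 0≤ω) ⊗ (≤⇒0≤- tan-2T ⊗ (0≤im c ⊕ 0≤σ₀ ⊗ 0≤re c)) ⊕ ω-fact ⊗ 0≤square (re (u ²) T))
      (trans (cong (λ p → ω - p) (re-+ (u ²) T T)) (trans (solve 2 (λ w q → w :- q := w :* con 1ℚ :- q) refl ω _)
        (trans (cong (λ o → ω * o - (re (u ²) T * re (u ²) T - im (u ²) T * im (u ²) T)) (sym (unit (u ²) T)))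
          (solve 4 (λ a b s w → w :* (a :* a :+ b :* b) :- (a :* a :- b :* b)
              := (con 1ℚ :+ w) :* ((b :- s :* a) :* (b :+ s :* a)) :+ ((con 1ℚ :+ w) :* (s :* s) :- (con 1ℚ :- w))
              :* (a :* a)) refl (re (u ²) T) (im (u ²) T) σ₀ ω))))
      where c = cone-u² (ℕ.≤-refl {T})

    -- 1 - cos 16θ = 2 sin² 8θ = 8 sin² 4θ cos² 4θ ≤ 8 cos² 4θ.
    re-16T : 1ℚ - re χ T ≤ (ℤ.+ 8 / 1) * (ω * ω)
    re-16T = ≤-by (0≤ι 8 ⊗ (≤⇒0≤- re-4T ⊗ (0≤ω ⊕ 0≤re-u⁴ ℕ.≤-refl)) ⊕ 0≤ι 8 ⊗ (0≤square r ⊗ 0≤square r))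
      (begin
        (ℤ.+ 8 / 1) * (ω * ω) - (1ℚ - re χ T)
          ≡⟨ cong₂ (λ o p → (ℤ.+ 8 / 1) * (ω * ω) - (o - p)) (sym (unit u⁸ T)) (re-+ u⁸ T T) ⟩
        (ℤ.+ 8 / 1) * (ω * ω) - (re u⁸ T * re u⁸ T + im u⁸ T * im u⁸ T - (re u⁸ T * re u⁸ T - im u⁸ T * im u⁸ T))
          ≡⟨ solve 3 (λ w a b → con (ℤ.+ 8 / 1) :* (w :* w) :- (a :* a :+ b :* b :- (a :* a :- b :* b))
              := con (ℤ.+ 8 / 1) :* (w :* w) :- con (ℤ.+ 2 / 1) :* (b :* b)) refl ω (re u⁸ T) (im u⁸ T) ⟩
        (ℤ.+ 8 / 1) * (ω * ω) - (ℤ.+ 2 / 1) * (im u⁸ T * im u⁸ T)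
          ≡⟨ cong (λ b → (ℤ.+ 8 / 1) * (ω * ω) - (ℤ.+ 2 / 1) * (b * b)) (im-2* u⁴ T) ⟩
        (ℤ.+ 8 / 1) * (ω * ω) - (ℤ.+ 2 / 1) * ((ℤ.+ 2 / 1) * (r * i) * ((ℤ.+ 2 / 1) * (r * i)))
          ≡⟨ solve 3 (λ w r i → con (ℤ.+ 8 / 1) :* (w :* w) :- con (ℤ.+ 2 / 1) :* (con (ℤ.+ 2 / 1) :* (r :* i)
              :* (con (ℤ.+ 2 / 1) :* (r :* i))) := con (ℤ.+ 8 / 1) :* ((w :- r) :* (w :+ r)) :+ con (ℤ.+ 8 / 1)
              :* (r :* r :* (con 1ℚ :- i :* i))) refl ω r i ⟩
        (ℤ.+ 8 / 1) * ((ω - r) * (ω + r)) + (ℤ.+ 8 / 1) * (r * r * (1ℚ - i * i))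
          ≡⟨ cong (λ o → (ℤ.+ 8 / 1) * ((ω - r) * (ω + r)) + (ℤ.+ 8 / 1) * (r * r * (o - i * i))) (sym (unit u⁴ T)) ⟩
        (ℤ.+ 8 / 1) * ((ω - r) * (ω + r)) + (ℤ.+ 8 / 1) * (r * r * (r * r + i * i - i * i))
          ≡⟨ solve 3 (λ w r i → con (ℤ.+ 8 / 1) :* ((w :- r) :* (w :+ r)) :+ con (ℤ.+ 8 / 1) :* (r :* r :* (r :* r
              :+ i :* i :- i :* i)) := con (ℤ.+ 8 / 1) :* ((w :- r) :* (w :+ r)) :+ con (ℤ.+ 8 / 1)
              :* (r :* r :* (r :* r))) refl ω r i ⟩
        (ℤ.+ 8 / 1) * ((ω - r) * (ω + r)) + (ℤ.+ 8 / 1) * (r * r * (r * r)) ∎)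
      where
      open ≡-Reasoning
      r = re u⁴ T
      i = im u⁴ T

  0<ε : 0ℚ < ε
  0<ε = ℚ.*-cancelˡ-<-nonNeg ιT {{nonNegative (ℚ.<⇒≤ 0<T)}}
    (subst₂ _<_ (sym (ℚ.*-zeroʳ ιT)) (sym Tε≡e₀) 0<e₀)

  -- The bound 8 ω² for the defect after `T` steps does not depend on `T`, whereas a single step
  -- shrinks like 1 / T. The quotient of the two chords, which is the geometric sum, is thus bounded
  -- by a multiple of `T`.
  error : ℚ
  error = (ℤ.+ 3 / 10000) * ιT

  χ-almostPeriodic : AlmostPeriodic T error χ
  χ-almostPeriodic = record
    { 0≤R   = positive-constant {ℤ.+ 3 / 10000} ⊗ ℚ.<⇒≤ 0<T
    ; moves = ℚ.<-≤-trans (ℚ.≤-<-trans (≤-reflexive (sym (ℚ.*-zeroʳ ((ℤ.+ 510 / 1) * ε))))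
        (subst ((ℤ.+ 510 / 1) * ε * 0ℚ <_) (ℚ.*-assoc (ℤ.+ 510 / 1) ε ε) (ℚ.*-monoʳ-<-pos
            ((ℤ.+ 510 / 1) * ε) {{ℚ.pos*pos⇒pos (ℤ.+ 510 / 1) ε {{positive 0<ε}}}} 0<ε))) 510ε²≤
    ; close = ≤-trans re-16T (≤-trans ω²≤ (≤-by ((0≤square error) ⊗ ≤⇒0≤- 510ε²≤)
        (trans (cong (λ z → error * error * (1ℚ - re χ 1) - (ℤ.+ 9 / 100000000) * (ℤ.+ 510 / 1) * (z * z)) (sym Tε≡e₀))
          (solve 3 (λ t e d → con (ℤ.+ 3 / 10000) :* t :* (con (ℤ.+ 3 / 10000) :* t) :* d :- con (ℤ.+ 9 / 100000000)
              :* con (ℤ.+ 510 / 1) :* (t :* e :* (t :* e))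
              := con (ℤ.+ 3 / 10000) :* t :* (con (ℤ.+ 3 / 10000) :* t) :* (d :- con (ℤ.+ 510 / 1) :* (e :* e))) refl ιT
              ε (1ℚ - re χ 1)))))
    }

-- The kernel is at least 1 on the upper half circle

-- The quotient of kernel - 1 by u = sin θ; the division is exact because the kernel equals 1 at u =
-- 0.
kernel-poly : ℚ → ℚ
kernel-poly u = (ℤ.+ 163 / 100) - (ℤ.+ 5977 / 1250) * u + (ℤ.+ 5183 / 625) * (u * u * u) - (ℤ.+ 5062 / 625) * (u * u * u * u * u)
                  + (ℤ.+ 1856 / 625) * (u * u * u * u * u * u * u)

kernel-im : ∀ χ k → kernel χ k - 1ℚ ≡ im χ k * kernel-poly (im χ k)
kernel-im χ k = begin
  kernel χ k - 1ℚ
    ≡⟨ cong₂ (λ p q → c₁ * u + c₂ * re (χ ²) k + c₄ * p + c₆ * q + c₈ * re (χ ² ² ²) k - 1ℚ) (re-2* (χ ²) k) (re-³ (χ ²) k) ⟩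
  c₁ * u + c₂ * re (χ ²) k + c₄ * T₂ (re (χ ²) k) + c₆ * T₃ (re (χ ²) k) + c₈ * re (χ ² ² ²) k - 1ℚ
    ≡⟨ cong (λ p → c₁ * u + c₂ * re (χ ²) k + c₄ * T₂ (re (χ ²) k) + c₆ * T₃ (re (χ ²) k) + c₈ * p - 1ℚ)
         (trans (re-2* (χ ² ²) k) (cong T₂ (re-2* (χ ²) k))) ⟩
  c₁ * u + c₂ * re (χ ²) k + c₄ * T₂ (re (χ ²) k) + c₆ * T₃ (re (χ ²) k) + c₈ * T₂ (T₂ (re (χ ²) k)) - 1ℚ
    ≡⟨ cong (λ p → c₁ * u + c₂ * p + c₄ * T₂ p + c₆ * T₃ p + c₈ * T₂ (T₂ p) - 1ℚ) re-² ⟩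
  c₁ * u + c₂ * p + c₄ * T₂ p + c₆ * T₃ p + c₈ * T₂ (T₂ p) - 1ℚ
    ≡⟨ solve 1 (λ u → con (ℤ.+ 163 / 100) :* u :+ con (ℤ.+ 7417 / 10000) :* (con 1ℚ :- con (ℤ.+ 2 / 1) :* (u :* u))
        :+ con (ℤ.+ 419 / 2500) :* (con (ℤ.+ 2 / 1) :* ((con 1ℚ :- con (ℤ.+ 2 / 1) :* (u :* u)) :* (con 1ℚ
        :- con (ℤ.+ 2 / 1) :* (u :* u))) :- con 1ℚ) :+ con (ℤ.+ 27 / 400) :* (con (ℤ.+ 4 / 1) :* ((con 1ℚ
        :- con (ℤ.+ 2 / 1) :* (u :* u)) :* (con 1ℚ :- con (ℤ.+ 2 / 1) :* (u :* u)) :* (con 1ℚ :- con (ℤ.+ 2 / 1)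
        :* (u :* u))) :- con (ℤ.+ 3 / 1) :* (con 1ℚ :- con (ℤ.+ 2 / 1) :* (u :* u))) :+ con (ℤ.+ 29 / 1250)
        :* (con (ℤ.+ 2 / 1) :* ((con (ℤ.+ 2 / 1) :* ((con 1ℚ :- con (ℤ.+ 2 / 1) :* (u :* u)) :* (con 1ℚ
        :- con (ℤ.+ 2 / 1) :* (u :* u))) :- con 1ℚ) :* (con (ℤ.+ 2 / 1) :* ((con 1ℚ :- con (ℤ.+ 2 / 1) :* (u :* u))
        :* (con 1ℚ :- con (ℤ.+ 2 / 1) :* (u :* u))) :- con 1ℚ)) :- con 1ℚ) :- con 1ℚ
        := u :* (con (ℤ.+ 163 / 100) :- con (ℤ.+ 5977 / 1250) :* u :+ con (ℤ.+ 5183 / 625) :* (u :* u :* u)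
        :- con (ℤ.+ 5062 / 625) :* (u :* u :* u :* u :* u) :+ con (ℤ.+ 1856 / 625) :* (u :* u :* u :* u :* u :* u :* u))) refl u ⟩
  u * kernel-poly u ∎
  where
  open ≡-Reasoning
  u p : ℚ
  u = im χ k
  p = 1ℚ - (ℤ.+ 2 / 1) * (u * u)
  T₂ T₃ : ℚ → ℚ
  T₂ c = (ℤ.+ 2 / 1) * (c * c) - 1ℚ
  T₃ c = (ℤ.+ 4 / 1) * (c * c * c) - (ℤ.+ 3 / 1) * c
  re-² : re (χ ²) k ≡ p
  re-² = trans (re-+ χ k k) (trans (solve 2 (λ a b → a :* a :- b :* b
      := a :* a :+ b :* b :- con (ℤ.+ 2 / 1) :* (b :* b)) refl (re χ k) u)
    (cong (λ o → o - (ℤ.+ 2 / 1) * (u * u)) (unit χ k)))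

-- The squared factors vanish near the two interior minima.
0≤kernel-poly : ∀ {u} → 0ℚ ≤ u → u ≤ 1ℚ → 0ℚ ≤ kernel-poly u
0≤kernel-poly {u} 0≤u u≤1 = ℚ.*-cancelˡ-≤-pos (ℤ.+ 61035156250000000000 / 1) (≤-by
  (0≤square (((ℤ.+ 500 / 1) * u - (ℤ.+ 313 / 1)) * ((ℤ.+ 250 / 1) * u - (ℤ.+ 239 / 1)))
      ⊗ (positive-constant {ℤ.+ 17716590192 / 1} ⊕ positive-constant {ℤ.+ 41573116000 / 1} ⊗ 0≤u
          ⊕ positive-constant {ℤ.+ 36702400000 / 1} ⊗ 0≤square u
         ⊕ positive-constant {ℤ.+ 11600000000 / 1} ⊗ (0≤square u ⊗ 0≤u))
    ⊕ positive-constant {ℤ.+ 17255410451806192 / 1} ⊕ positive-constant {ℤ.+ 326464807838532000 / 1} ⊗ ≤⇒0≤- u≤1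
    ⊕ 0≤square u ⊗ (positive-constant {ℤ.+ 235503410315400000 / 1} ⊕ positive-constant {ℤ.+ 224271619750000000 / 1} ⊗ ≤⇒0≤- u≤1))
  (solve 1 (λ u → con (ℤ.+ 61035156250000000000 / 1) :* (con (ℤ.+ 163 / 100) :- con (ℤ.+ 5977 / 1250) :* u
      :+ con (ℤ.+ 5183 / 625) :* (u :* u :* u) :- con (ℤ.+ 5062 / 625) :* (u :* u :* u :* u :* u)
      :+ con (ℤ.+ 1856 / 625) :* (u :* u :* u :* u :* u :* u :* u)) :- con (ℤ.+ 61035156250000000000 / 1) :* con 0ℚ
      := (con (ℤ.+ 500 / 1) :* u :- con (ℤ.+ 313 / 1)) :* (con (ℤ.+ 250 / 1) :* u :- con (ℤ.+ 239 / 1))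
      :* ((con (ℤ.+ 500 / 1) :* u :- con (ℤ.+ 313 / 1)) :* (con (ℤ.+ 250 / 1) :* u :- con (ℤ.+ 239 / 1)))
      :* (con (ℤ.+ 17716590192 / 1) :+ con (ℤ.+ 41573116000 / 1) :* u :+ con (ℤ.+ 36702400000 / 1) :* (u :* u)
      :+ con (ℤ.+ 11600000000 / 1) :* (u :* u :* u)) :+ con (ℤ.+ 17255410451806192 / 1)
      :+ con (ℤ.+ 326464807838532000 / 1) :* (con 1ℚ :- u) :+ u :* u :* (con (ℤ.+ 235503410315400000 / 1)
      :+ con (ℤ.+ 224271619750000000 / 1) :* (con 1ℚ :- u))) refl u))

-- The tangent at 23/50 bounds the cubic term from below.
kernel-poly-neg : ∀ {w} → 0ℚ ≤ w → w ≤ (ℤ.+ 23 / 50) → kernel-poly (- w) ≤ (ℤ.+ 16 / 5)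
kernel-poly-neg {w} 0≤w w≤ = ≤-by
  (positive-constant {ℤ.+ 1354693 / 125000000} ⊕ positive-constant {ℤ.+ 1513127 / 2500000} ⊗ ≤⇒0≤- w≤
    ⊕ positive-constant {ℤ.+ 6579 / 1000} ⊗ (0≤square (w - (ℤ.+ 23 / 50)) ⊗ (0≤w ⊕ positive-constant {ℤ.+ 23 / 25}))
    ⊕ positive-constant {ℤ.+ 29 / 3125000} ⊗ (0≤square w ⊗ 0≤w)
    ⊕ positive-constant {ℤ.+ 5062 / 625} ⊗ ((0≤square w ⊗ 0≤w) ⊗ (≤⇒0≤- w≤ ⊗ (positive-constant {ℤ.+ 23 / 50} ⊕ 0≤w)))
    ⊕ positive-constant {ℤ.+ 1856 / 625} ⊗ (0≤square (w * w * w) ⊗ 0≤w))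
  (solve 1 (λ w → con (ℤ.+ 16 / 5) :- (con (ℤ.+ 163 / 100) :- con (ℤ.+ 5977 / 1250) :* (:- w) :+ con (ℤ.+ 5183 / 625)
      :* ((:- w) :* (:- w) :* (:- w)) :- con (ℤ.+ 5062 / 625) :* ((:- w) :* (:- w) :* (:- w) :* (:- w) :* (:- w))
      :+ con (ℤ.+ 1856 / 625) :* ((:- w) :* (:- w) :* (:- w) :* (:- w) :* (:- w) :* (:- w) :* (:- w)))
      := con (ℤ.+ 1354693 / 125000000) :+ con (ℤ.+ 1513127 / 2500000) :* (con (ℤ.+ 23 / 50) :- w)
      :+ con (ℤ.+ 6579 / 1000) :* ((w :- con (ℤ.+ 23 / 50)) :* (w :- con (ℤ.+ 23 / 50)) :* (w :+ con (ℤ.+ 23 / 25)))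
      :+ con (ℤ.+ 29 / 3125000) :* (w :* w :* w) :+ con (ℤ.+ 5062 / 625) :* (w :* w :* w :* ((con (ℤ.+ 23 / 50) :- w)
      :* (con (ℤ.+ 23 / 50) :+ w))) :+ con (ℤ.+ 1856 / 625) :* (w :* w :* w :* (w :* w :* w) :* w)) refl w)

im≤1 : ∀ χ k → im χ k ≤ 1ℚ
im≤1 χ k = square-cancel-≤ 0≤1 (≤-by (0≤square (re χ k))
  (trans (cong (λ o → o - im χ k * im χ k) (sym (unit χ k)))
         (solve 2 (λ a b → a :* a :+ b :* b :- b :* b := a :* a) refl (re χ k) (im χ k))))

kernel≥1 : ∀ χ k → 0ℚ ≤ im χ k → 1ℚ ≤ kernel χ k
kernel≥1 χ k 0≤im = ≤-by (0≤im ⊗ 0≤kernel-poly 0≤im (im≤1 χ k)) (kernel-im χ k)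

-- Below the real axis the kernel drops at most linearly, with slope 16/5, as long as the sine stays
-- above -23/50. This prices the values slightly above T / 2 that are kept.
kernel≥ : ∀ χ k {w} → 0ℚ ≤ w → w ≤ (ℤ.+ 23 / 50) → - w ≤ im χ k → 1ℚ - (ℤ.+ 16 / 5) * w ≤ kernel χ k
kernel≥ χ k {w} 0≤w w≤ -w≤im = [ upper , lower ]′ (ℚ.≤-total 0ℚ (im χ k))
  where
  0≤16/5 : 0ℚ ≤ (ℤ.+ 16 / 5)
  0≤16/5 = positive-constant
  upper : 0ℚ ≤ im χ k → 1ℚ - (ℤ.+ 16 / 5) * w ≤ kernel χ k
  upper 0≤im = ≤-trans (≤-by (0≤16/5 ⊗ 0≤w) (solve 1 (λ w → con 1ℚ :- (con 1ℚ :- con (ℤ.+ 16 / 5) :* w)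
      := con (ℤ.+ 16 / 5) :* w) refl w)) (kernel≥1 χ k 0≤im)
  lower : im χ k ≤ 0ℚ → 1ℚ - (ℤ.+ 16 / 5) * w ≤ kernel χ k
  lower im≤0 = ≤-by (0≤x ⊗ ≤⇒0≤- (kernel-poly-neg 0≤x (≤-trans x≤w w≤)) ⊕ 0≤16/5 ⊗ ≤⇒0≤- x≤w)
    (begin
      kernel χ k - (1ℚ - (ℤ.+ 16 / 5) * w)                    ≡⟨ solve 2 (λ p w → p :- (con 1ℚ :- con (ℤ.+ 16 / 5) :* w)
          := p :- con 1ℚ :+ con (ℤ.+ 16 / 5) :* w) refl (kernel χ k) w ⟩
      kernel χ k - 1ℚ + (ℤ.+ 16 / 5) * w                      ≡⟨ cong (_+ (ℤ.+ 16 / 5) * w) (kernel-im χ k) ⟩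
      im χ k * kernel-poly (im χ k) + (ℤ.+ 16 / 5) * w        ≡⟨ cong (λ y → im χ k * kernel-poly y + (ℤ.+ 16 / 5) * w)
          (solve 1 (λ y → y := (:- (:- y))) refl (im χ k)) ⟩
      im χ k * kernel-poly (- x) + (ℤ.+ 16 / 5) * w           ≡⟨ solve 3 (λ y q w → y :* q :+ con (ℤ.+ 16 / 5) :* w
          := (:- y) :* (con (ℤ.+ 16 / 5) :- q) :+ con (ℤ.+ 16 / 5) :* (w :- (:- y))) refl
                                                            (im χ k) (kernel-poly (- x)) w ⟩
      x * ((ℤ.+ 16 / 5) - kernel-poly (- x)) + (ℤ.+ 16 / 5) * (w - x) ∎)
    where
    open ≡-Reasoning
    x = - im χ k
    0≤x : 0ℚ ≤ x
    0≤x = ℚ.neg-antimono-≤ im≤0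
    x≤w : x ≤ w
    x≤w = subst (x ≤_) (solve 1 (λ w → (:- (:- w)) := w) refl w) (ℚ.neg-antimono-≤ -w≤im)

-- The three numerical contradictions, in terms of z = m − 40

module Numerics {xs T} (500≤T : 500 ℕ.≤ T) (P : Packing xs T) {z : ℚ} (0≤z : 0ℚ ≤ z)
                (e≤ : Packing.e P ≤ (ℤ.+ 40 / 1) + z)
                (R≤ : Rotation.error T 500≤T ≤ (ℤ.+ 3 / 20000) * (((ℤ.+ 40 / 1) + z) * ((ℤ.+ 43 / 1) + z))) where
  open Rotation T 500≤T using (χ; error; χ-almostPeriodic; χ-small)
  open Packing P
  open Estimate P χ χ-almostPeriodic χ-small

  private
    0≤y : 0ℚ ≤ (ℤ.+ 40 / 1) + z
    0≤y = positive-constant {ℤ.+ 40 / 1} ⊕ 0≤z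
    -- The multiplier for `kernel-sum-bound`. At z = 0 it is 9, close to the minimiser of the
    -- resulting bound on the kernel sum.
    k : ℚ
    k = (ℤ.+ 9 / 40) * ((ℤ.+ 40 / 1) + z)
    0≤k : 0ℚ ≤ k
    0≤k = positive-constant {ℤ.+ 9 / 40} ⊗ 0≤y

  -- The case in which every vertex is kept: `w` is the loss due to the two largest values, and the
  -- hypothesis on it bounds 2 k w.
  all-spokes-impossible : ι (length xs) ≡ (ℤ.+ 41 / 1) + z → μ ≤ (ℤ.+ 80 / 1) + (ℤ.+ 2 / 1) * z → ∀ {w}
      → (ℤ.+ 9 / 20) * ((ℤ.+ 40 / 1) + z) * w ≤ (ℤ.+ 10521 / 250) → (ℤ.+ 41 / 1) + z - w ≤ ∑ (kernel χ) xs → ⊥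
  all-spokes-impossible M≡ μ≤ {w} w≤ lower = ℚ.<-irrefl refl (ℚ.<-≤-trans
      -- At z = 0 the lower bound for 2 k times the kernel sum exceeds the upper bound by twice this
      -- constant. One half of the gap is the positive number to be refuted; the other half stays in
      -- the certificate, whose coefficients of z and z² are positive, so that all m ≥ 40 are
      -- covered at once.
      (toWitness {a? = 0ℚ <? (ℤ.+ 144691411 / 90000000)} _) (≤-by
      ((positive-constant {ℤ.+ 144691411 / 90000000} ⊕ positive-constant {ℤ.+ 8357447911 / 900000000} ⊗ 0≤z
          ⊕ positive-constant {ℤ.+ 1630019379 / 8000000000} ⊗ 0≤square z) ⊕ ≤⇒0≤- (kernel-sum-bound 0≤γ₂ 0≤γ₄ γ₄-large
          γ₂-large 0≤k)
        ⊕ (0≤ι 2 ⊗ 0≤k) ⊗ ≤⇒0≤- lower ⊕ positive-constant {ℤ.+ 98 / 45} ⊗ ≤⇒0≤- μ≤ ⊕ positive-constant {ℤ.+ 29 / 10} ⊗ ≤⇒0≤- e≤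
        ⊕ positive-constant {ℤ.+ 19 / 5} ⊗ ≤⇒0≤- R≤ ⊕ ≤⇒0≤- w≤)
      (solve 6 (λ z m e r s w → con 0ℚ :- con (ℤ.+ 144691411 / 90000000)
          := con (ℤ.+ 144691411 / 90000000) :+ con (ℤ.+ 8357447911 / 900000000) :* z
          :+ con (ℤ.+ 1630019379 / 8000000000) :* (z :* z) :+ (con (ℤ.+ 1 / 2) :* (con (ℤ.+ 403 / 1000)
          :* (con (ℤ.+ 40 / 1) :+ z)) :+ con (ℤ.+ 9 / 20) :* (con (ℤ.+ 53 / 125) :* (con (ℤ.+ 40 / 1) :+ z))
          :+ con (ℤ.+ 98 / 45) :* m :+ con (ℤ.+ 29 / 10) :* e :+ con (ℤ.+ 19 / 5) :* r :+ con (ℤ.+ 9 / 40)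
          :* (con (ℤ.+ 40 / 1) :+ z) :* (con (ℤ.+ 9 / 40) :* (con (ℤ.+ 40 / 1) :+ z)) :* (con (ℤ.+ 163 / 100)
          :* con (ℤ.+ 163 / 100)) :+ con (ℤ.+ 5 / 9) :* ((con (ℤ.+ 2 / 1) :* (con (ℤ.+ 9 / 40) :* (con (ℤ.+ 40 / 1)
          :+ z)) :* con (ℤ.+ 7417 / 10000) :- con (ℤ.+ 1 / 2)) :* (con (ℤ.+ 2 / 1) :* (con (ℤ.+ 9 / 40)
          :* (con (ℤ.+ 40 / 1) :+ z)) :* con (ℤ.+ 7417 / 10000) :- con (ℤ.+ 1 / 2))) :+ con (ℤ.+ 2 / 1)
          :* (con (ℤ.+ 9 / 40) :* (con (ℤ.+ 40 / 1) :+ z)) :* (con (ℤ.+ 419 / 2500) :+ con (ℤ.+ 27 / 400)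
          :+ con (ℤ.+ 29 / 1250)) :* (con (ℤ.+ 53 / 125) :* (con (ℤ.+ 40 / 1) :+ z)) :- con (ℤ.+ 2 / 1)
          :* (con (ℤ.+ 9 / 40) :* (con (ℤ.+ 40 / 1) :+ z)) :* s) :+ con (ℤ.+ 2 / 1) :* (con (ℤ.+ 9 / 40)
          :* (con (ℤ.+ 40 / 1) :+ z)) :* (s :- (con (ℤ.+ 41 / 1) :+ z :- w)) :+ con (ℤ.+ 98 / 45) :* (con (ℤ.+ 80 / 1)
          :+ con (ℤ.+ 2 / 1) :* z :- m) :+ con (ℤ.+ 29 / 10) :* (con (ℤ.+ 40 / 1) :+ z :- e) :+ con (ℤ.+ 19 / 5)
          :* (con (ℤ.+ 3 / 20000) :* ((con (ℤ.+ 40 / 1) :+ z) :* (con (ℤ.+ 43 / 1) :+ z)) :- r)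
          :+ (con (ℤ.+ 10521 / 250) :- con (ℤ.+ 9 / 20) :* (con (ℤ.+ 40 / 1) :+ z) :* w)) refl z μ e error (∑ (kernel χ) xs) w)))
    where
    -- Majorants linear in m, fitted at z = 0, where the two conditions below hold with little
    -- slack.
    γ₂ = (ℤ.+ 403 / 1000) * ((ℤ.+ 40 / 1) + z)
    γ₄ = (ℤ.+ 53 / 125) * ((ℤ.+ 40 / 1) + z)
    0≤γ₂ : 0ℚ ≤ γ₂
    0≤γ₂ = positive-constant {ℤ.+ 403 / 1000} ⊗ 0≤y
    0≤γ₄ : 0ℚ ≤ γ₄
    0≤γ₄ = positive-constant {ℤ.+ 53 / 125} ⊗ 0≤y
    γ₄-large : ι (length xs) + (ℤ.+ 2 / 1) * ((ℤ.+ 8 / 1) * error + e + μ) ≤ γ₄ * γ₄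
    γ₄-large = ≤-by ((positive-constant {ℤ.+ 1571 / 625} ⊕ positive-constant {ℤ.+ 44893 / 6250} ⊗ 0≤z
        ⊕ positive-constant {ℤ.+ 5543 / 31250} ⊗ 0≤square z) ⊕ 0≤ι 2 ⊗ ≤⇒0≤- μ≤ ⊕ 0≤ι 2 ⊗ ≤⇒0≤- e≤ ⊕ 0≤ι 16 ⊗ ≤⇒0≤- R≤)
      (trans (cong (λ M → γ₄ * γ₄ - (M + (ℤ.+ 2 / 1) * ((ℤ.+ 8 / 1) * error + e + μ))) M≡)
        (solve 4 (λ z m e r → con (ℤ.+ 53 / 125) :* (con (ℤ.+ 40 / 1) :+ z) :* (con (ℤ.+ 53 / 125) :* (con (ℤ.+ 40 / 1)
            :+ z)) :- (con (ℤ.+ 41 / 1) :+ z :+ con (ℤ.+ 2 / 1) :* (con (ℤ.+ 8 / 1) :* r :+ e :+ m))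
            := con (ℤ.+ 1571 / 625) :+ con (ℤ.+ 44893 / 6250) :* z :+ con (ℤ.+ 5543 / 31250) :* (z :* z)
            :+ con (ℤ.+ 2 / 1) :* (con (ℤ.+ 80 / 1) :+ con (ℤ.+ 2 / 1) :* z :- m) :+ con (ℤ.+ 2 / 1)
            :* (con (ℤ.+ 40 / 1) :+ z :- e) :+ con (ℤ.+ 16 / 1) :* (con (ℤ.+ 3 / 20000) :* ((con (ℤ.+ 40 / 1) :+ z)
            :* (con (ℤ.+ 43 / 1) :+ z)) :- r)) refl z μ e error))
    γ₂-large : γ₄ + (ℤ.+ 2 / 1) * ((ℤ.+ 2 / 1) * error + e + μ) ≤ γ₂ * γ₂
    γ₂-large = ≤-by ((positive-constant {ℤ.+ 1164 / 625} ⊕ positive-constant {ℤ.+ 162973 / 25000} ⊗ 0≤z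
        ⊕ positive-constant {ℤ.+ 161809 / 1000000} ⊗ 0≤square z) ⊕ 0≤ι 2 ⊗ ≤⇒0≤- μ≤ ⊕ 0≤ι 2 ⊗ ≤⇒0≤- e≤ ⊕ 0≤ι 4 ⊗ ≤⇒0≤- R≤)
      (solve 4 (λ z m e r → con (ℤ.+ 403 / 1000) :* (con (ℤ.+ 40 / 1) :+ z) :* (con (ℤ.+ 403 / 1000)
          :* (con (ℤ.+ 40 / 1) :+ z)) :- (con (ℤ.+ 53 / 125) :* (con (ℤ.+ 40 / 1) :+ z) :+ con (ℤ.+ 2 / 1)
          :* (con (ℤ.+ 2 / 1) :* r :+ e :+ m)) := con (ℤ.+ 1164 / 625) :+ con (ℤ.+ 162973 / 25000) :* z
          :+ con (ℤ.+ 161809 / 1000000) :* (z :* z) :+ con (ℤ.+ 2 / 1) :* (con (ℤ.+ 80 / 1) :+ con (ℤ.+ 2 / 1) :* z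
          :- m) :+ con (ℤ.+ 2 / 1) :* (con (ℤ.+ 40 / 1) :+ z :- e) :+ con (ℤ.+ 4 / 1) :* (con (ℤ.+ 3 / 20000)
          :* ((con (ℤ.+ 40 / 1) :+ z) :* (con (ℤ.+ 43 / 1) :+ z)) :- r)) refl z μ e error)

  drop-two-impossible : ι (length xs) ≡ (ℤ.+ 39 / 1) + z → μ ≤ (ℤ.+ 82 / 1) + (ℤ.+ 4 / 1) * z
      → (ℤ.+ 39 / 1) + z ≤ ∑ (kernel χ) xs → ⊥
  drop-two-impossible M≡ μ≤ lower = ℚ.<-irrefl refl (ℚ.<-≤-trans (toWitness {a? = 0ℚ <? (ℤ.+ 53999297 / 30000000)} _) (≤-by
      ((positive-constant {ℤ.+ 53999297 / 30000000} ⊕ positive-constant {ℤ.+ 3572104391 / 900000000} ⊗ 0≤z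
          ⊕ positive-constant {ℤ.+ 1624440099 / 8000000000} ⊗ 0≤square z) ⊕ ≤⇒0≤- (kernel-sum-bound 0≤γ₂ 0≤γ₄ γ₄-large
          γ₂-large 0≤k)
        ⊕ (0≤ι 2 ⊗ 0≤k) ⊗ ≤⇒0≤- lower ⊕ positive-constant {ℤ.+ 98 / 45} ⊗ ≤⇒0≤- μ≤ ⊕ positive-constant {ℤ.+ 29 / 10} ⊗ ≤⇒0≤- e≤
        ⊕ positive-constant {ℤ.+ 19 / 5} ⊗ ≤⇒0≤- R≤)
      (solve 5 (λ z m e r s → con 0ℚ :- con (ℤ.+ 53999297 / 30000000)
          := con (ℤ.+ 53999297 / 30000000) :+ con (ℤ.+ 3572104391 / 900000000) :* z :+ con (ℤ.+ 1624440099 / 8000000000)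
          :* (z :* z) :+ (con (ℤ.+ 1 / 2) :* (con (ℤ.+ 409 / 1000) :* (con (ℤ.+ 40 / 1) :+ z)) :+ con (ℤ.+ 9 / 20)
          :* (con (ℤ.+ 43 / 100) :* (con (ℤ.+ 40 / 1) :+ z)) :+ con (ℤ.+ 98 / 45) :* m :+ con (ℤ.+ 29 / 10) :* e
          :+ con (ℤ.+ 19 / 5) :* r :+ con (ℤ.+ 9 / 40) :* (con (ℤ.+ 40 / 1) :+ z) :* (con (ℤ.+ 9 / 40)
          :* (con (ℤ.+ 40 / 1) :+ z)) :* (con (ℤ.+ 163 / 100) :* con (ℤ.+ 163 / 100)) :+ con (ℤ.+ 5 / 9)
          :* ((con (ℤ.+ 2 / 1) :* (con (ℤ.+ 9 / 40) :* (con (ℤ.+ 40 / 1) :+ z)) :* con (ℤ.+ 7417 / 10000)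
          :- con (ℤ.+ 1 / 2)) :* (con (ℤ.+ 2 / 1) :* (con (ℤ.+ 9 / 40) :* (con (ℤ.+ 40 / 1) :+ z))
          :* con (ℤ.+ 7417 / 10000) :- con (ℤ.+ 1 / 2))) :+ con (ℤ.+ 2 / 1) :* (con (ℤ.+ 9 / 40) :* (con (ℤ.+ 40 / 1)
          :+ z)) :* (con (ℤ.+ 419 / 2500) :+ con (ℤ.+ 27 / 400) :+ con (ℤ.+ 29 / 1250)) :* (con (ℤ.+ 43 / 100)
          :* (con (ℤ.+ 40 / 1) :+ z)) :- con (ℤ.+ 2 / 1) :* (con (ℤ.+ 9 / 40) :* (con (ℤ.+ 40 / 1) :+ z)) :* s)
          :+ con (ℤ.+ 2 / 1) :* (con (ℤ.+ 9 / 40) :* (con (ℤ.+ 40 / 1) :+ z)) :* (s :- (con (ℤ.+ 39 / 1) :+ z))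
          :+ con (ℤ.+ 98 / 45) :* (con (ℤ.+ 82 / 1) :+ con (ℤ.+ 4 / 1) :* z :- m) :+ con (ℤ.+ 29 / 10)
          :* (con (ℤ.+ 40 / 1) :+ z :- e) :+ con (ℤ.+ 19 / 5) :* (con (ℤ.+ 3 / 20000) :* ((con (ℤ.+ 40 / 1) :+ z)
          :* (con (ℤ.+ 43 / 1) :+ z)) :- r)) refl z μ e error (∑ (kernel χ) xs))))
    where
    γ₂ = (ℤ.+ 409 / 1000) * ((ℤ.+ 40 / 1) + z)
    γ₄ = (ℤ.+ 43 / 100) * ((ℤ.+ 40 / 1) + z)
    0≤γ₂ : 0ℚ ≤ γ₂
    0≤γ₂ = positive-constant {ℤ.+ 409 / 1000} ⊗ 0≤y
    0≤γ₄ : 0ℚ ≤ γ₄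
    0≤γ₄ = positive-constant {ℤ.+ 43 / 100} ⊗ 0≤y
    γ₄-large : ι (length xs) + (ℤ.+ 2 / 1) * ((ℤ.+ 8 / 1) * error + e + μ) ≤ γ₄ * γ₄
    γ₄-large = ≤-by ((positive-constant {ℤ.+ 1089 / 125} ⊕ positive-constant {ℤ.+ 4491 / 1250} ⊗ 0≤z
        ⊕ positive-constant {ℤ.+ 73 / 400} ⊗ 0≤square z) ⊕ 0≤ι 2 ⊗ ≤⇒0≤- μ≤ ⊕ 0≤ι 2 ⊗ ≤⇒0≤- e≤ ⊕ 0≤ι 16 ⊗ ≤⇒0≤- R≤)
      (trans (cong (λ M → γ₄ * γ₄ - (M + (ℤ.+ 2 / 1) * ((ℤ.+ 8 / 1) * error + e + μ))) M≡)
        (solve 4 (λ z m e r → con (ℤ.+ 43 / 100) :* (con (ℤ.+ 40 / 1) :+ z) :* (con (ℤ.+ 43 / 100) :* (con (ℤ.+ 40 / 1)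
            :+ z)) :- (con (ℤ.+ 39 / 1) :+ z :+ con (ℤ.+ 2 / 1) :* (con (ℤ.+ 8 / 1) :* r :+ e :+ m))
            := con (ℤ.+ 1089 / 125) :+ con (ℤ.+ 4491 / 1250) :* z :+ con (ℤ.+ 73 / 400) :* (z :* z) :+ con (ℤ.+ 2 / 1)
            :* (con (ℤ.+ 82 / 1) :+ con (ℤ.+ 4 / 1) :* z :- m) :+ con (ℤ.+ 2 / 1) :* (con (ℤ.+ 40 / 1) :+ z :- e)
            :+ con (ℤ.+ 16 / 1) :* (con (ℤ.+ 3 / 20000) :* ((con (ℤ.+ 40 / 1) :+ z) :* (con (ℤ.+ 43 / 1) :+ z)) :- r))
            refl z μ e error))
    γ₂-large : γ₄ + (ℤ.+ 2 / 1) * ((ℤ.+ 2 / 1) * error + e + μ) ≤ γ₂ * γ₂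
    γ₂-large = ≤-by ((positive-constant {ℤ.+ 3386 / 625} ⊕ positive-constant {ℤ.+ 72567 / 25000} ⊗ 0≤z
        ⊕ positive-constant {ℤ.+ 166681 / 1000000} ⊗ 0≤square z) ⊕ 0≤ι 2 ⊗ ≤⇒0≤- μ≤ ⊕ 0≤ι 2 ⊗ ≤⇒0≤- e≤ ⊕ 0≤ι 4 ⊗ ≤⇒0≤- R≤)
      (solve 4 (λ z m e r → con (ℤ.+ 409 / 1000) :* (con (ℤ.+ 40 / 1) :+ z) :* (con (ℤ.+ 409 / 1000)
          :* (con (ℤ.+ 40 / 1) :+ z)) :- (con (ℤ.+ 43 / 100) :* (con (ℤ.+ 40 / 1) :+ z) :+ con (ℤ.+ 2 / 1)
          :* (con (ℤ.+ 2 / 1) :* r :+ e :+ m)) := con (ℤ.+ 3386 / 625) :+ con (ℤ.+ 72567 / 25000) :* z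
          :+ con (ℤ.+ 166681 / 1000000) :* (z :* z) :+ con (ℤ.+ 2 / 1) :* (con (ℤ.+ 82 / 1) :+ con (ℤ.+ 4 / 1) :* z
          :- m) :+ con (ℤ.+ 2 / 1) :* (con (ℤ.+ 40 / 1) :+ z :- e) :+ con (ℤ.+ 4 / 1) :* (con (ℤ.+ 3 / 20000)
          :* ((con (ℤ.+ 40 / 1) :+ z) :* (con (ℤ.+ 43 / 1) :+ z)) :- r)) refl z μ e error)

  drop-three-impossible : ι (length xs) ≡ (ℤ.+ 38 / 1) + z → μ ≤ (ℤ.+ 73 / 1) + (ℤ.+ 5 / 1) * z
      → (ℤ.+ 38 / 1) + z ≤ ∑ (kernel χ) xs → ⊥
  drop-three-impossible M≡ μ≤ lower = ℚ.<-irrefl refl (ℚ.<-≤-trans (toWitness {a? = 0ℚ <? (ℤ.+ 94497497 / 30000000)} _) (≤-by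
      ((positive-constant {ℤ.+ 94497497 / 30000000} ⊕ positive-constant {ℤ.+ 1252773991 / 900000000} ⊗ 0≤z
          ⊕ positive-constant {ℤ.+ 1629089499 / 8000000000} ⊗ 0≤square z) ⊕ ≤⇒0≤- (kernel-sum-bound 0≤γ₂ 0≤γ₄ γ₄-large
          γ₂-large 0≤k)
        ⊕ (0≤ι 2 ⊗ 0≤k) ⊗ ≤⇒0≤- lower ⊕ positive-constant {ℤ.+ 98 / 45} ⊗ ≤⇒0≤- μ≤ ⊕ positive-constant {ℤ.+ 29 / 10} ⊗ ≤⇒0≤- e≤
        ⊕ positive-constant {ℤ.+ 19 / 5} ⊗ ≤⇒0≤- R≤)
      (solve 5 (λ z m e r s → con 0ℚ :- con (ℤ.+ 94497497 / 30000000)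
          := con (ℤ.+ 94497497 / 30000000) :+ con (ℤ.+ 1252773991 / 900000000) :* z :+ con (ℤ.+ 1629089499 / 8000000000)
          :* (z :* z) :+ (con (ℤ.+ 1 / 2) :* (con (ℤ.+ 81 / 200) :* (con (ℤ.+ 40 / 1) :+ z)) :+ con (ℤ.+ 9 / 20)
          :* (con (ℤ.+ 17 / 40) :* (con (ℤ.+ 40 / 1) :+ z)) :+ con (ℤ.+ 98 / 45) :* m :+ con (ℤ.+ 29 / 10) :* e
          :+ con (ℤ.+ 19 / 5) :* r :+ con (ℤ.+ 9 / 40) :* (con (ℤ.+ 40 / 1) :+ z) :* (con (ℤ.+ 9 / 40)
          :* (con (ℤ.+ 40 / 1) :+ z)) :* (con (ℤ.+ 163 / 100) :* con (ℤ.+ 163 / 100)) :+ con (ℤ.+ 5 / 9)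
          :* ((con (ℤ.+ 2 / 1) :* (con (ℤ.+ 9 / 40) :* (con (ℤ.+ 40 / 1) :+ z)) :* con (ℤ.+ 7417 / 10000)
          :- con (ℤ.+ 1 / 2)) :* (con (ℤ.+ 2 / 1) :* (con (ℤ.+ 9 / 40) :* (con (ℤ.+ 40 / 1) :+ z))
          :* con (ℤ.+ 7417 / 10000) :- con (ℤ.+ 1 / 2))) :+ con (ℤ.+ 2 / 1) :* (con (ℤ.+ 9 / 40) :* (con (ℤ.+ 40 / 1)
          :+ z)) :* (con (ℤ.+ 419 / 2500) :+ con (ℤ.+ 27 / 400) :+ con (ℤ.+ 29 / 1250)) :* (con (ℤ.+ 17 / 40)
          :* (con (ℤ.+ 40 / 1) :+ z)) :- con (ℤ.+ 2 / 1) :* (con (ℤ.+ 9 / 40) :* (con (ℤ.+ 40 / 1) :+ z)) :* s)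
          :+ con (ℤ.+ 2 / 1) :* (con (ℤ.+ 9 / 40) :* (con (ℤ.+ 40 / 1) :+ z)) :* (s :- (con (ℤ.+ 38 / 1) :+ z))
          :+ con (ℤ.+ 98 / 45) :* (con (ℤ.+ 73 / 1) :+ con (ℤ.+ 5 / 1) :* z :- m) :+ con (ℤ.+ 29 / 10)
          :* (con (ℤ.+ 40 / 1) :+ z :- e) :+ con (ℤ.+ 19 / 5) :* (con (ℤ.+ 3 / 20000) :* ((con (ℤ.+ 40 / 1) :+ z)
          :* (con (ℤ.+ 43 / 1) :+ z)) :- r)) refl z μ e error (∑ (kernel χ) xs))))
    where
    γ₂ = (ℤ.+ 81 / 200) * ((ℤ.+ 40 / 1) + z)
    γ₄ = (ℤ.+ 17 / 40) * ((ℤ.+ 40 / 1) + z)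
    0≤γ₂ : 0ℚ ≤ γ₂
    0≤γ₂ = positive-constant {ℤ.+ 81 / 200} ⊗ 0≤y
    0≤γ₄ : 0ℚ ≤ γ₄
    0≤γ₄ = positive-constant {ℤ.+ 17 / 40} ⊗ 0≤y
    γ₄-large : ι (length xs) + (ℤ.+ 2 / 1) * ((ℤ.+ 8 / 1) * error + e + μ) ≤ γ₄ * γ₄
    γ₄-large = ≤-by ((positive-constant {ℤ.+ 2609 / 125} ⊕ positive-constant {ℤ.+ 3127 / 2500} ⊗ 0≤z
        ⊕ positive-constant {ℤ.+ 7129 / 40000} ⊗ 0≤square z) ⊕ 0≤ι 2 ⊗ ≤⇒0≤- μ≤ ⊕ 0≤ι 2 ⊗ ≤⇒0≤- e≤ ⊕ 0≤ι 16 ⊗ ≤⇒0≤- R≤)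
      (trans (cong (λ M → γ₄ * γ₄ - (M + (ℤ.+ 2 / 1) * ((ℤ.+ 8 / 1) * error + e + μ))) M≡)
        (solve 4 (λ z m e r → con (ℤ.+ 17 / 40) :* (con (ℤ.+ 40 / 1) :+ z) :* (con (ℤ.+ 17 / 40) :* (con (ℤ.+ 40 / 1)
            :+ z)) :- (con (ℤ.+ 38 / 1) :+ z :+ con (ℤ.+ 2 / 1) :* (con (ℤ.+ 8 / 1) :* r :+ e :+ m))
            := con (ℤ.+ 2609 / 125) :+ con (ℤ.+ 3127 / 2500) :* z :+ con (ℤ.+ 7129 / 40000) :* (z :* z)
            :+ con (ℤ.+ 2 / 1) :* (con (ℤ.+ 73 / 1) :+ con (ℤ.+ 5 / 1) :* z :- m) :+ con (ℤ.+ 2 / 1)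
            :* (con (ℤ.+ 40 / 1) :+ z :- e) :+ con (ℤ.+ 16 / 1) :* (con (ℤ.+ 3 / 20000) :* ((con (ℤ.+ 40 / 1) :+ z)
            :* (con (ℤ.+ 43 / 1) :+ z)) :- r)) refl z μ e error))
    γ₂-large : γ₄ + (ℤ.+ 2 / 1) * ((ℤ.+ 2 / 1) * error + e + μ) ≤ γ₂ * γ₂
    γ₂-large = ≤-by ((positive-constant {ℤ.+ 2301 / 125} ⊕ positive-constant {ℤ.+ 809 / 1250} ⊗ 0≤z
        ⊕ positive-constant {ℤ.+ 6537 / 40000} ⊗ 0≤square z) ⊕ 0≤ι 2 ⊗ ≤⇒0≤- μ≤ ⊕ 0≤ι 2 ⊗ ≤⇒0≤- e≤ ⊕ 0≤ι 4 ⊗ ≤⇒0≤- R≤)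
      (solve 4 (λ z m e r → con (ℤ.+ 81 / 200) :* (con (ℤ.+ 40 / 1) :+ z) :* (con (ℤ.+ 81 / 200) :* (con (ℤ.+ 40 / 1)
          :+ z)) :- (con (ℤ.+ 17 / 40) :* (con (ℤ.+ 40 / 1) :+ z) :+ con (ℤ.+ 2 / 1) :* (con (ℤ.+ 2 / 1) :* r :+ e
          :+ m)) := con (ℤ.+ 2301 / 125) :+ con (ℤ.+ 809 / 1250) :* z :+ con (ℤ.+ 6537 / 40000) :* (z :* z)
          :+ con (ℤ.+ 2 / 1) :* (con (ℤ.+ 73 / 1) :+ con (ℤ.+ 5 / 1) :* z :- m) :+ con (ℤ.+ 2 / 1) :* (con (ℤ.+ 40 / 1)
          :+ z :- e) :+ con (ℤ.+ 4 / 1) :* (con (ℤ.+ 3 / 20000) :* ((con (ℤ.+ 40 / 1) :+ z) :* (con (ℤ.+ 43 / 1) :+ z))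
          :- r)) refl z μ e error)

-- Lists without repetitions

module _ {A : Set} where

  ∈-tail : ∀ {x y : A} {zs} → x ≢ y → y ∈ x ∷ zs → y ∈ zs
  ∈-tail x≢y (here y≡x)   = contradiction (sym y≡x) x≢y
  ∈-tail x≢y (there y∈zs) = y∈zs

  -- The complement, up to permutation. With `range T` for `ys` it becomes the list `missing` of a
  -- packing, and its length gives the pigeonhole principle.
  unique-⊆⇒↭ : ∀ {xs ys : List A} → Unique xs → (∀ {x} → x ∈ xs → x ∈ ys) →
               ∃[ zs ] ys ↭ xs ++ zs
  unique-⊆⇒↭ {[]}     {ys} _        _   = ys , Perm.refl
  unique-⊆⇒↭ {x ∷ xs} {ys} (x∉ ∷ u) sub
    with ws , vs , refl ← ∈-∃++ (sub (here refl))
    with zs , p ← unique-⊆⇒↭ u (λ y∈xs → ∈-tail (All.lookup x∉ y∈xs) (∈-resp-↭ (shift x ws vs) (sub (there y∈xs))))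
    = zs , Perm.trans (shift x ws vs) (Perm.prep x p)

  unique-⊆⇒length-≤ : ∀ {xs ys : List A} → Unique xs → (∀ {x} → x ∈ xs → x ∈ ys) → length xs ℕ.≤ length ys
  unique-⊆⇒length-≤ {xs} {ys} u sub with zs , p ← unique-⊆⇒↭ u sub =
    subst (length xs ℕ.≤_) (sym (trans (↭-length p) (length-++ xs))) (ℕ.m≤m+n _ _)

module _ {A B : Set} {f : A → B} where

  map-unique⇒injective : ∀ {xs x y} → Unique (map f xs) → x ∈ xs → y ∈ xs → f x ≡ f y → x ≡ y
  map-unique⇒injective _        (here refl) (here refl) _   = refl
  map-unique⇒injective (x∉ ∷ _) (here refl) (there y∈)  eq = contradiction eq (All.lookup x∉ (∈-map⁺ f y∈))
  map-unique⇒injective (x∉ ∷ _) (there x∈)  (here refl) eq = contradiction (sym eq) (All.lookup x∉ (∈-map⁺ f x∈))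
  map-unique⇒injective (_ ∷ u)  (there x∈)  (there y∈)  eq = map-unique⇒injective u x∈ y∈ eq

  injective⇒map-unique : ∀ {xs} → Unique xs → (∀ {x y} → x ∈ xs → y ∈ xs → f x ≡ f y → x ≡ y) → Unique (map f xs)
  injective⇒map-unique []       _   = []
  injective⇒map-unique (x∉ ∷ u) inj =
    All.tabulate (λ {b} b∈ fx≡b → let y , y∈ , b≡fy = ∈-map⁻ f b∈ in
      All.lookup x∉ y∈ (inj (here refl) (there y∈) (trans fx≡b b≡fy)))
    ∷ injective⇒map-unique u (λ x∈ y∈ → inj (there x∈) (there y∈))

pairs : {A : Set} → List A → List (A × A)
pairs []       = []
pairs (x ∷ xs) = map (x ,_) xs ++ pairs xs

triangle : ℕ → ℕ
triangle zero    = 0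
triangle (suc n) = n ℕ.+ triangle n

2*triangle : ∀ n → triangle n ℕ.+ triangle n ℕ.+ n ≡ n ℕ.* n
2*triangle zero    = refl
2*triangle (suc n) = trans
  (ℕR.solve 2 (λ n t → (n ℕR.:+ t) ℕR.:+ (n ℕR.:+ t) ℕR.:+ (ℕR.con 1 ℕR.:+ n)
     ℕR.:= ℕR.con 1 ℕR.:+ n ℕR.:+ n ℕR.:+ (t ℕR.:+ t ℕR.:+ n)) refl n (triangle n))
  (trans (cong (λ s → 1 ℕ.+ n ℕ.+ n ℕ.+ s) (2*triangle n))
    (ℕR.solve 1 (λ n → ℕR.con 1 ℕR.:+ n ℕR.:+ n ℕR.:+ n ℕR.:* n
       ℕR.:= (ℕR.con 1 ℕR.:+ n) ℕR.:* (ℕR.con 1 ℕR.:+ n)) refl n))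

module _ {A : Set} where

  length-pairs : ∀ (xs : List A) → length (pairs xs) ≡ triangle (length xs)
  length-pairs []       = refl
  length-pairs (x ∷ xs) = trans (length-++ (map (x ,_) xs)) (cong₂ ℕ._+_ (length-map (x ,_) xs) (length-pairs xs))

  ∈-pairs⁻ : ∀ {u v} (xs : List A) → (u , v) ∈ pairs xs → u ∈ xs × v ∈ xs
  ∈-pairs⁻ (x ∷ xs) p∈ with ∈-++⁻ (map (x ,_) xs) p∈
  ... | inj₁ p∈ˡ with _ , v∈ , refl ← ∈-map⁻ (x ,_) p∈ˡ = here refl , there v∈
  ... | inj₂ p∈ʳ with u∈ , v∈ ← ∈-pairs⁻ xs p∈ʳ = there u∈ , there v∈

  pairs-distinct : ∀ {u v} {xs : List A} → Unique xs → (u , v) ∈ pairs xs → u ≢ v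
  pairs-distinct {xs = x ∷ xs} (x∉ ∷ u) p∈ with ∈-++⁻ (map (x ,_) xs) p∈
  ... | inj₁ p∈ˡ with _ , v∈ , refl ← ∈-map⁻ (x ,_) p∈ˡ = All.lookup x∉ v∈
  ... | inj₂ p∈ʳ = pairs-distinct u p∈ʳ

  pairs-asym : ∀ {u v} {xs : List A} → Unique xs → (u , v) ∈ pairs xs → (v , u) ∈ pairs xs → ⊥
  pairs-asym {xs = x ∷ xs} (x∉ ∷ un) p∈ q∈ with ∈-++⁻ (map (x ,_) xs) p∈ | ∈-++⁻ (map (x ,_) xs) q∈
  ... | inj₁ p∈ˡ | q∈′ with _ , v∈ , refl ← ∈-map⁻ (x ,_) p∈ˡ | q∈′
  ...   | inj₁ q∈ˡ with _ , u∈ , refl ← ∈-map⁻ (x ,_) q∈ˡ = All.lookup x∉ u∈ refl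
  ...   | inj₂ q∈ʳ = All.lookup x∉ (proj₂ (∈-pairs⁻ xs q∈ʳ)) refl
  pairs-asym {xs = x ∷ xs} (x∉ ∷ un) p∈ q∈ | inj₂ p∈ʳ | inj₁ q∈ˡ with _ , u∈ , refl ← ∈-map⁻ (x ,_) q∈ˡ =
    All.lookup x∉ (proj₂ (∈-pairs⁻ xs p∈ʳ)) refl
  pairs-asym {xs = x ∷ xs} (x∉ ∷ un) p∈ q∈ | inj₂ p∈ʳ | inj₂ q∈ʳ = pairs-asym un p∈ʳ q∈ʳ

  pairs-unique : ∀ {xs : List A} → Unique xs → Unique (pairs xs)
  pairs-unique []       = []
  pairs-unique {x ∷ xs} (x∉ ∷ u) = Unique.++⁺
    (injective⇒map-unique u (λ _ _ → cong proj₂))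
    (pairs-unique u)
    λ (p∈ˡ , p∈ʳ) → let _ , v∈ , eq = ∈-map⁻ (x ,_) p∈ˡ in
      All.lookup x∉ (proj₁ (∈-pairs⁻ xs p∈ʳ)) (sym (cong proj₁ eq))

  filter-split : ∀ {P : A → Set} (P? : ∀ x → Dec (P x)) xs → xs ↭ filter P? xs ++ filter (¬? ∘ P?) xs
  filter-split P? []       = Perm.refl
  filter-split P? (x ∷ xs) with P? x
  ... | yes _ = Perm.prep x (filter-split P? xs)
  ... | no _  = Perm.trans (Perm.prep x (filter-split P? xs)) (↭-sym (shift x (filter P? xs) _))

∈-pairs-map⁺ : ∀ {A B : Set} {f : A → B} {u v} (xs : List A) → (u , v) ∈ pairs xs → (f u , f v) ∈ pairs (map f xs)
∈-pairs-map⁺ {f = f} (x ∷ xs) p∈ with ∈-++⁻ (map (x ,_) xs) p∈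
... | inj₁ p∈ˡ with _ , v∈ , refl ← ∈-map⁻ (x ,_) p∈ˡ = ∈-++⁺ˡ (∈-map⁺ (f x ,_) (∈-map⁺ f v∈))
... | inj₂ p∈ʳ = ∈-++⁺ʳ (map (f x ,_) (map f xs)) (∈-pairs-map⁺ xs p∈ʳ)

pairSums-map : ∀ {A : Set} (w : A → ℕ) xs → pairSums (map w xs) ≡ map (λ (u , v) → w u ℕ.+ w v) (pairs xs)
pairSums-map w []       = refl
pairSums-map w (x ∷ xs) = trans
  (cong₂ _++_ (trans (sym (map-∘ xs)) (map-∘ xs)) (pairSums-map w xs))
  (sym (map-++ _ (map (x ,_) xs) (pairs xs)))

fins : ∀ n → List (Fin n)
fins zero    = []
fins (suc n) = zero ∷ map suc (fins n)

length-fins : ∀ n → length (fins n) ≡ n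
length-fins zero    = refl
length-fins (suc n) = cong suc (trans (length-map suc (fins n)) (length-fins n))

∈-fins : ∀ {n} (i : Fin n) → i ∈ fins n
∈-fins zero    = here refl
∈-fins (suc i) = there (∈-map⁺ suc (∈-fins i))

fins-unique : ∀ n → Unique (fins n)
fins-unique zero    = []
fins-unique (suc n) = All.tabulate (λ i∈ 0≡i → let _ , _ , eq = ∈-map⁻ suc i∈ in Fin.0≢1+n (trans 0≡i eq))
  ∷ injective⇒map-unique (fins-unique n) (λ _ _ → Fin.suc-injective)

<⇒∈-pairs-fins : ∀ {n} {u v : Fin n} → u Fin.< v → (u , v) ∈ pairs (fins n)
<⇒∈-pairs-fins {u = zero}  {v = suc v} _         = ∈-++⁺ˡ (∈-map⁺ (zero ,_) (∈-map⁺ suc (∈-fins v)))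
<⇒∈-pairs-fins {suc n} {u = suc u} {v = suc v} (s≤s u<v) =
  ∈-++⁺ʳ (map (zero ,_) (map suc (fins n))) (∈-pairs-map⁺ (fins n) (<⇒∈-pairs-fins u<v))

length-range : ∀ T → length (range T) ≡ T
length-range zero    = refl
length-range (suc T) = cong suc (length-range T)

∈-range : ∀ {s T} → 1 ℕ.≤ s → s ℕ.≤ T → s ∈ range T
∈-range {T = zero}  1≤s s≤0 = contradiction (ℕ.≤-trans 1≤s s≤0) λ ()
∈-range {s} {suc T} 1≤s s≤T with s ℕ.≟ suc T
... | yes refl = here refl
... | no s≢T   = there (∈-range 1≤s (ℕ.≤-pred (ℕ.≤∧≢⇒< s≤T s≢T)))

unique-resp-↭ : ∀ {A : Set} {xs ys : List A} → xs ↭ ys → Unique xs → Unique ys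
unique-resp-↭ p = AllPairs-resp-↭ (setoid _) (λ x≢y y≡x → x≢y (sym y≡x)) ((λ { refl x → x }) , λ { refl x → x }) (↭⇒↭ₛ p)

maximum-first : ∀ {A : Set} (g : A → ℕ) x xs → ∃₂ λ y ys → x ∷ xs ↭ y ∷ ys × All (λ v → g v ℕ.≤ g y) ys
maximum-first g x []       = x , [] , Perm.refl , []
maximum-first g x (z ∷ xs) with maximum-first g z xs
... | y , ys , p , le with ℕ.≤-total (g x) (g y)
...   | inj₁ x≤y = y , x ∷ ys , Perm.trans (Perm.prep x p) (Perm.swap x y Perm.refl) , x≤y ∷ le
...   | inj₂ y≤x = x , y ∷ ys , Perm.prep x p , y≤x ∷ All.map (λ v≤y → ℕ.≤-trans v≤y y≤x) le

module _ {A : Set} (g : A → ℕ) where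

  top-three : ∀ {p} xs → length xs ≡ 3 ℕ.+ p → ∃[ a ] ∃[ b ] ∃[ c ] ∃[ ys ]
    xs ↭ a ∷ b ∷ c ∷ ys × length ys ≡ p × g b ℕ.≤ g a × g c ℕ.≤ g b × All (λ v → g v ℕ.≤ g c) ys
  top-three (x ∷ xs) eq with maximum-first g x xs
  ... | a , [] , p₁ , _ with () ← trans (sym eq) (↭-length p₁)
  ... | a , y ∷ ys , p₁ , le₁ with maximum-first g y ys
  ...   | b , [] , p₂ , _ with () ← trans (sym eq) (trans (↭-length p₁) (cong suc (↭-length p₂)))
  ...   | b , z ∷ zs , p₂ , le₂ with maximum-first g z zs
  ...     | c , rest , p₃ , le₃ =
    a , b , c , rest , perm , ℕ.suc-injective (ℕ.suc-injective (ℕ.suc-injective (trans (sym (↭-length perm)) eq)))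
    , All.head (All-resp-↭ p₂ le₁) , All.head (All-resp-↭ p₃ le₂) , le₃
    where
    perm = Perm.trans p₁ (Perm.prep a (Perm.trans p₂ (Perm.prep b p₃)))

triangle-mono : ∀ {m n} → m ℕ.≤ n → triangle m ℕ.≤ triangle n
triangle-mono z≤n       = z≤n
triangle-mono (s≤s m≤n) = ℕ.+-mono-≤ m≤n (triangle-mono m≤n)

-- Geodesics of the wheel

Next-functional : ∀ {m} {i j k : Fin m} → Next i j → Next i k → j ≡ k
Next-functional (inj₁ p) (inj₁ q) = Fin.toℕ-injective (trans p (sym q))
Next-functional {j = j} (inj₁ p) (inj₂ (q , _)) = contradiction (trans p q) (ℕ.<⇒≢ (Fin.toℕ<n j))
Next-functional {k = k} (inj₂ (p , _)) (inj₁ q) = contradiction (trans q p) (ℕ.<⇒≢ (Fin.toℕ<n k))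
Next-functional (inj₂ (_ , p)) (inj₂ (_ , q)) = Fin.toℕ-injective (trans p (sym q))

Next-injective : ∀ {m} {i j k : Fin m} → Next i k → Next j k → i ≡ j
Next-injective (inj₁ p) (inj₁ q) = Fin.toℕ-injective (ℕ.suc-injective (trans (sym p) q))
Next-injective (inj₁ p) (inj₂ (_ , q)) = contradiction (trans (sym q) p) λ ()
Next-injective (inj₂ (_ , p)) (inj₁ q) = contradiction (trans (sym p) q) λ ()
Next-injective (inj₂ (p , _)) (inj₂ (q , _)) = Fin.toℕ-injective (ℕ.suc-injective (trans p (sym q)))

-- By the number of steps that wrap around from m - 1 to 0: with none a vertex would lie after
-- itself, with one m = 3, and two consecutive ones give m = 1.
no-triangle : ∀ {m} {a b c : Fin m} → 4 ℕ.≤ m → Next a b → Next b c → Next c a → ⊥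
no-triangle {a = a} 4≤m (inj₁ p) (inj₁ q) (inj₁ r) =
  ℕ.<⇒≢ (ℕ.<-trans (ℕ.n<1+n _) (ℕ.<-trans (ℕ.n<1+n _) (ℕ.n<1+n (suc (suc (toℕ a))))))
    (trans r (cong suc (trans q (cong suc p))))
no-triangle 4≤m (inj₁ p) (inj₁ q) (inj₂ (r , s)) =
  contradiction (subst (4 ℕ.≤_) (trans (sym r) (cong suc (trans q (cong suc (trans p (cong suc s)))))) 4≤m) λ {
      (s≤s (s≤s (s≤s ()))) }
no-triangle 4≤m (inj₁ p) (inj₂ (q , s)) (inj₁ r) =
  contradiction (subst (4 ℕ.≤_) (trans (sym q) (cong suc (trans p (cong suc (trans r (cong suc s)))))) 4≤m) λ {
      (s≤s (s≤s (s≤s ()))) }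
no-triangle 4≤m (inj₂ (p , s)) (inj₁ q) (inj₁ r) =
  contradiction (subst (4 ℕ.≤_) (trans (sym p) (cong suc (trans r (cong suc (trans q (cong suc s)))))) 4≤m) λ {
      (s≤s (s≤s (s≤s ()))) }
no-triangle 4≤m (inj₁ p) (inj₂ (q , s)) (inj₂ (r , t)) =
  contradiction (subst (4 ℕ.≤_) (trans (sym r) (cong suc s)) 4≤m) λ { (s≤s ()) }
no-triangle 4≤m (inj₂ (p , s)) (inj₁ q) (inj₂ (r , t)) =
  contradiction (subst (4 ℕ.≤_) (trans (sym p) (cong suc t)) 4≤m) λ { (s≤s ()) }
no-triangle 4≤m (inj₂ (p , s)) (inj₂ (q , t)) _ =
  contradiction (subst (4 ℕ.≤_) (trans (sym q) (cong suc s)) 4≤m) λ { (s≤s ()) }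

module WheelGeodesics (m : ℕ) where

  private
    G = wheel (suc m)
    V = Fin (suc m)

  Rim : V → V → Set
  Rim zero    _       = ⊥
  Rim (suc _) zero    = ⊥
  Rim (suc i) (suc j) = CycleAdj i j

  rim? : ∀ u v → Dec (Rim u v)
  rim? zero    _       = no λ ()
  rim? (suc _) zero    = no λ ()
  rim? (suc i) (suc j) = wheelAdj? (suc i) (suc j)

  rim-sym : ∀ {u v} → Rim u v → Rim v u
  rim-sym {suc i} {suc j} = wheelAdj-sym {x = suc i} {suc j}

  -- The clause for the hub lets single spokes and two-spoke paths be treated alike: as the hub has
  -- the value 0, the weight is the sum of the values of the endpoints in both cases.
  viaHub : V → V → List V
  viaHub zero    v = zero ∷ v ∷ []
  viaHub (suc i) v = suc i ∷ zero ∷ v ∷ []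

  viaHub-geodesic : ∀ {u v} → u Fin.< v → ¬ Rim u v → IsGeodesic G u v (viaHub u v)
  viaHub-geodesic {zero}  {suc j} _   _  =
    (λ ()) , (refl , refl , tt ∷ [-] , ((λ ()) ∷ []) ∷ [] ∷ []) , minimal
    where
    minimal : ∀ ys → IsPath G zero (suc j) ys → 2 ℕ.≤ length ys
    minimal (_ ∷ []) (refl , () , _)
    minimal (_ ∷ _ ∷ _) _ = s≤s (s≤s z≤n)
  viaHub-geodesic {suc i} {suc j} i<j ¬r =
    i≢j , (refl , refl , tt ∷ tt ∷ [-] , ((λ ()) ∷ i≢j ∷ []) ∷ ((λ ()) ∷ []) ∷ [] ∷ []) , minimal
    where
    i≢j = Fin.<⇒≢ i<j
    minimal : ∀ ys → IsPath G (suc i) (suc j) ys → 3 ℕ.≤ length ys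
    minimal (_ ∷ []) (refl , eq , _) = contradiction (just-injective eq) i≢j
    minimal (_ ∷ _ ∷ []) (refl , refl , r ∷ _ , _) = contradiction r ¬r
    minimal (_ ∷ _ ∷ _ ∷ _) _ = s≤s (s≤s (s≤s z≤n))

  data Shape (u v : V) : List V → Set where
    edge : Rim u v ⊎ u ≡ zero → Shape u v (u ∷ v ∷ [])
    hub  : u ≢ zero → ¬ Rim u v → Shape u v (u ∷ zero ∷ v ∷ [])
    rim  : ∀ {i j x} → u ≡ suc i → v ≡ suc j → CycleAdj i x → CycleAdj x j → Shape u v (u ∷ suc x ∷ v ∷ [])

  shape : ∀ {u v xs} → u Fin.< v → IsGeodesic G u v xs → Shape u v xs
  shape {xs = []} _ (_ , (() , _) , _)
  shape {xs = _ ∷ []} _ (u≢v , (refl , eq , _) , _) = contradiction (just-injective eq) u≢v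
  shape {zero} {xs = _ ∷ _ ∷ []} _ (_ , (refl , refl , _) , _) = edge (inj₂ refl)
  shape {suc i} {suc j} {_ ∷ _ ∷ []} _ (_ , (refl , refl , r ∷ _ , _) , _) = edge (inj₁ r)
  shape {zero} {suc j} {_ ∷ _ ∷ _ ∷ _} u<v (_ , _ , minimal)
    with s≤s (s≤s ()) ← minimal _ (proj₁ (proj₂ (viaHub-geodesic {zero} {suc j} u<v (λ ()))))
  shape {suc i} {suc j} {_ ∷ x ∷ _ ∷ []} u<v (u≢v , (refl , refl , r ∷ r′ ∷ _ , _) , minimal) = middle x r r′
    where
    ¬rim : ¬ CycleAdj i j
    ¬rim r with s≤s (s≤s ()) ← minimal (suc i ∷ suc j ∷ []) (refl , refl , r ∷ [-] , (u≢v ∷ []) ∷ [] ∷ [])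
    middle : ∀ x → WheelAdj (suc i) x → WheelAdj x (suc j) → Shape (suc i) (suc j) (suc i ∷ x ∷ suc j ∷ [])
    middle zero    _ _  = hub (λ ()) ¬rim
    middle (suc x) r r′ = rim refl refl r r′
  shape {suc i} {suc j} {_ ∷ _ ∷ _ ∷ _ ∷ _} u<v (u≢v , _ , minimal) with rim? (suc i) (suc j)
  ... | yes r with s≤s (s≤s ()) ← minimal (suc i ∷ suc j ∷ []) (refl , refl , r ∷ [-] , (u≢v ∷ []) ∷ [] ∷ [])
  ... | no ¬r with s≤s (s≤s (s≤s ())) ← minimal _ (proj₁ (proj₂ (viaHub-geodesic {suc i} {suc j} u<v ¬r)))

  -- Edges and paths through the hub are determined by their endpoints. A rim path of two edges is
  -- determined by its middle vertex, whose only rim neighbours are its endpoints; its code lies on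
  -- the diagonal, away from all pairs of endpoints.
  code : List V → V × V
  code (u ∷ v ∷ [])         = u , v
  code (u ∷ zero ∷ v ∷ [])  = u , v
  code (u ∷ suc x ∷ v ∷ []) = suc x , suc x
  code _                    = zero , zero

  codes : List (V × V)
  codes = pairs (fins (suc m)) ++ map (λ i → suc i , suc i) (fins m)

  length-codes : length codes ≡ triangle (suc m) ℕ.+ m
  length-codes = trans (length-++ (pairs (fins (suc m)))) (cong₂ ℕ._+_
    (trans (length-pairs (fins (suc m))) (cong triangle (length-fins (suc m))))
    (trans (length-map _ (fins m)) (length-fins m)))

  code-∈ : ∀ {u v xs} → u Fin.< v → Shape u v xs → code xs ∈ codes
  code-∈ u<v (edge _)  = ∈-++⁺ˡ (<⇒∈-pairs-fins u<v)
  code-∈ u<v (hub _ _) = ∈-++⁺ˡ (<⇒∈-pairs-fins u<v)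
  code-∈ u<v (rim {x = x} _ _ _ _) = ∈-++⁺ʳ (pairs (fins (suc m))) (∈-map⁺ _ (∈-fins x))

  code-injective : ∀ {u v u′ v′ xs ys} → u Fin.< v → u′ Fin.< v′ → Shape u v xs → Shape u′ v′ ys →
                   code xs ≡ code ys → xs ≡ ys
  code-injective _ _ (edge _) (edge _) refl = refl
  code-injective _ _ (edge (inj₁ r)) (hub _ ¬r) refl = contradiction r ¬r
  code-injective _ _ (edge (inj₂ z)) (hub ¬z _) refl = contradiction z ¬z
  code-injective u<v _ (edge _) (rim _ _ _ _) refl = contradiction u<v (ℕ.<-irrefl refl)
  code-injective _ _ (hub _ ¬r) (edge (inj₁ r)) refl = contradiction r ¬r
  code-injective _ _ (hub ¬z _) (edge (inj₂ z)) refl = contradiction z ¬z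
  code-injective _ _ (hub _ _) (hub _ _) refl = refl
  code-injective u<v _ (hub _ _) (rim _ _ _ _) refl = contradiction u<v (ℕ.<-irrefl refl)
  code-injective _ u<v (rim _ _ _ _) (edge _) refl = contradiction u<v (ℕ.<-irrefl refl)
  code-injective _ u<v (rim _ _ _ _) (hub _ _) refl = contradiction u<v (ℕ.<-irrefl refl)
  code-injective u<v u′<v′ (rim refl refl (_ , ix) (_ , xj)) (rim refl refl (_ , i′x) (_ , xj′)) refl =
    same ix xj i′x xj′ u<v u′<v′
    where
    same : ∀ {i j i′ j′ x} → Next i x ⊎ Next x i → Next x j ⊎ Next j x → Next i′ x ⊎ Next x i′ → Next x j′ ⊎ Next j′ x →
           suc i Fin.< suc j → suc i′ Fin.< suc j′ →
           _≡_ {A = List V} (suc i ∷ suc x ∷ suc j ∷ []) (suc i′ ∷ suc x ∷ suc j′ ∷ [])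
    same (inj₁ p) (inj₂ q) _ _ lt _ = contradiction (cong suc (Next-injective p q)) (Fin.<⇒≢ lt)
    same (inj₂ p) (inj₁ q) _ _ lt _ = contradiction (cong suc (Next-functional p q)) (Fin.<⇒≢ lt)
    same _ _ (inj₁ p) (inj₂ q) _ lt = contradiction (cong suc (Next-injective p q)) (Fin.<⇒≢ lt)
    same _ _ (inj₂ p) (inj₁ q) _ lt = contradiction (cong suc (Next-functional p q)) (Fin.<⇒≢ lt)
    same (inj₁ p) (inj₁ q) (inj₁ p′) (inj₁ q′) _ _
      rewrite Next-injective p p′ | Next-functional q q′ = refl
    same (inj₂ p) (inj₂ q) (inj₂ p′) (inj₂ q′) _ _
      rewrite Next-functional p p′ | Next-injective q q′ = refl
    same (inj₁ p) (inj₁ q) (inj₂ p′) (inj₂ q′) lt lt′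
      rewrite Next-injective p q′ | Next-functional q p′ = contradiction lt′ (ℕ.<-asym lt)
    same (inj₂ p) (inj₂ q) (inj₁ p′) (inj₁ q′) lt lt′
      rewrite Next-functional p q′ | Next-injective q p′ = contradiction lt′ (ℕ.<-asym lt)

  geodesics-unique⇒tgp≤ : Unique (geodesics G) → tgp G ℕ.≤ triangle (suc m) ℕ.+ m
  geodesics-unique⇒tgp≤ unique = subst₂ ℕ._≤_ (length-map code (geodesics G)) length-codes
    (unique-⊆⇒length-≤
      (injective⇒map-unique unique λ x∈ y∈ eq →
        let _ , _ , u<v , g = ∈-geodesics⁻ G x∈ ; _ , _ , u′<v′ , g′ = ∈-geodesics⁻ G y∈ in
        code-injective u<v u′<v′ (shape u<v g) (shape u′<v′ g′) eq)
      λ c∈ → let _ , x∈ , eq = ∈-map⁻ code c∈ ; _ , _ , u<v , g = ∈-geodesics⁻ G x∈ in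
        subst (_∈ codes) (sym eq) (code-∈ u<v (shape u<v g)))

  module _ (f : EdgeLabeling G) (leech : IsGeodesicLeechLabeling G f) where
    open EdgeLabeling f

    spoke : V → ℕ
    spoke zero    = 0
    spoke (suc i) = label zero (suc i)

    weight-viaHub : ∀ u v → v ≢ zero → weight (viaHub u v) ≡ spoke u ℕ.+ spoke v
    weight-viaHub _       zero    v≢0 = contradiction refl v≢0
    weight-viaHub zero    (suc j) _   = ℕ.+-identityʳ _
    weight-viaHub (suc i) (suc j) _   = cong₂ ℕ._+_ (label-sym tt) (ℕ.+-identityʳ _)

    private
      weights-unique : Unique (map weight (geodesics G))
      weights-unique = unique-resp-↭ (↭-sym leech) (Unique.map⁺ ℕ.suc-injective (Unique.upTo⁺ (tgp G)))

    N : ℕ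
    N = tgp G

    -- That `geodesics` has no repetition is inferred from the labeling: a path listed twice would
    -- repeat a weight, whereas the weights are a permutation of 1, ..., N.
    N≤ : N ℕ.≤ triangle (suc m) ℕ.+ m
    N≤ = geodesics-unique⇒tgp≤ (AllPairs.map (λ fx≢fy x≡y → fx≢fy (cong weight x≡y)) (AllPairs.map⁻ weights-unique))

    private
      viaHub-∈ : ∀ {u v} → u Fin.< v → ¬ Rim u v → viaHub u v ∈ geodesics G
      viaHub-∈ u<v ¬r = ∈-geodesics⁺ G u<v (viaHub-geodesic u<v ¬r)

      v≢0 : ∀ {u v : V} → u Fin.< v → v ≢ zero
      v≢0 () refl

      viaHub-injective : ∀ {u v u′ v′} → viaHub u v ≡ viaHub u′ v′ → u ≡ u′ × v ≡ v′
      viaHub-injective {zero}  {u′ = zero}  refl = refl , refl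
      viaHub-injective {suc _} {u′ = suc _} refl = refl , refl

      bounds< : ∀ {u v} → u Fin.< v → ¬ Rim u v → 1 ℕ.≤ spoke u ℕ.+ spoke v × spoke u ℕ.+ spoke v ℕ.≤ N
      bounds< {u} {v} u<v ¬r
        with k , k∈ , eq ← ∈-map⁻ suc (∈-resp-↭ leech (∈-map⁺ weight (viaHub-∈ u<v ¬r)))
        rewrite sym (weight-viaHub u v (v≢0 u<v)) | eq = s≤s z≤n , ∈-upTo⁻ k∈

      injective< : ∀ {u v u′ v′} → u Fin.< v → ¬ Rim u v → u′ Fin.< v′ → ¬ Rim u′ v′ →
                   spoke u ℕ.+ spoke v ≡ spoke u′ ℕ.+ spoke v′ → u ≡ u′ × v ≡ v′
      injective< {u} {v} {u′} {v′} u<v ¬r u′<v′ ¬r′ eq = viaHub-injective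
        (map-unique⇒injective weights-unique (viaHub-∈ u<v ¬r) (viaHub-∈ u′<v′ ¬r′)
          (trans (weight-viaHub u v (v≢0 u<v)) (trans eq (sym (weight-viaHub u′ v′ (v≢0 u′<v′))))))

    sum-bounds : ∀ {u v} → u ≢ v → ¬ Rim u v → 1 ℕ.≤ spoke u ℕ.+ spoke v × spoke u ℕ.+ spoke v ℕ.≤ N
    sum-bounds {u} {v} u≢v ¬r with Fin.<-cmp u v
    ... | tri< u<v _ _ = bounds< u<v ¬r
    ... | tri≈ _ u≡v _ = contradiction u≡v u≢v
    ... | tri> _ _ v<u rewrite ℕ.+-comm (spoke u) (spoke v) = bounds< v<u (¬r ∘ rim-sym)

    sum-injective : ∀ {u v u′ v′} → u ≢ v → ¬ Rim u v → u′ ≢ v′ → ¬ Rim u′ v′ →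
                    spoke u ℕ.+ spoke v ≡ spoke u′ ℕ.+ spoke v′ →
                    (u ≡ u′ × v ≡ v′) ⊎ (u ≡ v′ × v ≡ u′)
    sum-injective {u} {v} {u′} {v′} u≢v ¬r u′≢v′ ¬r′ eq with Fin.<-cmp u v | Fin.<-cmp u′ v′
    ... | tri≈ _ u≡v _ | _ = contradiction u≡v u≢v
    ... | _ | tri≈ _ u≡v _ = contradiction u≡v u′≢v′
    ... | tri< u<v _ _ | tri< u′<v′ _ _ = inj₁ (injective< u<v ¬r u′<v′ ¬r′ eq)
    ... | tri< u<v _ _ | tri> _ _ v′<u′ =
      inj₂ (injective< u<v ¬r v′<u′ (¬r′ ∘ rim-sym) (trans eq (ℕ.+-comm (spoke u′) _)))
    ... | tri> _ _ v<u | tri< u′<v′ _ _ = let p , q = injective< v<u (¬r ∘ rim-sym) u′<v′ ¬r′ (trans (ℕ.+-comm (spoke v) _) eq) in inj₂ (q , p)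
    ... | tri> _ _ v<u | tri> _ _ v′<u′ = let p , q = injective< v<u (¬r ∘ rim-sym) v′<u′ (¬r′ ∘ rim-sym)
                                                (trans (ℕ.+-comm (spoke v) _) (trans eq (ℕ.+-comm (spoke u′) _))) in inj₁ (q , p)

-- The kernel at single values

module RotationKernel (T : ℕ) (500≤T : 500 ℕ.≤ T) where
  open Rotation T 500≤T using (χ; 0≤im-χ; 0≤re-χ; im-χ-1)

  0≤im-1 : 0ℚ ≤ im χ 1
  0≤im-1 = 0≤im-χ {1} (ℕ.≤-trans (s≤s (s≤s z≤n)) 500≤T)

  -- sin (j + 1)φ ≤ sin φ + sin jφ as long as both sines on the right are nonnegative.
  im-≤ : ∀ j → j ℕ.+ j ℕ.≤ T → im χ j ≤ ι j * im χ 1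
  im-≤ zero    _   = ≤-reflexive (trans (im-zero χ) (sym (ℚ.*-zeroˡ (im χ 1))))
    where
    -- For the value a + i b at 0, the addition law for 0 + 0 gives b = 2 a b and a = a² - b². With
    -- a² + b² = 1, b = (2 a b) a - b (a² - b²) = b a - b a = 0.
    im-zero : ∀ ψ → im ψ 0 ≡ 0ℚ
    im-zero ψ = begin
      im ψ 0                                          ≡⟨ solve 2 (λ a b → b := b :* con 1ℚ) refl (re ψ 0) (im ψ 0) ⟩
      im ψ 0 * 1ℚ                                     ≡⟨ cong (im ψ 0 *_) (sym (unit ψ 0)) ⟩
      im ψ 0 * (re ψ 0 * re ψ 0 + im ψ 0 * im ψ 0)    ≡⟨ solve 2 (λ a b → b :* (a :* a :+ b :* b)
          := (b :* a :+ a :* b) :* a :- b :* (a :* a :- b :* b)) refl (re ψ 0) (im ψ 0) ⟩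
      (im ψ 0 * re ψ 0 + re ψ 0 * im ψ 0) * re ψ 0 - im ψ 0 * (re ψ 0 * re ψ 0 - im ψ 0 * im ψ 0)
                                                      ≡⟨ cong₂ (λ p q → p * re ψ 0 - im ψ 0 * q) (sym (im-+ ψ 0 0))
                                                          (sym (re-+ ψ 0 0)) ⟩
      im ψ 0 * re ψ 0 - im ψ 0 * re ψ 0               ≡⟨ solve 2 (λ a b → b :* a :- b :* a := con 0ℚ) refl (re ψ 0) (im ψ 0) ⟩
      0ℚ                                              ∎
      where open ≡-Reasoning
  im-≤ (suc j) 2j<T = ≤-by
    (0≤im-1 ⊗ ≤⇒0≤- (re≤1 χ j) ⊕ ≤⇒0≤- (re≤1 χ 1) ⊗ 0≤im-χ {j} 2j≤T ⊕ ≤⇒0≤- (im-≤ j 2j≤T))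
    (trans (cong (λ q → (1ℚ + ι j) * im χ 1 - q) (im-+ χ 1 j))
      (solve 5 (λ n s c a b → (con 1ℚ :+ n) :* s :- (s :* a :+ c :* b)
          := s :* (con 1ℚ :- a) :+ (con 1ℚ :- c) :* b :+ (n :* s :- b)) refl
         (ι j) (im χ 1) (re χ 1) (re χ j) (im χ j)))
    where
    2j≤T : j ℕ.+ j ℕ.≤ T
    2j≤T = ℕ.≤-trans (ℕ.+-mono-≤ (ℕ.n≤1+n j) (ℕ.n≤1+n j)) 2j<T

  kernel-lower : ∀ x → x ℕ.+ x ℕ.≤ T → 1ℚ ≤ kernel χ x
  kernel-lower x 2x≤T = kernel≥1 χ x (0≤im-χ {x} 2x≤T)

  -- For x = h + d beyond h = ⌊T / 2⌋, the addition law has the terms im h · re d ≥ 0 and re h · im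
  -- d with re h ≥ -1, so that im χ x ≥ -im χ d ≥ -d · im χ 1. The bound on 4 J makes re d
  -- nonnegative.
  kernel-outlier : ∀ J x → J ℕ.+ J ℕ.+ (J ℕ.+ J) ℕ.≤ T → ι J * im χ 1 ≤ (ℤ.+ 23 / 50) → x ℕ.+ x ℕ.≤ T ℕ.+ (J ℕ.+ J) →
                   1ℚ - (ℤ.+ 16 / 5) * (ι J * im χ 1) ≤ kernel χ x
  kernel-outlier J x 4J≤T small 2x≤ = kernel≥ χ x (0≤ι J ⊗ 0≤im-1) small (lower (ℕ.≤-total h x))
    where
    h = ℕ.⌊ T /2⌋
    2h≤T : h ℕ.+ h ℕ.≤ T
    2h≤T = subst (h ℕ.+ h ℕ.≤_) (ℕ.⌊n/2⌋+⌈n/2⌉≡n T) (ℕ.+-monoʳ-≤ h (ℕ.⌊n/2⌋≤⌈n/2⌉ T))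
    T≤2h+1 : T ℕ.≤ suc (h ℕ.+ h)
    T≤2h+1 = subst (ℕ._≤ suc (h ℕ.+ h)) (ℕ.⌊n/2⌋+⌈n/2⌉≡n T) (subst (h ℕ.+ ℕ.⌈ T /2⌉ ℕ.≤_) (ℕ.+-suc h h) (ℕ.+-monoʳ-≤ h (⌈/2⌉≤ T)))
      where
      ⌈/2⌉≤ : ∀ n → ℕ.⌈ n /2⌉ ℕ.≤ suc ℕ.⌊ n /2⌋
      ⌈/2⌉≤ zero          = z≤n
      ⌈/2⌉≤ (suc zero)    = s≤s z≤n
      ⌈/2⌉≤ (suc (suc n)) = s≤s (⌈/2⌉≤ n)
    nonNeg⇒ : 0ℚ ≤ im χ x → - (ι J * im χ 1) ≤ im χ x
    nonNeg⇒ 0≤im = ≤-trans (ℚ.neg-antimono-≤ (0≤ι J ⊗ 0≤im-1)) 0≤im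
    lower : h ℕ.≤ x ⊎ x ℕ.≤ h → - (ι J * im χ 1) ≤ im χ x
    lower (inj₂ x≤h) = nonNeg⇒ (0≤im-χ {x} (ℕ.≤-trans (ℕ.+-mono-≤ x≤h x≤h) 2h≤T))
    lower (inj₁ h≤x) = subst (λ y → - (ι J * im χ 1) ≤ im χ y) (ℕ.m+[n∸m]≡n h≤x)
      (≤-by (0≤im-χ {h} 2h≤T ⊗ 0≤re-χ {d} 4d≤T ⊕ ≤⇒0≤- (-1≤re χ h) ⊗ 0≤im-χ {d} 2d≤T ⊕ ≤⇒0≤- (im-≤ d 2d≤T)
              ⊕ ≤⇒0≤- (ι-mono-≤ d≤J) ⊗ 0≤im-1)
        (trans (cong (λ q → q - (- (ι J * im χ 1))) (im-+ χ h d))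
          (solve 7 (λ a b c e s J d → b :* c :+ a :* e :- (:- (J :* s))
              := b :* c :+ (a :- (:- con (ℤ.+ 1 / 1))) :* e :+ (d :* s :- e) :+ (J :- d) :* s) refl
             (re χ h) (im χ h) (re χ d) (im χ d) (im χ 1) (ι J) (ι d))))
      where
      d = x ℕ.∸ h
      d≤J : d ℕ.≤ J
      -- Rounding T / 2 down costs nothing: T ≤ 2h + 1, while d ≥ J + 1 would give 2x ≥ 2h + 2J + 2
      -- > T + 2J.
      d≤J = ℕ.≮⇒≥ λ J<d → ℕ.≤⇒≯ 2x≤ (begin
        suc (T ℕ.+ (J ℕ.+ J))                  ≤⟨ s≤s (ℕ.+-monoˡ-≤ (J ℕ.+ J) T≤2h+1) ⟩
        suc (suc (h ℕ.+ h)) ℕ.+ (J ℕ.+ J)      ≡⟨ ℕR.solve 2 (λ h J → ℕR.con 2 ℕR.:+ (h ℕR.:+ h) ℕR.:+ (J ℕR.:+ J)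
                                                     ℕR.:= (h ℕR.:+ (ℕR.con 1 ℕR.:+ J)) ℕR.:+
                                                         (h ℕR.:+ (ℕR.con 1 ℕR.:+ J))) refl h J ⟩
        (h ℕ.+ suc J) ℕ.+ (h ℕ.+ suc J)        ≤⟨ ℕ.+-mono-≤ (ℕ.+-monoʳ-≤ h J<d) (ℕ.+-monoʳ-≤ h J<d) ⟩
        (h ℕ.+ d) ℕ.+ (h ℕ.+ d)                ≡⟨ cong₂ ℕ._+_ (ℕ.m+[n∸m]≡n h≤x) (ℕ.m+[n∸m]≡n h≤x) ⟩
        x ℕ.+ x                                ∎)
        where open ℕ.≤-Reasoning
      4d≤T : d ℕ.+ d ℕ.+ (d ℕ.+ d) ℕ.≤ T
      4d≤T = ℕ.≤-trans (ℕ.+-mono-≤ (ℕ.+-mono-≤ d≤J d≤J) (ℕ.+-mono-≤ d≤J d≤J)) 4J≤T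
      2d≤T : d ℕ.+ d ℕ.≤ T
      2d≤T = ℕ.≤-trans (ℕ.m≤m+n (d ℕ.+ d) (d ℕ.+ d)) 4d≤T

-- Packings from sets of vertices

module _ (m : ℕ) where
  open WheelGeodesics m

  rim-triangle : 4 ℕ.≤ m → ∀ {a b c} → Rim a b → Rim b c → Rim c a → ⊥
  rim-triangle 4≤m {suc _} {suc _} {suc _} (_ , inj₁ ab) (_ , inj₁ bc)   (_ , inj₁ ca)   = no-triangle 4≤m ab bc ca
  rim-triangle 4≤m {suc _} {suc _} {suc _} (_ , inj₁ ab) (b≢c , inj₁ bc) (_ , inj₂ ac)   = b≢c (Next-functional ab ac)
  rim-triangle 4≤m {suc _} {suc _} {suc _} (_ , inj₁ ab) (_ , inj₂ cb)   (c≢a , _)       = c≢a (Next-injective cb ab)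
  rim-triangle 4≤m {suc _} {suc _} {suc _} (_ , inj₂ ba) (_ , inj₁ bc)   (c≢a , _)       = c≢a (Next-functional bc ba)
  rim-triangle 4≤m {suc _} {suc _} {suc _} (a≢b , inj₂ ba) (_ , inj₂ cb) (_ , inj₁ ca)   = a≢b (Next-functional ca cb)
  rim-triangle 4≤m {suc _} {suc _} {suc _} (_ , inj₂ ba) (_ , inj₂ cb)   (_ , inj₂ ac)   = no-triangle 4≤m ba ac cb

  rim-three : ∀ {a b c d} → Rim a b → Rim a c → Rim a d → b ≢ c → b ≢ d → c ≢ d → ⊥
  rim-three {suc _} {suc _} {suc _} {suc _} (_ , inj₁ p) (_ , inj₁ q) _ b≢c _ _ = b≢c (cong suc (Next-functional p q))
  rim-three {suc _} {suc _} {suc _} {suc _} (_ , inj₂ p) (_ , inj₂ q) _ b≢c _ _ = b≢c (cong suc (Next-injective p q))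
  rim-three {suc _} {suc _} {suc _} {suc _} (_ , inj₁ p) _ (_ , inj₁ r) _ b≢d _ = b≢d (cong suc (Next-functional p r))
  rim-three {suc _} {suc _} {suc _} {suc _} (_ , inj₂ p) _ (_ , inj₂ r) _ b≢d _ = b≢d (cong suc (Next-injective p r))
  rim-three {suc _} {suc _} {suc _} {suc _} _ (_ , inj₁ q) (_ , inj₁ r) _ _ c≢d = c≢d (cong suc (Next-functional q r))
  rim-three {suc _} {suc _} {suc _} {suc _} _ (_ , inj₂ q) (_ , inj₂ r) _ _ c≢d = c≢d (cong suc (Next-injective q r))

  -- A rim edge is determined by its first vertex in the direction of Next.
  tail : Fin (suc m) × Fin (suc m) → Fin (suc m)
  tail (suc i , suc j) with next? i j
  ... | yes _ = suc i
  ... | no _  = suc j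
  tail _ = zero

  tail-spec : ∀ {u v} → Rim u v → ∃₂ λ i j → Next i j × tail (u , v) ≡ suc i ×
              ((u , v) ≡ (suc i , suc j) ⊎ (v , u) ≡ (suc i , suc j))
  tail-spec {suc i} {suc j} (_ , adj) with next? i j
  ... | yes ij = i , j , ij , refl , inj₁ refl
  ... | no ¬ij = j , i , [ (λ ij → contradiction ij ¬ij) , (λ ji → ji) ]′ adj , refl , inj₂ refl

  module _ (f : EdgeLabeling (wheel (suc m))) (leech : IsGeodesicLeechLabeling (wheel (suc m)) f) where
    private
      s = spoke f leech
      V = Fin (suc m)
      Far : V × V → Set
      Far (u , v) = ¬ Rim u v
      far? : ∀ e → Dec (Far e)
      far? (u , v) = ¬? (rim? u v)
      adjacent : List V → List (V × V)
      adjacent l = filter (¬? ∘ far?) (pairs l)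

    -- The rim has `m` edges, one for each first vertex, and each occurs at most once among the
    -- pairs, since these are taken in the order of a list without repetitions.
    adjacent-length : ∀ {l} → Unique l → length (adjacent l) ℕ.≤ m
    adjacent-length {l} unique = subst₂ ℕ._≤_ (length-map tail (adjacent l)) (trans (length-map suc (fins m)) (length-fins m))
      (unique-⊆⇒length-≤
        (injective⇒map-unique (Unique.filter⁺ (¬? ∘ far?) (pairs-unique unique)) λ {e} {e′} → inj {e} {e′})
        λ t∈ → let e , e∈ , eq = ∈-map⁻ tail t∈ ; i , _ , _ , t≡ , _ = tail-spec (proj₂ (adjacent-∈ {e} e∈)) in
          subst (_∈ map suc (fins m)) (sym (trans eq t≡)) (∈-map⁺ suc (∈-fins i)))
      where
      adjacent-∈ : ∀ {e} → e ∈ adjacent l → e ∈ pairs l × Rim (proj₁ e) (proj₂ e)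
      adjacent-∈ {u , v} e∈ with e∈′ , ¬far ← ∈-filter⁻ (¬? ∘ far?) {xs = pairs l} e∈ = e∈′ , decidable-stable (rim? u v) ¬far
      inj : ∀ {e e′} → e ∈ adjacent l → e′ ∈ adjacent l → tail e ≡ tail e′ → e ≡ e′
      inj {u , v} {u′ , v′} e∈ e′∈ eq
        with tail-spec (proj₂ (adjacent-∈ e∈)) | tail-spec (proj₂ (adjacent-∈ e′∈))
      ... | i , j , ij , t , o | i′ , j′ , ij′ , t′ , o′
        with refl ← Fin.suc-injective (trans (sym t) (trans eq t′))
        with refl ← Next-functional ij ij′
        with o | o′
      ... | inj₁ refl | inj₁ refl = refl
      ... | inj₂ refl | inj₂ refl = refl
      ... | inj₁ refl | inj₂ refl = contradiction (proj₁ (adjacent-∈ e′∈)) (pairs-asym unique (proj₁ (adjacent-∈ e∈)))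
      ... | inj₂ refl | inj₁ refl = contradiction (proj₁ (adjacent-∈ e∈)) (pairs-asym unique (proj₁ (adjacent-∈ e′∈)))

    packing : ∀ {l T} → Unique l →
              (∀ {u v} → u ∈ l → v ∈ l → u ≢ v → ¬ Rim u v → s u ℕ.+ s v ℕ.≤ T) →
              Packing (map s l) T
    packing {l} {T} unique ≤T = record
      { distinct = sums
      ; rest     = map sum (adjacent l)
      ; missing  = proj₁ complement
      ; split    = subst₂ _↭_ (sym (pairSums-map s l)) (map-++ sum far (adjacent l)) (↭-map⁺ sum (filter-split far? (pairs l)))
      ; complete = ↭-sym (proj₂ complement)
      }
      where
      sum : V × V → ℕ
      sum (u , v) = s u ℕ.+ s v
      far = filter far? (pairs l)
      sums = map sum far
      far-∈ : ∀ {u v} → (u , v) ∈ far → (u , v) ∈ pairs l × ¬ Rim u v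
      far-∈ = ∈-filter⁻ far? {xs = pairs l}
      complement = unique-⊆⇒↭ {xs = sums} {range T}
        (injective⇒map-unique (Unique.filter⁺ far? (pairs-unique unique)) λ {e} {e′} → inj {e} {e′})
        λ s∈ → let (u , v) , e∈ , eq = ∈-map⁻ sum s∈ ; p∈ , ¬r = far-∈ e∈
                   u∈ , v∈ = ∈-pairs⁻ l p∈ ; u≢v = pairs-distinct unique p∈ in
          subst (_∈ range T) (sym eq) (∈-range (proj₁ (sum-bounds f leech u≢v ¬r)) (≤T u∈ v∈ u≢v ¬r))
        where
        inj : ∀ {e e′} → e ∈ far → e′ ∈ far → sum e ≡ sum e′ → e ≡ e′
        inj {u , v} {u′ , v′} e∈ e′∈ eq with far-∈ e∈ | far-∈ e′∈
        ... | p∈ , ¬r | p′∈ , ¬r′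
          with sum-injective f leech (pairs-distinct unique p∈) ¬r (pairs-distinct unique p′∈) ¬r′ eq
        ...   | inj₁ (refl , refl) = refl
        ...   | inj₂ (refl , refl) = contradiction p′∈ (pairs-asym unique p∈)

    packing-rest : ∀ {l T} (unique : Unique l) (≤T : ∀ {u v} → u ∈ l → v ∈ l → u ≢ v → ¬ Rim u v → s u ℕ.+ s v ℕ.≤ T) →
                   length (Packing.rest (packing unique ≤T)) ℕ.≤ m
    packing-rest {l} unique ≤T = subst (ℕ._≤ m) (sym (length-map _ (adjacent l))) (adjacent-length unique)

module _ {xs T} (P : Packing xs T) where
  open Packing P

  -- Comparing lengths in the two permutations eliminates `distinct`. As the quadratic parts of `T`
  -- and of the number of pairs will agree, `μ` becomes linear in m.
  packing-size : μ + ι (triangle (length xs)) ≡ ι T + e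
  packing-size = begin
    μ + ι (triangle (length xs))       ≡⟨ cong (λ n → μ + ι n) (trans (sym length-pairSums) (trans (↭-length split)
        (length-++ distinct))) ⟩
    μ + ι (length distinct ℕ.+ length rest)
                                       ≡⟨ cong (μ +_) (ι-+ (length distinct) (length rest)) ⟩
    μ + (ι (length distinct) + e)      ≡⟨ solve 3 (λ m d e → m :+ (d :+ e) := d :+ m :+ e) refl μ (ι (length distinct)) e ⟩
    ι (length distinct) + μ + e        ≡⟨ cong (_+ e) (trans (sym (ι-+ (length distinct) (length missing)))
                                            (cong ι (trans (sym (length-++ distinct)) (trans (↭-length complete)
                                                (length-range T))))) ⟩
    ι T + e                            ∎
    where
    open ≡-Reasoning
    length-pairSums : length (pairSums xs) ≡ triangle (length xs)
    length-pairSums = subst (λ ys → length (pairSums ys) ≡ triangle (length ys)) (map-id xs)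
      (trans (cong length (pairSums-map (λ x → x) xs)) (trans (length-map _ (pairs xs)) (trans (length-pairs xs)
          (cong triangle (sym (length-map _ xs))))))

ι-∸ : ∀ {m n} → n ℕ.≤ m → ι (m ℕ.∸ n) ≡ ι m - ι n
ι-∸ {m} {n} n≤m = begin
  ι (m ℕ.∸ n)                 ≡⟨ solve 2 (λ a b → a := a :+ b :- b) refl (ι (m ℕ.∸ n)) (ι n) ⟩
  ι (m ℕ.∸ n) + ι n - ι n     ≡⟨ cong (λ q → q - ι n) (trans (sym (ι-+ (m ℕ.∸ n) n)) (cong ι (ℕ.m∸n+n≡m n≤m))) ⟩
  ι m - ι n                   ∎
  where open ≡-Reasoning

double-≤-∸ : ∀ {x y K N} → x ℕ.+ y ℕ.≤ N → N ℕ.+ K ℕ.≤ y ℕ.+ y → x ℕ.+ x ℕ.≤ N ℕ.∸ K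
double-≤-∸ {x} {y} {K} {N} x+y≤N N+K≤2y = ℕ.m+n≤o⇒m≤o∸n (x ℕ.+ x) (ℕ.+-cancelʳ-≤ N _ _ (begin
  x ℕ.+ x ℕ.+ K ℕ.+ N       ≡⟨ ℕR.solve 3 (λ x K N → x ℕR.:+ x ℕR.:+ K ℕR.:+ N ℕR.:= x ℕR.:+ x ℕR.:+ (N ℕR.:+ K)) refl x K N ⟩
  x ℕ.+ x ℕ.+ (N ℕ.+ K)     ≤⟨ ℕ.+-monoʳ-≤ (x ℕ.+ x) N+K≤2y ⟩
  x ℕ.+ x ℕ.+ (y ℕ.+ y)     ≡⟨ ℕR.solve 2 (λ x y → x ℕR.:+ x ℕR.:+ (y ℕR.:+ y) ℕR.:= (x ℕR.:+ y) ℕR.:+ (x ℕR.:+ y)) refl x y ⟩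
  x ℕ.+ y ℕ.+ (x ℕ.+ y)     ≤⟨ ℕ.+-mono-≤ x+y≤N x+y≤N ⟩
  N ℕ.+ N                   ∎))
  where open ℕ.≤-Reasoning

sum-≤-doubles : ∀ {x y T} → x ℕ.+ x ℕ.≤ T → y ℕ.+ y ℕ.≤ T → x ℕ.+ y ℕ.≤ T
sum-≤-doubles {x} {y} 2x≤T 2y≤T with ℕ.≤-total x y
... | inj₁ x≤y = ℕ.≤-trans (ℕ.+-monoˡ-≤ y x≤y) 2y≤T
... | inj₂ y≤x = ℕ.≤-trans (ℕ.+-monoʳ-≤ x y≤x) 2x≤T

-- The contradiction for m ≥ 40

module LargeWheel (p : ℕ) (37≤p : 37 ℕ.≤ p)
                  (f : EdgeLabeling (wheel (4 ℕ.+ p))) (leech : IsGeodesicLeechLabeling (wheel (4 ℕ.+ p)) f) where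
  private
    m = 3 ℕ.+ p
    V = Fin (suc m)
    open WheelGeodesics m
    s = spoke f leech

    N₀ : ℕ
    N₀ = triangle (suc m) ℕ.+ m

    -- As m = p + 3, `z` is m - 40. `t` is the quadratic part shared by all triangular numbers
    -- involved, and cancels from the values of `μ`.
    z t : ℚ
    z = ι p - (ℤ.+ 37 / 1)
    t = ι (triangle p)

    0≤z : 0ℚ ≤ z
    0≤z = ≤⇒0≤- (ι-mono-≤ 37≤p)

    -- 860 = 40 · 43 / 2 is the value of `N₀` at m = 40.
    860≤N₀ : 860 ℕ.≤ N₀
    860≤N₀ = ℕ.+-mono-≤ (triangle-mono {41} (ℕ.+-monoʳ-≤ 4 37≤p)) (ℕ.+-monoʳ-≤ 3 37≤p)

    ι-triangle-1 : ι (triangle (1 ℕ.+ p)) ≡ ι p + t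
    ι-triangle-1 = ι-+ p (triangle p)

    ι-triangle-2 : ι (triangle (2 ℕ.+ p)) ≡ 1ℚ + (ℤ.+ 2 / 1) * ι p + t
    ι-triangle-2 = trans (ι-+ (1 ℕ.+ p) (triangle (1 ℕ.+ p))) (trans (cong (λ q → ι (1 ℕ.+ p) + q) ι-triangle-1)
      (solve 2 (λ p t → con 1ℚ :+ p :+ (p :+ t) := con 1ℚ :+ con (ℤ.+ 2 / 1) :* p :+ t) refl (ι p) t))

    ι-triangle-3 : ι (triangle (3 ℕ.+ p)) ≡ (ℤ.+ 3 / 1) + (ℤ.+ 3 / 1) * ι p + t
    ι-triangle-3 = trans (ι-+ (2 ℕ.+ p) (triangle (2 ℕ.+ p))) (trans (cong (λ q → ι (2 ℕ.+ p) + q) ι-triangle-2)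
      (solve 2 (λ p t → con 1ℚ :+ (con 1ℚ :+ p) :+ (con 1ℚ :+ con (ℤ.+ 2 / 1) :* p :+ t)
          := con (ℤ.+ 3 / 1) :+ con (ℤ.+ 3 / 1) :* p :+ t) refl (ι p) t))

    ι-triangle-4 : ι (triangle (4 ℕ.+ p)) ≡ (ℤ.+ 6 / 1) + (ℤ.+ 4 / 1) * ι p + t
    ι-triangle-4 = trans (ι-+ (3 ℕ.+ p) (triangle (3 ℕ.+ p))) (trans (cong (λ q → ι (3 ℕ.+ p) + q) ι-triangle-3)
      (solve 2 (λ p t → con 1ℚ :+ (con 1ℚ :+ (con 1ℚ :+ p)) :+ (con (ℤ.+ 3 / 1) :+ con (ℤ.+ 3 / 1) :* p :+ t)
          := con (ℤ.+ 6 / 1) :+ con (ℤ.+ 4 / 1) :* p :+ t) refl (ι p) t))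

    ι-N₀ : ι N₀ ≡ (ℤ.+ 9 / 1) + (ℤ.+ 5 / 1) * ι p + t
    ι-N₀ = trans (ι-+ (triangle (suc m)) m) (trans (cong (λ q → q + ι m) ι-triangle-4)
      (solve 2 (λ p t → con (ℤ.+ 6 / 1) :+ con (ℤ.+ 4 / 1) :* p :+ t :+ (con 1ℚ :+ (con 1ℚ :+ (con 1ℚ :+ p)))
          := con (ℤ.+ 9 / 1) :+ con (ℤ.+ 5 / 1) :* p :+ t) refl (ι p) t))

    2*ι-N₀ : (ℤ.+ 2 / 1) * ι N₀ ≡ ((ℤ.+ 40 / 1) + z) * ((ℤ.+ 43 / 1) + z)
    2*ι-N₀ = begin
      (ℤ.+ 2 / 1) * ι N₀                              ≡⟨ cong ((ℤ.+ 2 / 1) *_) ι-N₀ ⟩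
      (ℤ.+ 2 / 1) * ((ℤ.+ 9 / 1) + (ℤ.+ 5 / 1) * ι p + t)               ≡⟨ solve 2 (λ p t → con (ℤ.+ 2 / 1)
          :* (con (ℤ.+ 9 / 1) :+ con (ℤ.+ 5 / 1) :* p :+ t)
          := con (ℤ.+ 18 / 1) :+ con (ℤ.+ 9 / 1) :* p :+ (t :+ t :+ p)) refl (ι p) t ⟩
      (ℤ.+ 18 / 1) + (ℤ.+ 9 / 1) * ι p + (t + t + ι p)         ≡⟨ cong ((ℤ.+ 18 / 1) + (ℤ.+ 9 / 1) * ι p +_)
          (trans (sym (trans (ι-+ (triangle p ℕ.+ triangle p) p) (cong (_+ ι p) (ι-+ (triangle p) (triangle p)))))
                                                  (trans (cong ι (2*triangle p)) (ι-* p p))) ⟩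
      (ℤ.+ 18 / 1) + (ℤ.+ 9 / 1) * ι p + ι p * ι p             ≡⟨ solve 1 (λ p → con (ℤ.+ 18 / 1) :+ con (ℤ.+ 9 / 1)
          :* p :+ p :* p := (con (ℤ.+ 40 / 1) :+ (p :- con (ℤ.+ 37 / 1))) :* (con (ℤ.+ 43 / 1)
          :+ (p :- con (ℤ.+ 37 / 1)))) refl (ι p) ⟩
      ((ℤ.+ 40 / 1) + z) * ((ℤ.+ 43 / 1) + z)                  ∎
      where open ≡-Reasoning

    sum-≤N₀ : ∀ {u v} → u ≢ v → ¬ Rim u v → s u ℕ.+ s v ℕ.≤ N₀
    sum-≤N₀ u≢v ¬r = ℕ.≤-trans (proj₂ (sum-bounds f leech u≢v ¬r)) (N≤ f leech)

    module Spokes {l : List V} {T} (500≤T : 500 ℕ.≤ T) (T≤N₀ : T ℕ.≤ N₀) (unique : Unique l)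
                  (≤T : ∀ {u v} → u ∈ l → v ∈ l → u ≢ v → ¬ Rim u v → s u ℕ.+ s v ℕ.≤ T) where

      P : Packing (map s l) T
      P = packing m f leech unique ≤T

      open Rotation T 500≤T using (χ; error) public
      open RotationKernel T 500≤T using (kernel-lower) public
      open Packing P using (e; μ) public

      e≤ : e ≤ (ℤ.+ 40 / 1) + z
      e≤ = ≤-trans (ι-mono-≤ (packing-rest m f leech unique ≤T))
        (≤-reflexive (solve 1 (λ p → con 1ℚ :+ (con 1ℚ :+ (con 1ℚ :+ p))
            := con (ℤ.+ 40 / 1) :+ (p :- con (ℤ.+ 37 / 1))) refl (ι p)))

      R≤ : error ≤ (ℤ.+ 3 / 20000) * (((ℤ.+ 40 / 1) + z) * ((ℤ.+ 43 / 1) + z))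
      R≤ = ≤-by (positive-constant {ℤ.+ 3 / 10000} ⊗ ≤⇒0≤- (ι-mono-≤ T≤N₀))
        (trans (cong (λ q → (ℤ.+ 3 / 20000) * q - error) (sym 2*ι-N₀))
          (solve 2 (λ n r → con (ℤ.+ 3 / 20000) :* (con (ℤ.+ 2 / 1) :* n) :- con (ℤ.+ 3 / 10000) :* r
              := con (ℤ.+ 3 / 10000) :* (n :- r)) refl (ι N₀) (ι T)))

      μ≡ : ∀ {τ n} → ι (triangle (length (map s l))) ≡ τ → ι T ≡ n → μ ≡ n - τ + e
      μ≡ {τ} {n} τ≡ n≡ = begin
        μ               ≡⟨ solve 2 (λ m τ → m := m :+ τ :- τ) refl μ τ ⟩
        μ + τ - τ       ≡⟨ cong (λ q → q - τ) (trans (cong (μ +_) (sym τ≡)) (packing-size P)) ⟩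
        ι T + e - τ     ≡⟨ cong (λ q → q + e - τ) n≡ ⟩
        n + e - τ       ≡⟨ solve 3 (λ n e τ → n :+ e :- τ := n :- τ :+ e) refl n e τ ⟩
        n - τ + e       ∎
        where open ≡-Reasoning

      kernel-sum : ∀ us → (∀ {u} → u ∈ us → s u ℕ.+ s u ℕ.≤ T) → ι (length (map s us)) ≤ ∑ (kernel χ) (map s us)
      kernel-sum us small = subst (_≤ ∑ (kernel χ) (map s us)) (ℚ.*-identityʳ (ι (length (map s us))))
        (∑-const-≤ (kernel χ) (map s us) λ x∈ → let u , u∈ , eq = ∈-map⁻ s x∈ in
          subst (λ x → 1ℚ ≤ kernel χ x) (sym eq) (kernel-lower (s u) (small u∈)))

      open Numerics 500≤T P 0≤z e≤ R≤ public

  module Sorted {a b c : V} {rest : List V} (unique : Unique (zero ∷ a ∷ b ∷ c ∷ rest)) (len : length (map s rest) ≡ p)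
                (b≤a : s b ℕ.≤ s a) (c≤b : s c ℕ.≤ s b) (rest≤c : ∀ {v} → v ∈ rest → s v ℕ.≤ s c) where
    private
      unique-a = AllPairs.tail unique
      unique-b = AllPairs.tail unique-a
      unique-c = AllPairs.tail unique-b
      a≢b = All.head (AllPairs.head unique-a)
      a≢c = All.head (All.tail (AllPairs.head unique-a))
      b≢c = All.head (AllPairs.head unique-b)
      a≢ : ∀ {v} → v ∈ rest → a ≢ v
      a≢ = All.lookup (All.tail (All.tail (AllPairs.head unique-a)))
      b≢ : ∀ {v} → v ∈ rest → b ≢ v
      b≢ = All.lookup (All.tail (AllPairs.head unique-b))
      c≢ : ∀ {v} → v ∈ rest → c ≢ v
      c≢ = All.lookup (AllPairs.head unique-c)
      zero≢ = AllPairs.head unique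

      -- Among the three vertices with the largest values two are not adjacent, and the sum of their
      -- values is at least that of the two smaller ones.
      c+b≤N₀ : s c ℕ.+ s b ℕ.≤ N₀
      c+b≤N₀ with rim? a b | rim? b c | rim? c a
      ... | no ¬r | _ | _ = ℕ.≤-trans (ℕ.+-mono-≤ (ℕ.≤-trans c≤b b≤a) ℕ.≤-refl) (sum-≤N₀ a≢b ¬r)
      ... | yes _ | no ¬r | _ = subst (ℕ._≤ N₀) (ℕ.+-comm (s b) (s c)) (sum-≤N₀ b≢c ¬r)
      ... | yes _ | yes _ | no ¬r = ℕ.≤-trans (ℕ.+-monoʳ-≤ (s c) b≤a) (sum-≤N₀ (a≢c ∘ sym) ¬r)
      ... | yes ab | yes bc | yes ca = ⊥-elim (rim-triangle m 4≤m ab bc ca)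
        where
        4≤m : 4 ℕ.≤ m
        4≤m = ℕ.+-monoʳ-≤ 3 (ℕ.≤-trans (s≤s z≤n) 37≤p)

      -- `a` has only two rim neighbours, so it is not adjacent to one of `v`, `b` and `c`, of which
      -- `v` has the smallest value.
      rest+a≤N₀ : ∀ {v} → v ∈ rest → s v ℕ.+ s a ℕ.≤ N₀
      rest+a≤N₀ {v} v∈ with rim? a v | rim? a b | rim? a c
      ... | no ¬r | _ | _ = subst (ℕ._≤ N₀) (ℕ.+-comm (s a) (s v)) (sum-≤N₀ (a≢ v∈) ¬r)
      ... | yes _ | no ¬r | _ = ℕ.≤-trans (ℕ.+-monoˡ-≤ (s a) (ℕ.≤-trans (rest≤c v∈) c≤b))
                                  (sum-≤N₀ (a≢b ∘ sym) (¬r ∘ rim-sym))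
      ... | yes _ | yes _ | no ¬r = ℕ.≤-trans (ℕ.+-monoˡ-≤ (s a) (rest≤c v∈)) (sum-≤N₀ (a≢c ∘ sym) (¬r ∘ rim-sym))
      ... | yes av | yes ab | yes ac = ⊥-elim (rim-three m ab ac av b≢c (b≢ v∈) (c≢ v∈))

    -- `a` and `b` are dropped. The interval shortens by 77, but about 2 m pair sums disappear too,
    -- and the bound on `μ` grows by 4 per unit of m instead of 2.
    large-second : N₀ ℕ.+ 77 ℕ.≤ s b ℕ.+ s b → ⊥
    large-second 2b≥ = drop-two-impossible len≡ μ≤
      (≤-trans (≤-reflexive (sym len≡)) (kernel-sum l double))
      where
      l = zero ∷ c ∷ rest
      T = N₀ ℕ.∸ 77
      unique-l : Unique l
      unique-l = All.tail (All.tail zero≢) ∷ unique-c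
      double-c : s c ℕ.+ s c ℕ.≤ T
      double-c = double-≤-∸ {s c} {s b} c+b≤N₀ 2b≥
      double : ∀ {u} → u ∈ l → s u ℕ.+ s u ℕ.≤ T
      double (here refl)         = z≤n
      double (there (here refl)) = double-c
      double (there (there v∈))  = ℕ.≤-trans (ℕ.+-mono-≤ (rest≤c v∈) (rest≤c v∈)) double-c
      open Spokes {l} {T} (ℕ.≤-trans (ℕ.m≤m+n 500 283) (ℕ.∸-monoˡ-≤ 77 860≤N₀)) (ℕ.m∸n≤m N₀ 77) unique-l
        (λ {u} {v} u∈ v∈ _ _ → sum-≤-doubles {s u} {s v} (double u∈) (double v∈))
      len≡ : ι (length (map s l)) ≡ (ℤ.+ 39 / 1) + z
      len≡ = trans (cong (λ n → ι (2 ℕ.+ n)) len) (solve 1 (λ p → con 1ℚ :+ (con 1ℚ :+ p)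
          := con (ℤ.+ 39 / 1) :+ (p :- con (ℤ.+ 37 / 1))) refl (ι p))
      μ≤ : μ ≤ (ℤ.+ 82 / 1) + (ℤ.+ 4 / 1) * z
      μ≤ = ≤-by (≤⇒0≤- e≤) (trans
        (cong (λ q → (ℤ.+ 82 / 1) + (ℤ.+ 4 / 1) * z - q) (μ≡ (trans (cong (λ n → ι (triangle (2 ℕ.+ n))) len) ι-triangle-2)
          (trans (ι-∸ (ℕ.≤-trans (ℕ.m≤m+n 77 783) 860≤N₀)) (cong (λ q → q - (ℤ.+ 77 / 1)) ι-N₀))))
        (solve 3 (λ p t e → con (ℤ.+ 82 / 1) :+ con (ℤ.+ 4 / 1) :* (p :- con (ℤ.+ 37 / 1)) :- (con (ℤ.+ 9 / 1)
            :+ con (ℤ.+ 5 / 1) :* p :+ t :- con (ℤ.+ 77 / 1) :- (con 1ℚ :+ con (ℤ.+ 2 / 1) :* p :+ t) :+ e)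
            := con (ℤ.+ 40 / 1) :+ (p :- con (ℤ.+ 37 / 1)) :- e) refl (ι p) t e))

    -- `b` and `c` may be the two rim neighbours of `a`, so only the vertices of `rest` are forced
    -- below the middle, and `b` and `c` are dropped along with `a`.
    large-first : N₀ ℕ.+ 124 ℕ.≤ s a ℕ.+ s a → ⊥
    large-first 2a≥ = drop-three-impossible len≡ μ≤
      (≤-trans (≤-reflexive (sym len≡)) (kernel-sum l double))
      where
      l = zero ∷ rest
      T = N₀ ℕ.∸ 124
      unique-l : Unique l
      unique-l = All.tail (All.tail (All.tail zero≢)) ∷ AllPairs.tail unique-c
      double : ∀ {u} → u ∈ l → s u ℕ.+ s u ℕ.≤ T
      double (here refl) = z≤n
      double {u} (there v∈) = double-≤-∸ {s u} {s a} (rest+a≤N₀ v∈) 2a≥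
      open Spokes {l} {T} (ℕ.≤-trans (ℕ.m≤m+n 500 236) (ℕ.∸-monoˡ-≤ 124 860≤N₀)) (ℕ.m∸n≤m N₀ 124) unique-l
        (λ {u} {v} u∈ v∈ _ _ → sum-≤-doubles {s u} {s v} (double u∈) (double v∈))
      len≡ : ι (length (map s l)) ≡ (ℤ.+ 38 / 1) + z
      len≡ = trans (cong (λ n → ι (1 ℕ.+ n)) len) (solve 1 (λ p → con 1ℚ :+ p
          := con (ℤ.+ 38 / 1) :+ (p :- con (ℤ.+ 37 / 1))) refl (ι p))
      μ≤ : μ ≤ (ℤ.+ 73 / 1) + (ℤ.+ 5 / 1) * z
      μ≤ = ≤-by (≤⇒0≤- e≤) (trans
        (cong (λ q → (ℤ.+ 73 / 1) + (ℤ.+ 5 / 1) * z - q) (μ≡ (trans (cong (λ n → ι (triangle (1 ℕ.+ n))) len) ι-triangle-1)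
          (trans (ι-∸ (ℕ.≤-trans (ℕ.m≤m+n 124 736) 860≤N₀)) (cong (λ q → q - (ℤ.+ 124 / 1)) ι-N₀))))
        (solve 3 (λ p t e → con (ℤ.+ 73 / 1) :+ con (ℤ.+ 5 / 1) :* (p :- con (ℤ.+ 37 / 1)) :- (con (ℤ.+ 9 / 1)
            :+ con (ℤ.+ 5 / 1) :* p :+ t :- con (ℤ.+ 124 / 1) :- (p :+ t) :+ e)
            := con (ℤ.+ 40 / 1) :+ (p :- con (ℤ.+ 37 / 1)) :- e) refl (ι p) t e))

    -- 62 and 38 are the halves of 124 and 76; together the two outliers lose 16/5 · (62 + 38) = 320
    -- times im χ 1.
    no-large : s a ℕ.+ s a ℕ.≤ N₀ ℕ.+ 124 → s b ℕ.+ s b ℕ.≤ N₀ ℕ.+ 76 → ⊥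
    no-large 2a≤ 2b≤ = all-spokes-impossible len≡ μ≤ w≤ (≤-by
        (≤⇒0≤- (kernel-lower 0 z≤n)
          ⊕ ≤⇒0≤- (kernel-outlier 62 (s a) (ℕ.≤-trans (ℕ.m≤m+n 248 612) 860≤N₀) σ-small 2a≤)
          ⊕ ≤⇒0≤- (kernel-outlier 38 (s b) (ℕ.≤-trans (ℕ.m≤m+n 152 708) 860≤N₀)
              (≤-trans (≤-by (positive-constant {ℤ.+ 24 / 1} ⊗ 0≤im-1) (solve 1 (λ σ → con (ℤ.+ 62 / 1) :* σ
              :- con (ℤ.+ 38 / 1) :* σ := con (ℤ.+ 24 / 1) :* σ) refl σ)) σ-small) 2b≤)
          ⊕ ≤⇒0≤- (kernel-sum (c ∷ rest) double))
        (trans (cong (λ n → kernel χ 0 + (kernel χ (s a) + (kernel χ (s b) + ∑ (kernel χ) (map s (c ∷ rest))))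
            - (n - w)) (sym len≡))
          (solve 6 (λ n k0 ka kb S σ → k0 :+ (ka :+ (kb :+ S)) :- (con 1ℚ :+ (con 1ℚ :+ (con 1ℚ :+ n))
              :- con (ℤ.+ 320 / 1) :* σ) := k0 :- con 1ℚ :+ (ka :- (con 1ℚ :- con (ℤ.+ 16 / 5) :* (con (ℤ.+ 62 / 1)
              :* σ))) :+ (kb :- (con 1ℚ :- con (ℤ.+ 16 / 5) :* (con (ℤ.+ 38 / 1) :* σ))) :+ (S :- n)) refl
             (ι (length (map s (c ∷ rest)))) (kernel χ 0) (kernel χ (s a)) (kernel χ (s b)) (∑ (kernel χ) (map s (c ∷ rest))) σ)))
      where
      l = zero ∷ a ∷ b ∷ c ∷ rest
      500≤N₀ : 500 ℕ.≤ N₀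
      500≤N₀ = ℕ.≤-trans (ℕ.m≤m+n 500 360) 860≤N₀
      double : ∀ {u} → u ∈ c ∷ rest → s u ℕ.+ s u ℕ.≤ N₀
      double (here refl) = ℕ.≤-trans (ℕ.+-monoʳ-≤ (s c) c≤b) c+b≤N₀
      double (there v∈)  = ℕ.≤-trans (ℕ.+-mono-≤ (rest≤c v∈) (ℕ.≤-trans (rest≤c v∈) c≤b)) c+b≤N₀
      open Spokes {l} {N₀} 500≤N₀ ℕ.≤-refl unique (λ _ _ → sum-≤N₀)
      open RotationKernel N₀ 500≤N₀ using (0≤im-1; kernel-outlier)
      open Rotation N₀ 500≤N₀ using (im-χ-1)
      σ = im χ 1
      w = (ℤ.+ 320 / 1) * σ
      -- 62 · 6.283 / 860 is about 0.453, within the range 23/50 allowed by `kernel≥`.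
      σ-small : (ℤ.+ 62 / 1) * σ ≤ (ℤ.+ 23 / 50)
      σ-small = ≤-by
        (positive-constant {ℤ.+ 31 / 430} ⊗ (≤⇒0≤- (ι-mono-≤ 860≤N₀) ⊗ 0≤im-1 ⊕ ≤⇒0≤- im-χ-1)
            ⊕ positive-constant {ℤ.+ 3027 / 430000})
        (solve 2 (λ n σ → con (ℤ.+ 23 / 50) :- con (ℤ.+ 62 / 1) :* σ
            := con (ℤ.+ 31 / 430) :* ((n :- con (ℤ.+ 860 / 1)) :* σ :+ (con (ℤ.+ 6283 / 1000) :- n :* σ))
            :+ con (ℤ.+ 3027 / 430000)) refl (ι N₀) σ)
      -- Since 2 N₀ = (40 + z)(43 + z) and N₀ σ ≤ 6283/1000, the left side is at most 288 · 6.283 /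
      -- (43 + z), which at z = 0 is just below the constant. The proof first inserts 2 N₀ - 2 N₀
      -- and rewrites one copy.
      w≤ : (ℤ.+ 9 / 20) * ((ℤ.+ 40 / 1) + z) * w ≤ (ℤ.+ 10521 / 250)
      w≤ = ≤-by
        (positive-constant {ℤ.+ 288 / 43} ⊗ ≤⇒0≤- im-χ-1 ⊕ positive-constant {ℤ.+ 144 / 43}
            ⊗ ((positive-constant {ℤ.+ 40 / 1} ⊕ 0≤z) ⊗ 0≤z ⊗ 0≤im-1) ⊕ positive-constant {ℤ.+ 27 / 10750})
        (trans (solve 3 (λ z n σ → con (ℤ.+ 10521 / 250) :- con (ℤ.+ 9 / 20) :* (con (ℤ.+ 40 / 1) :+ z)
            :* (con (ℤ.+ 320 / 1) :* σ) := con (ℤ.+ 10521 / 250) :- con (ℤ.+ 144 / 1) :* (con (ℤ.+ 40 / 1) :+ z) :* σ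
            :+ con (ℤ.+ 144 / 43) :* (con (ℤ.+ 2 / 1) :* n :- con (ℤ.+ 2 / 1) :* n) :* σ) refl z (ι N₀) σ)
          (trans (cong (λ q → (ℤ.+ 10521 / 250) - (ℤ.+ 144 / 1) * ((ℤ.+ 40 / 1) + z) * σ + (ℤ.+ 144 / 43) * (q
              - (ℤ.+ 2 / 1) * ι N₀) * σ) 2*ι-N₀)
            (solve 3 (λ z n σ → con (ℤ.+ 10521 / 250) :- con (ℤ.+ 144 / 1) :* (con (ℤ.+ 40 / 1) :+ z) :* σ
                :+ con (ℤ.+ 144 / 43) :* ((con (ℤ.+ 40 / 1) :+ z) :* (con (ℤ.+ 43 / 1) :+ z) :- con (ℤ.+ 2 / 1) :* n)
                :* σ := con (ℤ.+ 288 / 43) :* (con (ℤ.+ 6283 / 1000) :- n :* σ) :+ con (ℤ.+ 144 / 43)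
                :* ((con (ℤ.+ 40 / 1) :+ z) :* z :* σ) :+ con (ℤ.+ 27 / 10750)) refl z (ι N₀) σ)))
      len≡ : ι (length (map s l)) ≡ (ℤ.+ 41 / 1) + z
      len≡ = trans (cong (λ n → ι (4 ℕ.+ n)) len) (solve 1 (λ p → con 1ℚ :+ (con 1ℚ :+ (con 1ℚ :+ (con 1ℚ :+ p)))
          := con (ℤ.+ 41 / 1) :+ (p :- con (ℤ.+ 37 / 1))) refl (ι p))
      μ≤ : μ ≤ (ℤ.+ 80 / 1) + (ℤ.+ 2 / 1) * z
      μ≤ = ≤-by (≤⇒0≤- e≤) (trans
        (cong (λ q → (ℤ.+ 80 / 1) + (ℤ.+ 2 / 1) * z - q) (μ≡ (trans (cong (λ n → ι (triangle (4 ℕ.+ n))) len) ι-triangle-4) ι-N₀))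
        (solve 3 (λ p t e → con (ℤ.+ 80 / 1) :+ con (ℤ.+ 2 / 1) :* (p :- con (ℤ.+ 37 / 1)) :- (con (ℤ.+ 9 / 1)
            :+ con (ℤ.+ 5 / 1) :* p :+ t :- (con (ℤ.+ 6 / 1) :+ con (ℤ.+ 4 / 1) :* p :+ t) :+ e)
            := con (ℤ.+ 40 / 1) :+ (p :- con (ℤ.+ 37 / 1)) :- e) refl (ι p) t e))

    impossible : ⊥
    impossible with N₀ ℕ.+ 77 ℕ.≤? s b ℕ.+ s b | N₀ ℕ.+ 124 ℕ.≤? s a ℕ.+ s a
    ... | yes 2b≥ | _       = large-second 2b≥
    ... | no _    | yes 2a≥ = large-first 2a≥
    -- Failure of the first threshold gives the bound N₀ + 76, with 76 = 2 · 38; for the second, N₀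
    -- + 123 is rounded up to the even excess 124.
    ... | no ¬2b≥ | no ¬2a≥ = no-large (ℕ.<⇒≤ (ℕ.≰⇒> ¬2a≥)) (ℕ.≤-pred (subst (suc (s b ℕ.+ s b) ℕ.≤_) (ℕ.+-suc N₀ 76) (ℕ.≰⇒> ¬2b≥)))

  impossible : ⊥
  impossible with top-three s {p} (map suc (fins m)) (trans (length-map suc (fins m)) (length-fins m))
  ... | a , b , c , rest , perm , len , b≤a , c≤b , rest≤c =
    Sorted.impossible (unique-resp-↭ (Perm.prep zero perm) (fins-unique (suc m))) (trans (length-map s rest) len)
      b≤a c≤b (All.lookup rest≤c)

theorem1p1 : (n : ℕ) → 5 ℕ.≤ n → IsGeodesicLeech (wheel n) → n ℕ.≤ 40
theorem1p1 n _ (f , leech) with n ℕ.≤? 40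
... | yes n≤40 = n≤40
... | no n≰40 = ⊥-elim (large n f leech (ℕ.≰⇒> n≰40))
  where
  large : ∀ n (f : EdgeLabeling (wheel n)) → IsGeodesicLeechLabeling (wheel n) f → 41 ℕ.≤ n → ⊥
  large (suc (suc (suc (suc p)))) f leech (s≤s (s≤s (s≤s (s≤s 37≤p)))) = LargeWheel.impossible p 37≤p f leech
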